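{- Let $p$ be a prime, $q$ a power of $p$, and $r$ a power of $p$ ($r=p^a$ with an integer $a\ge 1$). Let $\mathbf{m}=(m_j)_{j\ge 0}$ be a sequence of integers with $m_0=1$ and $m_j\ge 2$ for all integers $j\ge 1$. For each integer $j\ge 0$ put $r_j:=r^{m_0m_1\cdots m_j}$ and $\alpha_j(r,\mathbf{m}):=\sum_{n=1}^{\infty}T^{ -r_j^n}\in\mathbb{F}_q((T^{ -1}))$, where $r_j^n=(r_j)^n$. Then the Laurent series $\xi(r,\mathbf{m}):=\sum_{j=0}^{\infty}\alpha_j(r,\mathbf{m})\in\mathbb{F}_q((T^{ -1}))$ is both a $T$-number and a $T^{*}$-number.
   Context: $\mathbb{F}_q$ is the finite field with $q$ elements and $\mathbb{F}_q((T^{ -1}))$ is the field of Laurent series in $T^{ -1}$ over $\mathbb{F}_q$. For nonzero $\xi=\sum_{n=N}^{\infty}a_nT^{ -n}\in\mathbb{F}_q((T^{ -1}))$ with $N\in\mathbb{Z}$, $a_n\in\mathbb{F}_q$, $a_N\neq 0$, put $|\xi|:=q^{ -N}$, and $|0|:=0$; this absolute value extends uniquely to the algebraic closure of $\mathbb{F}_q((T^{ -1}))$, and the extension is also denoted $|\cdot|$. $\overline{\mathbb{F}_q(T)}$ is the algebraic closure of $\mathbb{F}_q(T)$ inside the algebraic closure of $\mathbb{F}_q((T^{ -1}))$. Infinite series converge with respect to $|\cdot|$ (the series defining $\xi(r,\mathbf{m})$ converges since $|\alpha_j(r,\mathbf{m})|\to 0$). The height $H(P)$ of a polynomial $P(X)\in(\mathbb{F}_q[T])[X]$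 is the maximum of the absolute values of its coefficients. For $\alpha\in\overline{\mathbb{F}_q(T)}$, its minimal polynomial is the unique non-constant, irreducible, primitive polynomial $P(X)\in(\mathbb{F}_q[T])[X]$ whose leading coefficient is a monic polynomial in $T$ and with $P(\alpha)=0$; the height $H(\alpha)$ and the degree $\deg\alpha$ are the height and the degree (in $X$) of this polynomial. For an integer $n\ge 1$ and $\xi\in\mathbb{F}_q((T^{ -1}))$, $w_n(\xi)$ (resp. $w_n^{*}(\xi)$) denotes the supremum in $\mathbb{R}\cup\{+\infty\}$ of the real numbers $w$ (resp. $w^{*}$) such that $0<|P(\xi)|\le H(P)^{ -w}$ for infinitely many $P(X)\in(\mathbb{F}_q[T])[X]$ of degree at most $n$ (resp. $0<|\xi-\alpha|\le H(\alpha)^{ -w^{*}-1}$ for infinitely many $\alpha\in\overline{\mathbb{F}_q(T)}$ of degree at most $n$). Put $w(\xi):=\limsup_{n\to\infty}w_n(\xi)/n$ and $w^{*}(\xi):=\limsup_{n\to\infty}w_n^{*}(\xi)/n$. $\xi$ is a $T$-number if $w(\xi)=+\infty$ and $w_n(\xi)<+\infty$ for all integers $n\ge 1$; $\xi$ is a $T^{*}$-number if $w^{*}(\xi)=+\infty$ and $w_n^{*}(\xi)<+\infty$ for all integers $n\ge 1$. -}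

module Defs where

open import Algebra.Bundles using (CommutativeRing)
open import Algebra.Bundles.Raw using (RawRing)
import Algebra.Definitions.RawMonoid as RawMonoidDefs
import Algebra.Definitions.RawSemiring as RawSemiringDefs
open import Algebra.Morphism.Structures using (IsRingHomomorphism)
open import Data.Fin.Base using (Fin; toℕ)
open import Data.Integer.Base as ℤ using (ℤ; +_; -[1+_])
open import Data.List.Base using (List; []; _∷_; map)
open import Data.List.Relation.Unary.Any using (Any)
open import Data.Nat.Base as ℕ using (ℕ; zero; suc; _∸_; _^_)
open import Data.Product.Base using (∃; ∃-syntax; _×_)
open import Data.Rational.Base as ℚ using (ℚ; _/_; 1ℚ)
open import Data.Sum.Base using (_⊎_)
open import Function.Base using (id)
open import Function.Bundles using (Inverse)
open import Level using (Level; _⊔_) renaming (suc to lsuc)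
open import Relation.Binary.Construct.Add.Infimum.NonStrict ℚ._≤_ using (_≤₋_)
open import Relation.Binary.Core using (Rel)
open import Relation.Binary.PropositionalEquality.Core using (_≡_)
open import Relation.Binary.PropositionalEquality.Properties using (setoid)
open import Relation.Nullary.Construct.Add.Infimum using (_₋; ⊥₋; [_])
open import Relation.Nullary.Negation.Core using (¬_)
open import Relation.Unary using (Pred)

private
  variable
    a b c ℓ c₁ ℓ₁ c₂ ℓ₂ : Level

-- Infinitely many elements, counted up to _≈_.
Infinitely : {A : Set a} → Rel A ℓ → Pred A b → Set (a ⊔ ℓ ⊔ b)
Infinitely _≈_ P = ∀ xs → ∃[ x ] P x × ¬ Any (x ≈_) xs

------------------------------------------------------------------------
-- Extended reals

-- x ∈ ℝ ∪ {±∞} is represented by its rational lower cut { q ∣ q < x }.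
-- Only suprema, division by positive integers, upper limits and
-- comparison with +∞ are used, and all of them are definable on lower cuts.
ExtReal : (ℓ : Level) → Set (lsuc ℓ)
ExtReal ℓ = Pred ℚ ℓ

sup : Pred ℚ ℓ → ExtReal ℓ
sup S q = ∃[ s ] S s × q ℚ.< s

_÷_ : ExtReal ℓ → (n : ℕ) .{{_ : ℕ.NonZero n}} → ExtReal ℓ
(x ÷ n) q = x (q ℚ.* (+ n / 1))

limsup : (ℕ → ExtReal ℓ) → ExtReal ℓ
limsup x q = ∃[ q′ ] q ℚ.< q′ × (∀ N → ∃[ n ] N ℕ.≤ n × x n q′)

_≡+∞ : ExtReal ℓ → Set ℓ
x ≡+∞ = ∀ q → x q

_<+∞ : ExtReal ℓ → Set ℓ
x <+∞ = ∃[ B ] ¬ x B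

------------------------------------------------------------------------
-- Fields

record IsField (R : CommutativeRing c ℓ) : Set (c ⊔ ℓ) where
  open CommutativeRing R
  field
    1≉0     : 1# ≉ 0#
    inverse : ∀ x → x ≉ 0# → ∃[ y ] x * y ≈ 1#

record FiniteField (q : ℕ) c ℓ : Set (lsuc (c ⊔ ℓ)) where
  field
    commutativeRing : CommutativeRing c ℓ
    isField         : IsField commutativeRing
    enumeration     : Inverse (setoid (Fin q)) (CommutativeRing.setoid commutativeRing)

  open CommutativeRing commutativeRing public using (rawRing)

------------------------------------------------------------------------
-- Univariate polynomials

module Polynomial (R : RawRing c ℓ) where
  open RawRing R

  -- Coefficients in order of increasing degree; trailing zeros are allowed.
  Poly : Set c
  Poly = List Carrier

  coeff : Poly → ℕ → Carrier
  coeff []      _       = 0#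
  coeff (a ∷ _) zero    = a
  coeff (_ ∷ p) (suc i) = coeff p i

  infixl 6 _+ₚ_
  infixl 7 _*ₚ_

  _+ₚ_ : Poly → Poly → Poly
  []      +ₚ q       = q
  (a ∷ p) +ₚ []      = a ∷ p
  (a ∷ p) +ₚ (b ∷ q) = (a + b) ∷ (p +ₚ q)

  _*ₚ_ : Poly → Poly → Poly
  []      *ₚ q = []
  (a ∷ p) *ₚ q = map (a *_) q +ₚ (0# ∷ (p *ₚ q))

  polyRawRing : RawRing c ℓ
  polyRawRing = record
    { Carrier = Poly
    ; _≈_     = λ p q → ∀ i → coeff p i ≈ coeff q i
    ; _+_     = _+ₚ_
    ; _*_     = _*ₚ_
    ; -_      = map (-_)
    ; 0#      = []
    ; 1#      = 1# ∷ []
    }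

  DegreeAtMost : ℕ → Poly → Set ℓ
  DegreeAtMost n p = ∀ i → n ℕ.< i → coeff p i ≈ 0#

  HasDegree : Poly → ℕ → Set ℓ
  HasDegree p d = DegreeAtMost d p × coeff p d ≉ 0#

  Monic : Poly → Set ℓ
  Monic p = ∃[ d ] HasDegree p d × coeff p d ≈ 1#

  eval : (S : RawRing c₁ ℓ₁) → (Carrier → RawRing.Carrier S) →
         Poly → RawRing.Carrier S → RawRing.Carrier S
  eval S ι []      x = RawRing.0# S
  eval S ι (a ∷ p) x = ι a S.+ x S.* eval S ι p x
    where module S = RawRing S

------------------------------------------------------------------------
-- Laurent series in T⁻¹

module LaurentSeries (k : RawRing c ℓ) where
  open RawRing k
  open RawMonoidDefs +-rawMonoid using (sum)

  -- Σ_{i ≥ 0} digit i · T^{-(start + i)}; leading digits may vanish.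
  record Laurent : Set c where
    constructor laurent
    field
      start : ℤ
      digit : ℕ → Carrier

  open Laurent

  -- coefficient ξ n is the coefficient of T⁻ⁿ.
  coefficient : Laurent → ℤ → Carrier
  coefficient ξ n with n ℤ.- start ξ
  ... | + i      = digit ξ i
  ... | -[1+ _ ] = 0#

  infixl 6 _+ₗ_
  infixl 7 _*ₗ_

  _+ₗ_ : Laurent → Laurent → Laurent
  ξ +ₗ η = laurent s λ i →
             coefficient ξ (s ℤ.+ + i) + coefficient η (s ℤ.+ + i)
    where s = start ξ ℤ.⊓ start η

  _*ₗ_ : Laurent → Laurent → Laurent
  ξ *ₗ η = laurent (start ξ ℤ.+ start η) λ n →
             sum {suc n} (λ i → digit ξ (toℕ i) * digit η (n ∸ toℕ i))

  constant : Carrier → Laurent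
  constant a = laurent (+ 0) λ { zero → a ; (suc _) → 0# }

  -- T^[ e ] = Tᵉ
  T^[_] : ℤ → Laurent
  T^[ e ] = laurent (ℤ.- e) λ { zero → 1# ; (suc _) → 0# }

  laurentRawRing : RawRing c ℓ
  laurentRawRing = record
    { Carrier = Laurent
    ; _≈_     = λ ξ η → ∀ n → coefficient ξ n ≈ coefficient η n
    ; _+_     = _+ₗ_
    ; _*_     = _*ₗ_
    ; -_      = λ ξ → laurent (start ξ) (λ i → - digit ξ i)
    ; 0#      = constant 0#
    ; 1#      = constant 1#
    }

  infix 4 ∣_∣≤q^_ ∣_∣≡q^_

  -- The absolute value is q^{-N} where T^{-N} is the leading term, so it is
  -- recorded through its exponent; ∣ 0 ∣ = 0 satisfies every upper bound.
  ∣_∣≤q^_ : Laurent → ℤ → Set ℓ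
  ∣ ξ ∣≤q^ e = ∀ n → n ℤ.< ℤ.- e → coefficient ξ n ≈ 0#

  ∣_∣≡q^_ : Laurent → ℤ → Set ℓ
  ∣ ξ ∣≡q^ e = ∣ ξ ∣≤q^ e × coefficient ξ (ℤ.- e) ≉ 0#

  partialSum : (ℕ → Laurent) → ℕ → Laurent
  partialSum f zero    = constant 0#
  partialSum f (suc n) = partialSum f n +ₗ f n

  -- s = Σ_{n ≥ 0} f n with respect to ∣_∣.
  HasSum : (ℕ → Laurent) → Laurent → Set ℓ
  HasSum f s = ∀ (M : ℕ) → ∃[ N ] ∀ n → N ℕ.≤ n →
    ∣ partialSum f n +ₗ RawRing.-_ laurentRawRing s ∣≤q^ (ℤ.- + M)

------------------------------------------------------------------------
-- Algebraic closure of the field of Laurent series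

module _ (k : RawRing c ℓ) where
  open LaurentSeries k using (Laurent; laurentRawRing; ∣_∣≡q^_)

  record AlgebraicClosure c₁ ℓ₁ : Set (c ⊔ ℓ ⊔ lsuc (c₁ ⊔ ℓ₁)) where
    field
      commutativeRing : CommutativeRing c₁ ℓ₁
      isField         : IsField commutativeRing

    open CommutativeRing commutativeRing public
    private
      module L[X] = Polynomial laurentRawRing
      module Ω[X] = Polynomial rawRing

    field
      ι                   : Laurent → Carrier
      ι-isHomomorphism    : IsRingHomomorphism laurentRawRing rawRing ι
      algebraic           : ∀ x → ∃[ P ] ∃[ d ]
                              L[X].HasDegree P d × L[X].eval rawRing ι P x ≈ 0#
      algebraicallyClosed : ∀ P d → 1 ℕ.≤ d → Ω[X].HasDegree P d →
                              ∃[ x ] Ω[X].eval rawRing id P x ≈ 0#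

  infixl 6 _+₋_

  _+₋_ : ℚ ₋ → ℚ ₋ → ℚ ₋
  [ x ] +₋ [ y ] = [ x ℚ.+ y ]
  [ _ ] +₋ ⊥₋    = ⊥₋
  ⊥₋    +₋ _     = ⊥₋

  -- log∣ x ∣ is the logarithm to base q of ∣ x ∣, with ⊥₋ standing for log 0.
  -- It is rational for the extension of ∣_∣ to the algebraic closure, since
  -- ∣ x ∣ᵈ is the absolute value of a norm when x has degree d.
  record AbsoluteValue (Ω : AlgebraicClosure c₁ ℓ₁) : Set (c ⊔ ℓ ⊔ c₁ ⊔ ℓ₁) where
    open AlgebraicClosure Ω
    field
      log∣_∣      : Carrier → ℚ ₋
      log-cong    : ∀ {x y} → x ≈ y → log∣ x ∣ ≡ log∣ y ∣
      log-0       : log∣ 0# ∣ ≡ ⊥₋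
      log-⊥⇒0     : ∀ x → log∣ x ∣ ≡ ⊥₋ → x ≈ 0#
      log-*       : ∀ x y → log∣ x * y ∣ ≡ log∣ x ∣ +₋ log∣ y ∣
      ultrametric : ∀ x y → log∣ x + y ∣ ≤₋ log∣ x ∣ ⊎ log∣ x + y ∣ ≤₋ log∣ y ∣
      extends     : ∀ ξ e → ∣ ξ ∣≡q^ e → log∣ ι ξ ∣ ≡ [ e / 1 ]

------------------------------------------------------------------------
-- Diophantine exponents

module Exponents (k : RawRing c ℓ) where
  open LaurentSeries k

  module k[T] = Polynomial k
  module k[T][X] = Polynomial k[T].polyRawRing

  private
    module A = RawRing k[T].polyRawRing
    module A[X] = RawRing k[T][X].polyRawRing

  embed : k[T].Poly → Laurent
  embed p = k[T].eval laurentRawRing constant p T^[ + 1 ]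

  infix 8 _⟨_⟩
  _⟨_⟩ : k[T][X].Poly → Laurent → Laurent
  P ⟨ ξ ⟩ = k[T][X].eval laurentRawRing embed P ξ

  -- H(P) = q^h; this forces P to be nonzero.
  HasHeight : k[T][X].Poly → ℤ → Set ℓ
  HasHeight P h = (∀ i → ∣ embed (k[T][X].coeff P i) ∣≤q^ h)
                × (∃[ i ] ∣ embed (k[T][X].coeff P i) ∣≡q^ h)

  -- The conditions with exponents w and w* are written for the logarithms to
  -- base q of both sides.  It suffices to let w and w* be rational: as heights
  -- are at least 1, the sets of admissible exponents are downward closed.
  WSet : ℕ → Laurent → Pred ℚ (c ⊔ ℓ)
  WSet n ξ w = Infinitely A[X]._≈_ λ P →
    k[T][X].DegreeAtMost n P ×
    ∃[ h ] ∃[ e ] HasHeight P h × ∣ P ⟨ ξ ⟩ ∣≡q^ e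
                × e / 1 ℚ.≤ (ℚ.- w) ℚ.* (h / 1)

  wₙ : ℕ → Laurent → ExtReal (c ⊔ ℓ)
  wₙ n ξ = sup (WSet n ξ)

  w : Laurent → ExtReal (c ⊔ ℓ)
  w ξ = limsup λ n → wₙ (suc n) ξ ÷ suc n

  IsTNumber : Laurent → Set (c ⊔ ℓ)
  IsTNumber ξ = w ξ ≡+∞ × (∀ n → 1 ℕ.≤ n → wₙ n ξ <+∞)

  Primitive : k[T][X].Poly → Set (c ⊔ ℓ)
  Primitive P = ∀ d → (∀ i → d ∣ k[T][X].coeff P i) → d ∣ A.1#
    where open RawSemiringDefs A.rawSemiring using (_∣_)

  module _ (Ω : AlgebraicClosure k c₁ ℓ₁) (abs : AbsoluteValue k Ω) where
    private module Ω = AlgebraicClosure Ω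
    open AbsoluteValue abs using (log∣_∣)

    -- An element of Ω lies in the algebraic closure of k(T) exactly when it
    -- has a minimal polynomial in this sense.
    record IsMinimalPolynomial (P : k[T][X].Poly) (α : Ω.Carrier)
                               : Set (c ⊔ ℓ ⊔ ℓ₁) where
      open RawSemiringDefs A[X].rawSemiring using (Irreducible)
      field
        degree       : ℕ
        hasDegree    : k[T][X].HasDegree P degree
        nonConstant  : 1 ℕ.≤ degree
        irreducible  : Irreducible P
        isPrimitive  : Primitive P
        leadingMonic : k[T].Monic (k[T][X].coeff P degree)
        root         : k[T][X].eval Ω.rawRing (λ a → Ω.ι (embed a)) P α Ω.≈ Ω.0#

    W*Set : ℕ → Laurent → Pred ℚ (c ⊔ ℓ ⊔ c₁ ⊔ ℓ₁)
    W*Set n ξ w* = Infinitely Ω._≈_ λ α →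
      ∃[ P ] IsMinimalPolynomial P α × k[T][X].DegreeAtMost n P ×
      ∃[ h ] ∃[ e ] HasHeight P h × log∣ Ω.ι ξ Ω.- α ∣ ≡ [ e ]
                  × e ℚ.≤ (ℚ.- w* ℚ.- 1ℚ) ℚ.* (h / 1)

    w*ₙ : ℕ → Laurent → ExtReal (c ⊔ ℓ ⊔ c₁ ⊔ ℓ₁)
    w*ₙ n ξ = sup (W*Set n ξ)

    w* : Laurent → ExtReal (c ⊔ ℓ ⊔ c₁ ⊔ ℓ₁)
    w* ξ = limsup λ n → w*ₙ (suc n) ξ ÷ suc n

    IsT*Number : Laurent → Set (c ⊔ ℓ ⊔ c₁ ⊔ ℓ₁)
    IsT*Number ξ = w* ξ ≡+∞ × (∀ n → 1 ℕ.≤ n → w*ₙ n ξ <+∞)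

------------------------------------------------------------------------
-- The numbers r_j

∏≤ : (ℕ → ℕ) → ℕ → ℕ
∏≤ m zero    = m zero
∏≤ m (suc j) = ∏≤ m j ℕ.* m (suc j)

r[_,_]_ : ℕ → (ℕ → ℕ) → ℕ → ℕ
r[ r , m ] j = r ^ ∏≤ m j

module _ (k : RawRing c ℓ) where
  open LaurentSeries k

  -- ξ is the sum over j ≥ 0 of the series α_j = Σ_{n ≥ 1} T^{-r_jⁿ}.
  IsXi : ℕ → (ℕ → ℕ) → Laurent → Set (c ⊔ ℓ)
  IsXi r m ξ = ∃[ α ]
      (∀ j → HasSum (λ n → T^[ ℤ.- + ((r[ r , m ] j) ^ suc n) ]) (α j))
    × HasSum α ξ

{-# OPTIONS --safe #-}

-- Write d = r_j, R = r_{j+1} and M_i = m_0 ⋯ m_i.  By Frobenius, ξ_j = α_0 + … + α_j satisfies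
-- ξ_j^d − ξ_j ∈ k[T⁻¹], and all exponents of ξ − ξ_j are powers of R: the coefficient of T^{−R^k}
-- is the number of i > j with M_i ∣ k M_{j+1}, taken modulo p.  Truncating ξ − ξ_j after T^{−R^k}
-- yields β with β^d − β ∈ T^{−d R^k} k[T].
--
-- Lower bounds.  For suitable arbitrarily large k the coefficient of T^{−R^{k+1}} is p · 1 = 0 and
-- that of T^{−R^{k+2}} is 1.  Then ∣ξ − β∣ = q^{−R^{k+2}} while β has degree at most d and height at
-- most q^{d R^k}, so that w_d(ξ) and w*_d(ξ) are at least R²/d − 1 ≥ d².
--
-- Upper bounds.  Let P have degree n < d.  Linear algebra gives N ≠ 0 of degree at most n, of height
-- polynomial in that of P, with P(X) ∣ N(X^d − X).  If ∣P(ξ)∣ is very small, so is ∣N(ξ^d − ξ)∣.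
-- Truncations after T^{−R^k} with m_{j+2} ∣ k give rational approximations β^d − β of ξ^d − ξ which
-- are so good, because R ≥ d² > n d, that N has to vanish at n + 1 of them.  Hence ∣P(ξ)∣ is bounded
-- below by a fixed power of the height of P, which bounds w_n(ξ), and w*_n(ξ) because
-- ∣P(ξ)∣ ≤ ∣ξ − α∣ H(P) for a root α of P close to ξ.

module Submission where

open import Algebra.Bundles using (CommutativeRing; RawRing)
import Algebra.Definitions.RawMagma as RawMagmaDefs
import Algebra.Definitions.RawMonoid as RawMonoidDefs
import Algebra.Definitions.RawSemiring as RawSemiringDefs
import Algebra.Morphism.Construct.Composition as Composition
import Algebra.Morphism.RingMonomorphism as RingMono
open import Algebra.Morphism.Structures using (IsRingMonomorphism; IsRingHomomorphism)
import Algebra.Properties.AbelianGroup as AbelianGroupProperties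
import Algebra.Properties.CommutativeMonoid.Sum as CommutativeMonoidSum
import Algebra.Properties.CommutativeSemigroup as CommutativeSemigroupProperties
import Algebra.Properties.CommutativeSemiring.Binomial as BinomialTheorem
import Algebra.Properties.Monoid.Mult as MonoidMult
import Algebra.Properties.Monoid.Mult.TCOptimised as MonoidMult′
import Algebra.Properties.Ring as RingProperties
import Algebra.Properties.Semiring.Exp as SemiringExp
import Algebra.Properties.Semiring.Mult as SemiringMult
import Algebra.Properties.Semiring.Sum as SemiringSum
import Algebra.Solver.Ring as RingSolver
open import Algebra.Solver.Ring.AlmostCommutativeRing using (_-Raw-AlmostCommutative⟶_; fromCommutativeRing)
open import Data.Empty using (⊥; ⊥-elim)
open import Data.Fin.Base as Fin using (Fin; toℕ; fromℕ; inject₁; splitAt; _↑ˡ_; _↑ʳ_; punchIn)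
open import Data.Fin.Permutation using (Permutation; permutation; _⟨$⟩ʳ_)
import Data.Fin.Properties as Fin
open import Data.Integer.Base as ℤ using (ℤ; +_; -[1+_])
import Data.Integer.Properties as ℤ
open import Data.Integer.Solver using (module +-*-Solver)
open import Data.List.Base as List using (List; []; _∷_; map; _++_; replicate; length; tabulate; applyUpTo; cartesianProductWith; allFin)
open import Data.List.Membership.Propositional.Properties using (∈-allFin)
import Data.List.Properties as List
open import Data.List.Relation.Unary.All as All using (All; []; _∷_)
import Data.List.Relation.Unary.All.Properties as All
open import Data.List.Relation.Unary.AllPairs using (AllPairs; []; _∷_)
import Data.List.Relation.Unary.AllPairs.Properties as AllPairs
open import Data.List.Relation.Unary.Any as Any using (Any; here; there)
import Data.List.Relation.Unary.Any.Properties as Any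
open import Data.Maybe.Base using (Maybe; nothing; just)
open import Data.Nat.Base as ℕ using (ℕ; zero; suc; _∸_; _!)
open import Data.Nat.Combinatorics using (nCn≡1; nCk≡n!/k![n-k]!; k![n∸k]!∣n!) renaming (_C_ to _choose_)
open import Data.Nat.DivMod using (m/n*n≡m)
open import Data.Nat.Divisibility using (_∣_; divides; ∣1⇒≡1; ∣⇒≤; ∣m⇒∣m*n; ∣-refl; ∣-trans; ∣m+n∣m⇒∣n; *-cancelˡ-∣; 1∣_)
open import Data.Nat.Primality using (Prime; euclidsLemma; prime⇒nonZero; ¬prime[1]; prime⇒nonTrivial)
import Data.Nat.Properties as ℕ
open import Data.Nat.Solver using () renaming (module +-*-Solver to ℕ-Solver)
open import Data.Product.Base using (_,_; _×_; ∃-syntax; proj₁; proj₂; Σ)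
open import Data.Rational.Base as ℚ using (ℚ; mkℚ; _/_; 1ℚ; toℚᵘ)
import Data.Rational.Properties as ℚ
open import Data.Rational.Unnormalised.Base as ℚᵘ using (mkℚᵘ; *<*; *≤*)
import Data.Rational.Unnormalised.Properties as ℚᵘ
open import Data.Sum.Base using (_⊎_; inj₁; inj₂; [_,_]′)
open import Data.Vec.Functional using (insertAt)
open import Data.Vec.Functional.Properties using (insertAt-lookup; insertAt-punchIn)
open import Defs
open import Function.Base using (_∘_; id)
open import Function.Bundles using (Inverse)
open import Level using (_⊔_) renaming (suc to lsuc)
open import Relation.Binary.Bundles using (Setoid)
open import Relation.Binary.Construct.Add.Infimum.NonStrict ℚ._≤_ using (_≤₋_; ⊥₋≤_; ≤₋-trans; ≤₋-dec; [≤]-injective) renaming ([_] to [_]≤)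
open import Relation.Binary.Core using (Rel)
open import Relation.Binary.Definitions using (tri<; tri≈; tri>)
open import Relation.Binary.PropositionalEquality as ≡ using (_≡_)
import Relation.Binary.Reasoning.Setoid as SetoidReasoning
open import Relation.Nullary using (¬_; Dec; yes; no; ¬?)
open import Relation.Nullary.Construct.Add.Infimum using (_₋; ⊥₋; [_])
open import Relation.Nullary.Decidable using (map′; decidable-stable; _×-dec_)
open import Relation.Unary using (Pred)

-- The `β` are merely algebraic, so a value `P(β)` cannot be bounded below by counting denominators.
-- Passing to `N` transports the question to `β^d − β`, which is rational: with `B = R^k`, the value
-- of `N` there lies in `T^(−n d B) k[T]`, hence is zero or at least `q^(−n d B)` in absolute value.
-- The polynomial `N(Y)` stands in for the resultant of `P(X)` and `X^d − X − Y` with respect to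
-- `X`; a relation found by elimination is enough, because only its degree and height matter.
--
-- The resulting lower bound for `∣P(ξ)∣` is `q^(−C (H + 1))` when `P` has height `q^H`. Its
-- exponent is not proportional to `H` at `H = 0`, so polynomials with coefficients in `k` have to
-- be set aside. For each degree there are finitely many of them, and they, respectively their
-- roots, form the list that `Infinitely` is asked to avoid. The list of roots is obtained only up
-- to double negation, which is harmless because it serves to derive a contradiction.

-- Ring predicates and a solver for identities in commutative rings

module _ {c ℓ} (R : CommutativeRing c ℓ) where
  open CommutativeRing R renaming (_*_ to _·_)
  open MonoidMult +-monoid using () renaming (_×_ to _×ₘ_)

  Nontrivial DecidableZero IsDomain HasInverses IsFinite : Set _
  Nontrivial    = ¬ 1# ≈ 0#
  DecidableZero = ∀ x → Dec (x ≈ 0#)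
  IsDomain      = ∀ {x y} → x · y ≈ 0# → x ≈ 0# ⊎ y ≈ 0#
  HasInverses   = ∀ x → ¬ x ≈ 0# → ∃[ y ] x · y ≈ 1#
  IsFinite      = ∃[ xs ] ∀ x → Any (x ≈_) xs

  Characteristic : ℕ → Set _
  Characteristic p = p ×ₘ 1# ≈ 0#

-- Integer coefficients a − b are represented by pairs (a , b).
module IntegerCoefficients {c ℓ} (R : CommutativeRing c ℓ) where
  open CommutativeRing R renaming (_*_ to _·_) hiding (zero)
  open SetoidReasoning setoid
  open MonoidMult +-monoid using (×-homo-+; ×-congˡ) renaming (_×_ to _×ₘ_)
  open MonoidMult′ +-monoid using (×ᵤ≈×) renaming (_×_ to _×′_)
  open SemiringMult semiring using (×1-homo-*)
  open AbelianGroupProperties +-abelianGroup using (⁻¹-∙-comm; ⁻¹-anti-homo‿-)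
  open RingProperties ring using (-‿distribˡ-*; -‿distribʳ-*; -0#≈0#)
  open CommutativeSemigroupProperties +-commutativeSemigroup using (interchange)

  coefficients : RawRing _ _
  coefficients = record
    { Carrier = ℕ × ℕ
    ; _≈_ = ≡._≡_
    ; _+_ = λ (a , b) (c , d) → a ℕ.+ c , b ℕ.+ d
    ; _*_ = λ (a , b) (c , d) → a ℕ.* c ℕ.+ b ℕ.* d , a ℕ.* d ℕ.+ b ℕ.* c
    ; -_  = λ (a , b) → b , a
    ; 0#  = 0 , 0
    ; 1#  = 1 , 0
    }

  ⟦_⟧ : ℕ × ℕ → Carrier
  ⟦ a , zero ⟧  = a ×′ 1#
  ⟦ a , suc b ⟧ = a ×′ 1# - suc b ×′ 1#

  ⟦⟧≈ : ∀ a b → ⟦ a , b ⟧ ≈ a ×ₘ 1# - b ×ₘ 1#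
  ⟦⟧≈ a zero    = sym (trans (+-cong (×ᵤ≈× a 1#) -0#≈0#) (+-identityʳ _))
  ⟦⟧≈ a (suc b) = sym (+-cong (×ᵤ≈× a 1#) (-‿cong (×ᵤ≈× (suc b) 1#)))

  interchange- : ∀ a b c d → (a + c) - (b + d) ≈ (a - b) + (c - d)
  interchange- a b c d = trans (+-congˡ (sym (⁻¹-∙-comm b d))) (interchange a c (- b) (- d))

  expand : ∀ a b c d → (a - b) · (c - d) ≈ (a · c + b · d) - (a · d + b · c)
  expand a b c d = begin
    (a - b) · (c - d) ≈⟨ distribʳ _ _ _ ⟩
    a · (c - d) + - b · (c - d) ≈⟨ +-cong (distribˡ _ _ _) (sym (-‿distribˡ-* _ _)) ⟩
    (a · c + a · - d) - b · (c - d) ≈⟨ +-cong (+-congˡ (sym (-‿distribʳ-* _ _)))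
         (-‿cong (trans (distribˡ _ _ _) (+-congˡ (sym (-‿distribʳ-* _ _))))) ⟩
    (a · c - a · d) - (b · c - b · d) ≈⟨ +-congˡ (⁻¹-anti-homo‿- _ _) ⟩
    (a · c - a · d) + (b · d - b · c) ≈⟨ interchange- _ _ _ _ ⟨
    (a · c + b · d) - (a · d + b · c) ∎

  morphism : coefficients -Raw-AlmostCommutative⟶ fromCommutativeRing R
  morphism = record
    { ⟦_⟧    = ⟦_⟧
    ; +-homo = λ (a , b) (c , d) → begin
        ⟦ a ℕ.+ c , b ℕ.+ d ⟧ ≈⟨ ⟦⟧≈ (a ℕ.+ c) (b ℕ.+ d) ⟩
        (a ℕ.+ c) ×ₘ 1# - (b ℕ.+ d) ×ₘ 1# ≈⟨ +-cong (×-homo-+ 1# a c) (-‿cong (×-homo-+ 1# b d)) ⟩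
        (a ×ₘ 1# + c ×ₘ 1#) - (b ×ₘ 1# + d ×ₘ 1#) ≈⟨ interchange- _ _ _ _ ⟩
        (a ×ₘ 1# - b ×ₘ 1#) + (c ×ₘ 1# - d ×ₘ 1#) ≈⟨ +-cong (⟦⟧≈ a b) (⟦⟧≈ c d) ⟨
        ⟦ a , b ⟧ + ⟦ c , d ⟧ ∎
    ; *-homo = λ (a , b) (c , d) → begin
        ⟦ a ℕ.* c ℕ.+ b ℕ.* d , a ℕ.* d ℕ.+ b ℕ.* c ⟧ ≈⟨ ⟦⟧≈ (a ℕ.* c ℕ.+ b ℕ.* d) (a ℕ.* d ℕ.+ b ℕ.* c) ⟩
        (a ℕ.* c ℕ.+ b ℕ.* d) ×ₘ 1# - (a ℕ.* d ℕ.+ b ℕ.* c) ×ₘ 1# ≈⟨ +-cong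
             (trans (×-homo-+ 1# (a ℕ.* c) _) (+-cong (×1-homo-* a c) (×1-homo-* b d)))
             (-‿cong (trans (×-homo-+ 1# (a ℕ.* d) _) (+-cong (×1-homo-* a d) (×1-homo-* b c)))) ⟩
        _ ≈⟨ expand _ _ _ _ ⟨
        (a ×ₘ 1# - b ×ₘ 1#) · (c ×ₘ 1# - d ×ₘ 1#) ≈⟨ *-cong (⟦⟧≈ a b) (⟦⟧≈ c d) ⟨
        ⟦ a , b ⟧ · ⟦ c , d ⟧ ∎
    ; -‿homo = λ (a , b) → begin
        ⟦ b , a ⟧ ≈⟨ ⟦⟧≈ b a ⟩
        b ×ₘ 1# - a ×ₘ 1# ≈⟨ ⁻¹-anti-homo‿- _ _ ⟨
        - (a ×ₘ 1# - b ×ₘ 1#) ≈⟨ -‿cong (⟦⟧≈ a b) ⟨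
        - ⟦ a , b ⟧ ∎
    ; 0-homo = refl
    ; 1-homo = refl
    }

  ⟦⟧-cong : ∀ a b c d → a ℕ.+ d ≡.≡ c ℕ.+ b → ⟦ a , b ⟧ ≈ ⟦ c , d ⟧
  ⟦⟧-cong a b c d eq = begin
    ⟦ a , b ⟧ ≈⟨ ⟦⟧≈ a b ⟩
    a ×ₘ 1# - b ×ₘ 1# ≈⟨ +-identityʳ _ ⟨
    (a ×ₘ 1# - b ×ₘ 1#) + 0# ≈⟨ +-congˡ (-‿inverseʳ (d ×ₘ 1#)) ⟨
    (a ×ₘ 1# - b ×ₘ 1#) + (d ×ₘ 1# - d ×ₘ 1#) ≈⟨ interchange- _ _ _ _ ⟨
    (a ×ₘ 1# + d ×ₘ 1#) - (b ×ₘ 1# + d ×ₘ 1#) ≈⟨ +-cong (×-homo-+ 1# a d) (-‿cong (+-comm _ _)) ⟨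
    (a ℕ.+ d) ×ₘ 1# - (d ×ₘ 1# + b ×ₘ 1#) ≈⟨ +-congʳ (×-congˡ eq) ⟩
    (c ℕ.+ b) ×ₘ 1# - (d ×ₘ 1# + b ×ₘ 1#) ≈⟨ +-congʳ (×-homo-+ 1# c b) ⟩
    (c ×ₘ 1# + b ×ₘ 1#) - (d ×ₘ 1# + b ×ₘ 1#) ≈⟨ interchange- _ _ _ _ ⟩
    (c ×ₘ 1# - d ×ₘ 1#) + (b ×ₘ 1# - b ×ₘ 1#) ≈⟨ +-congˡ (-‿inverseʳ _) ⟩
    (c ×ₘ 1# - d ×ₘ 1#) + 0# ≈⟨ +-identityʳ _ ⟩
    c ×ₘ 1# - d ×ₘ 1# ≈⟨ ⟦⟧≈ c d ⟨
    ⟦ c , d ⟧ ∎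

  _coeff≟_ : ∀ (x y : ℕ × ℕ) → Maybe (⟦ x ⟧ ≈ ⟦ y ⟧)
  (a , b) coeff≟ (c , d) with a ℕ.+ d ℕ.≟ c ℕ.+ b
  ... | yes eq = just (⟦⟧-cong a b c d eq)
  ... | no _   = nothing

module Solver {c ℓ} (R : CommutativeRing c ℓ) where
  open IntegerCoefficients R using (coefficients; morphism; _coeff≟_)
  private module RS = RingSolver coefficients (fromCommutativeRing R) morphism _coeff≟_
  open RS public using (solve; _:=_; _:+_; _:*_; :-_; _:-_)

  :0 :1 : ∀ {n} → RS.Polynomial n
  :0 = RS.con (0 , 0)
  :1 = RS.con (1 , 0)

-- Formal power series and polynomials over a commutative ring

module Series {c ℓ} (R : CommutativeRing c ℓ) where
  open CommutativeRing R hiding (zero)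
  open RawMonoidDefs +-rawMonoid using (sum)
  open SetoidReasoning setoid
  open Polynomial rawRing

  open Solver R

  Fun : Set c
  Fun = ℕ → Carrier

  tail : Fun → Fun
  tail f n = f (suc n)

  conv : Fun → Fun → Fun
  conv f g n = sum {suc n} (λ i → f (toℕ i) * g (n ∸ toℕ i))

  infix 4 _≐_
  _≐_ : Fun → Fun → Set ℓ
  f ≐ g = ∀ i → f i ≈ g i

  conv-cong : ∀ {f f′ g g′} → f ≐ f′ → g ≐ g′ → conv f g ≐ conv f′ g′
  conv-cong e e′ zero    = +-congʳ (*-cong (e 0) (e′ 0))
  conv-cong e e′ (suc n) = +-cong (*-cong (e 0) (e′ (suc n))) (conv-cong (e ∘ suc) e′ n)

  -- By definition the sum unfolds at the first coefficient of `f`; commutativity also needs it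
  -- unfolded at the other end, at the first coefficient of `g`.
  conv-sucʳ : ∀ f g n → conv f g (suc n) ≈ conv f (tail g) n + f (suc n) * g 0
  conv-sucʳ f g zero = lemma (f 0 * g 1) (f 1 * g 0)
    where lemma = solve 2 (λ a b → a :+ (b :+ :0) := (a :+ :0) :+ b) refl
  conv-sucʳ f g (suc n) = trans (+-congˡ (conv-sucʳ (tail f) g n)) (sym (+-assoc _ _ _))

  conv-comm : ∀ f g → conv f g ≐ conv g f
  conv-comm f g zero    = +-congʳ (*-comm _ _)
  conv-comm f g (suc n) = begin
    f 0 * g (suc n) + conv (tail f) g n ≈⟨ +-cong (*-comm _ _) (conv-comm (tail f) g n) ⟩
    g (suc n) * f 0 + conv g (tail f) n ≈⟨ +-comm _ _ ⟩
    conv g (tail f) n + g (suc n) * f 0 ≈⟨ conv-sucʳ g f n ⟨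
    conv g f (suc n) ∎

  conv-zeroˡ : ∀ f g → (∀ i → f i ≈ 0#) → ∀ n → conv f g n ≈ 0#
  conv-zeroˡ f g e zero    = trans (+-identityʳ _) (trans (*-congʳ (e 0)) (zeroˡ _))
  conv-zeroˡ f g e (suc n) =
    trans (+-cong (trans (*-congʳ (e 0)) (zeroˡ _)) (conv-zeroˡ (tail f) g (e ∘ suc) n)) (+-identityˡ _)

  conv-distribʳ : ∀ h f g n → conv (λ i → f i + g i) h n ≈ conv f h n + conv g h n
  conv-distribʳ h f g zero = lemma (f 0) (g 0) (h 0)
    where lemma = solve 3 (λ a b c → (a :+ b) :* c :+ :0 := (a :* c :+ :0) :+ (b :* c :+ :0)) refl
  conv-distribʳ h f g (suc n) =
    trans (+-congˡ (conv-distribʳ h (tail f) (tail g) n)) (lemma (f 0) (g 0) (h (suc n)) _ _)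
    where lemma = solve 5 (λ a b c u v → (a :+ b) :* c :+ (u :+ v) := (a :* c :+ u) :+ (b :* c :+ v)) refl

  conv-scaleˡ : ∀ a f g n → conv (λ i → a * f i) g n ≈ a * conv f g n
  conv-scaleˡ a f g zero = lemma a (f 0) (g 0)
    where lemma = solve 3 (λ a b c → (a :* b) :* c :+ :0 := a :* (b :* c :+ :0)) refl
  conv-scaleˡ a f g (suc n) =
    trans (+-congˡ (conv-scaleˡ a (tail f) g n)) (lemma a (f 0) (g (suc n)) _)
    where lemma = solve 4 (λ a b c u → (a :* b) :* c :+ a :* u := a :* (b :* c :+ u)) refl

  conv-assoc : ∀ f g h n → conv (conv f g) h n ≈ conv f (conv g h) n
  conv-assoc f g h zero = lemma (f 0) (g 0) (h 0)
    where lemma = solve 3 (λ a b c → (a :* b :+ :0) :* c :+ :0 := a :* (b :* c :+ :0) :+ :0) refl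
  conv-assoc f g h (suc n) = begin
    (f 0 * g 0 + 0#) * h (suc n) + conv (λ i → f 0 * g (suc i) + conv (tail f) g i) h n
      ≈⟨ +-congˡ (conv-distribʳ h (λ i → f 0 * g (suc i)) (conv (tail f) g) n) ⟩
    (f 0 * g 0 + 0#) * h (suc n) + (conv (λ i → f 0 * g (suc i)) h n + conv (conv (tail f) g) h n)
      ≈⟨ +-congˡ (+-cong (conv-scaleˡ (f 0) (tail g) h n) (conv-assoc (tail f) g h n)) ⟩
    (f 0 * g 0 + 0#) * h (suc n) + (f 0 * conv (tail g) h n + conv (tail f) (conv g h) n)
      ≈⟨ lemma (f 0) (g 0) (h (suc n)) _ _ ⟩
    f 0 * (g 0 * h (suc n) + conv (tail g) h n) + conv (tail f) (conv g h) n ∎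
    where lemma = solve 5 (λ a b c u v → (a :* b :+ :0) :* c :+ (a :* u :+ v) := a :* (b :* c :+ u) :+ v) refl

  one : Fun
  one = coeff (1# ∷ [])

  conv-identityˡ : ∀ g → conv one g ≐ g
  conv-identityˡ g zero    = trans (+-identityʳ _) (*-identityˡ _)
  conv-identityˡ g (suc n) =
    trans (+-cong (*-identityˡ _) (conv-zeroˡ (tail one) g (λ _ → refl) n)) (+-identityʳ _)

  seriesRing : CommutativeRing c ℓ
  seriesRing = record
    { Carrier = Fun
    ; _≈_     = _≐_
    ; _+_     = λ f g i → f i + g i
    ; _*_     = conv
    ; -_      = λ f i → - f i
    ; 0#      = λ _ → 0#
    ; 1#      = one
    ; isCommutativeRing = record
      { isRing = record
        { +-isAbelianGroup = record
          { isGroup = record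
            { isMonoid = record
              { isSemigroup = record
                { isMagma = record
                  { isEquivalence = record
                    { refl = λ _ → refl ; sym = λ e i → sym (e i) ; trans = λ e e′ i → trans (e i) (e′ i) }
                  ; ∙-cong = λ e e′ i → +-cong (e i) (e′ i)
                  }
                ; assoc = λ f g h i → +-assoc _ _ _
                }
              ; identity = (λ f i → +-identityˡ _) , (λ f i → +-identityʳ _)
              }
            ; inverse = (λ f i → -‿inverseˡ _) , (λ f i → -‿inverseʳ _)
            ; ⁻¹-cong = λ e i → -‿cong (e i)
            }
          ; comm = λ f g i → +-comm _ _
          }
        ; *-cong = conv-cong
        ; *-assoc = conv-assoc
        ; *-identity = conv-identityˡ , λ f i → trans (conv-comm f one i) (conv-identityˡ f i)
        ; distrib = (λ f g h i → trans (conv-comm f (λ j → g j + h j) i) (trans (conv-distribʳ f g h i)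
                                   (+-cong (conv-comm g f i) (conv-comm h f i))))
                  , conv-distribʳ
        }
      ; *-comm = conv-comm
      }
    }

  coeff-+ : ∀ p q i → coeff (p +ₚ q) i ≈ coeff p i + coeff q i
  coeff-+ []      q       i       = sym (+-identityˡ _)
  coeff-+ (a ∷ p) []      i       = sym (+-identityʳ _)
  coeff-+ (a ∷ p) (b ∷ q) zero    = refl
  coeff-+ (a ∷ p) (b ∷ q) (suc i) = coeff-+ p q i

  coeff-map : ∀ (φ : Carrier → Carrier) → φ 0# ≈ 0# → ∀ p i → coeff (map φ p) i ≈ φ (coeff p i)
  coeff-map φ φ0 []      i       = sym φ0
  coeff-map φ φ0 (a ∷ p) zero    = refl
  coeff-map φ φ0 (a ∷ p) (suc i) = coeff-map φ φ0 p i

  coeff-* : ∀ p q i → coeff (p *ₚ q) i ≈ conv (coeff p) (coeff q) i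
  coeff-* []      q i       = sym (conv-zeroˡ (λ _ → 0#) (coeff q) (λ _ → refl) i)
  coeff-* (a ∷ p) q zero    = trans (coeff-+ (map (a *_) q) (0# ∷ (p *ₚ q)) 0) (+-congʳ (coeff-map (a *_) (zeroʳ a) q 0))
  coeff-* (a ∷ p) q (suc i) = trans (coeff-+ (map (a *_) q) (0# ∷ (p *ₚ q)) (suc i))
                                (+-cong (coeff-map (a *_) (zeroʳ a) q (suc i)) (coeff-* p q i))

  -0≈0 : - 0# ≈ 0#
  -0≈0 = solve 0 (:- :0 := :0) refl

  -- Polynomial equality is coefficientwise by definition, so injectivity costs nothing, and the
  -- ring laws of `polyRing` are pulled back from power series instead of being proved on lists.
  coeff-isRingMonomorphism : IsRingMonomorphism polyRawRing (CommutativeRing.rawRing seriesRing) coeff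
  coeff-isRingMonomorphism = record
    { isRingHomomorphism = record
      { isSemiringHomomorphism = record
        { isNearSemiringHomomorphism = record
          { +-isMonoidHomomorphism = record
            { isMagmaHomomorphism = record
              { isRelHomomorphism = record { cong = λ e → e }
              ; homo = coeff-+
              }
            ; ε-homo = λ _ → refl
            }
          ; *-homo = coeff-*
          }
        ; 1#-homo = λ _ → refl
        }
      ; -‿homo = λ p i → coeff-map (-_) -0≈0 p i
      }
    ; injective = λ e → e
    }

  polyRing : CommutativeRing c ℓ
  polyRing = record
    { isCommutativeRing = RingMono.isCommutativeRing coeff-isRingMonomorphism
                            (CommutativeRing.isCommutativeRing seriesRing) }

-- The ring of Laurent series

module LaurentRing {c ℓ} (K : CommutativeRing c ℓ) where
  open CommutativeRing K hiding (zero) renaming (rawRing to k)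
  open Series K
  open LaurentSeries k
  open Laurent
  private module 𝕃 = RawRing laurentRawRing

  at : Fun → ℤ → Carrier
  at f (+ i)      = f i
  at f (-[1+ _ ]) = 0#

  coefficient-at : ∀ ξ n z → n ℤ.- start ξ ≡ z → coefficient ξ n ≡ at (digit ξ) z
  coefficient-at ξ n z eq with n ℤ.- start ξ
  coefficient-at ξ n _ ≡.refl | + i      = ≡.refl
  coefficient-at ξ n _ ≡.refl | -[1+ i ] = ≡.refl

  m+n-m≡n : ∀ m n → m ℤ.+ n ℤ.- m ≡ n
  m+n-m≡n = solve 2 (λ m n → m :+ n :- m := n) ≡.refl
    where open +-*-Solver

  coefficient-digit : ∀ ξ i → coefficient ξ (start ξ ℤ.+ + i) ≡ digit ξ i
  coefficient-digit ξ i = coefficient-at ξ (start ξ ℤ.+ + i) (+ i) (m+n-m≡n (start ξ) (+ i))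

  coefficient-below : ∀ ξ {n} → n ℤ.< start ξ → coefficient ξ n ≡ 0#
  coefficient-below ξ {n} n<s with n ℤ.- start ξ in eq
  ... | -[1+ i ] = ≡.refl
  ... | + i with () ← ℤ.<⇒≱ n<s (ℤ.0≤i-j⇒j≤i (≡.subst (ℤ.0ℤ ℤ.≤_) (≡.sym eq) (ℤ.+≤+ ℕ.z≤n)))

  -- Wrapping coefficientwise equality in a record keeps `ξ` and `η` recoverable by unification.
  infix 4 _≃_
  record _≃_ (ξ η : Laurent) : Set ℓ where
    constructor mk
    field coef≈ : ξ 𝕃.≈ η
  open _≃_

  ≃-setoid : Setoid _ _
  ≃-setoid = record
    { Carrier = Laurent ; _≈_ = _≃_
    ; isEquivalence = record
      { refl = mk λ _ → refl ; sym = λ (mk e) → mk λ n → sym (e n)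
      ; trans = λ (mk e) (mk e′) → mk λ n → trans (e n) (e′ n) } }
  module ≃ = Setoid ≃-setoid
  open SetoidReasoning ≃-setoid hiding (start)

  coefficient-+ : ∀ ξ η n → coefficient (ξ +ₗ η) n ≈ coefficient ξ n + coefficient η n
  coefficient-+ ξ η n with n ℤ.- (start ξ ℤ.⊓ start η) in eq
  ... | + i = reflexive (≡.cong (λ n → coefficient ξ n + coefficient η n) n≡)
    where
    s = start ξ ℤ.⊓ start η
    n≡ : s ℤ.+ + i ≡ n
    n≡ = ≡.trans (≡.cong (ℤ._+_ s) (≡.sym eq)) (lemma s n)
      where open +-*-Solver
            lemma : ∀ s n → s ℤ.+ (n ℤ.- s) ≡ n
            lemma = solve 2 (λ s n → s :+ (n :- s) := n) ≡.refl
  ... | -[1+ i ] = sym (trans (+-cong (reflexive (coefficient-below ξ (ℤ.<-≤-trans n<s (ℤ.i⊓j≤i (start ξ) (start η)))))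
                                      (reflexive (coefficient-below η (ℤ.<-≤-trans n<s (ℤ.i⊓j≤j (start ξ) (start η))))))
                        (+-identityˡ 0#))
    where
    n<s : n ℤ.< start ξ ℤ.⊓ start η
    n<s = ℤ.≰⇒> λ s≤n → ℤ.<⇒≱ (≡.subst (ℤ._< ℤ.0ℤ) (≡.sym eq) ℤ.-<+) (ℤ.i≤j⇒0≤j-i s≤n)

  laurent-cong : ∀ {s s′ f f′} → s ≡ s′ → f ≐ f′ → laurent s f ≃ laurent s′ f′
  laurent-cong {s} {f = f} {f′} ≡.refl e = mk coef
    where
    coef : ∀ n → coefficient (laurent s f) n ≈ coefficient (laurent s f′) n
    coef n with n ℤ.- s
    ... | + i      = e i
    ... | -[1+ _ ] = refl

  cons0 : Fun → Fun
  cons0 f zero    = 0#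
  cons0 f (suc n) = f n

  -- The same series with one more leading zero. Equal series may have different starts, whereas
  -- multiplication is defined on digits; lowering two series to a common start turns equality into
  -- equality of digits and addition into addition of digits.
  lower : Laurent → Laurent
  lower ξ = laurent (ℤ.pred (start ξ)) (cons0 (digit ξ))

  lower-≃ : ∀ ξ → lower ξ ≃ ξ
  lower-≃ ξ = mk λ n → trans (reflexive (coefficient-at (lower ξ) n _ (lemma n (start ξ))))
                         (trans (step (n ℤ.- start ξ)) (sym (reflexive (coefficient-at ξ n _ ≡.refl))))
    where
    lemma : ∀ n s → n ℤ.- ℤ.pred s ≡ ℤ.suc (n ℤ.- s)
    lemma = solve 2 (λ n s → n :- (con ℤ.-1ℤ :+ s) := con ℤ.1ℤ :+ (n :- s)) ≡.refl
      where open +-*-Solver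
    step : ∀ z → at (cons0 (digit ξ)) (ℤ.suc z) ≈ at (digit ξ) z
    step (+ i)          = refl
    step -[1+ zero ]    = refl
    step -[1+ suc i ]   = refl

  lower-* : ∀ ξ η → lower ξ *ₗ η ≃ ξ *ₗ η
  lower-* ξ η = ≃.trans (laurent-cong (ℤ.pred-+ (start ξ) (start η)) digits) (lower-≃ (ξ *ₗ η))
    where
    digits : conv (cons0 (digit ξ)) (digit η) ≐ cons0 (conv (digit ξ) (digit η))
    digits zero    = trans (+-identityʳ _) (zeroˡ _)
    digits (suc n) = trans (+-congʳ (zeroˡ _)) (+-identityˡ _)

  lowers : ℕ → Laurent → Laurent
  lowers zero    ξ = ξ
  lowers (suc m) ξ = lower (lowers m ξ)

  lowers-≃ : ∀ m ξ → lowers m ξ ≃ ξ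
  lowers-≃ zero    ξ = ≃.refl
  lowers-≃ (suc m) ξ = ≃.trans (lower-≃ (lowers m ξ)) (lowers-≃ m ξ)

  lowers-* : ∀ m ξ η → lowers m ξ *ₗ η ≃ ξ *ₗ η
  lowers-* zero    ξ η = ≃.refl
  lowers-* (suc m) ξ η = ≃.trans (lower-* (lowers m ξ) η) (lowers-* m ξ η)

  start-lowers : ∀ m ξ → start (lowers m ξ) ≡ start ξ ℤ.- + m
  start-lowers zero    ξ = ≡.sym (ℤ.+-identityʳ _)
  start-lowers (suc m) ξ = ≡.trans (≡.cong ℤ.pred (start-lowers m ξ)) (lemma (start ξ) (+ m))
    where
    lemma : ∀ s m → ℤ.pred (s ℤ.- m) ≡ s ℤ.- (ℤ.1ℤ ℤ.+ m)
    lemma = solve 2 (λ s m → con ℤ.-1ℤ :+ (s :- m) := s :- (con ℤ.1ℤ :+ m)) ≡.refl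
      where open +-*-Solver

  commonStart : ∀ ξ η → ∃[ i ] ∃[ j ] start (lowers i ξ) ≡ start (lowers j η)
  commonStart ξ η with start ξ ℤ.- start η in eq
  ... | + i      = i , 0 , ≡.trans (start-lowers i ξ)
                     (≡.trans (≡.cong (ℤ._-_ (start ξ)) (≡.sym eq)) (lemma (start ξ) (start η)))
    where lemma : ∀ s t → s ℤ.- (s ℤ.- t) ≡ t
          lemma = solve 2 (λ s t → s :- (s :- t) := t) ≡.refl
            where open +-*-Solver
  ... | -[1+ i ] = 0 , suc i , ≡.sym (≡.trans (start-lowers (suc i) η)
                     (≡.trans (≡.cong (ℤ._+_ (start η)) (≡.sym eq)) (lemma (start ξ) (start η))))
    where lemma : ∀ s t → t ℤ.+ (s ℤ.- t) ≡ s
          lemma = solve 2 (λ s t → t :+ (s :- t) := s) ≡.refl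
            where open +-*-Solver

  *ₗ-congʳ : ∀ {ξ ξ′} η → ξ ≃ ξ′ → ξ *ₗ η ≃ ξ′ *ₗ η
  *ₗ-congʳ {ξ} {ξ′} η e with commonStart ξ ξ′
  ... | i , j , eq = begin
    ξ *ₗ η ≈⟨ lowers-* i ξ η ⟨
    ξ₁ *ₗ η ≈⟨ laurent-cong (≡.cong (ℤ._+ start η) eq) (conv-cong digits (λ _ → refl)) ⟩
    ξ₂ *ₗ η ≈⟨ lowers-* j ξ′ η ⟩
    ξ′ *ₗ η ∎
    where
    ξ₁ = lowers i ξ
    ξ₂ = lowers j ξ′
    e′ : ξ₁ ≃ ξ₂
    e′ = ≃.trans (lowers-≃ i ξ) (≃.trans e (≃.sym (lowers-≃ j ξ′)))
    digits : digit ξ₁ ≐ digit ξ₂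
    digits n = trans (reflexive (≡.sym (coefficient-digit ξ₁ n)))
                 (trans (coef≈ e′ (start ξ₁ ℤ.+ + n))
                   (reflexive (≡.trans (≡.cong (λ s → coefficient ξ₂ (s ℤ.+ + n)) eq) (coefficient-digit ξ₂ n))))

  *ₗ-comm : ∀ ξ η → ξ *ₗ η ≃ η *ₗ ξ
  *ₗ-comm ξ η = laurent-cong (ℤ.+-comm (start ξ) (start η)) (conv-comm (digit ξ) (digit η))

  *ₗ-cong : ∀ {ξ ξ′ η η′} → ξ ≃ ξ′ → η ≃ η′ → ξ *ₗ η ≃ ξ′ *ₗ η′
  *ₗ-cong {ξ} {ξ′} {η} {η′} e e′ = begin
    ξ *ₗ η   ≈⟨ *ₗ-congʳ η e ⟩
    ξ′ *ₗ η  ≈⟨ *ₗ-comm ξ′ η ⟩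
    η *ₗ ξ′  ≈⟨ *ₗ-congʳ ξ′ e′ ⟩
    η′ *ₗ ξ′ ≈⟨ *ₗ-comm η′ ξ′ ⟩
    ξ′ *ₗ η′ ∎

  *ₗ-assoc : ∀ ξ η ζ → (ξ *ₗ η) *ₗ ζ ≃ ξ *ₗ (η *ₗ ζ)
  *ₗ-assoc ξ η ζ = laurent-cong (ℤ.+-assoc (start ξ) (start η) (start ζ)) (conv-assoc (digit ξ) (digit η) (digit ζ))

  +ₗ-cong : ∀ {ξ ξ′ η η′} → ξ ≃ ξ′ → η ≃ η′ → ξ +ₗ η ≃ ξ′ +ₗ η′
  +ₗ-cong {ξ} {ξ′} {η} {η′} (mk e) (mk e′) = mk λ n →
    trans (coefficient-+ ξ η n) (trans (+-cong (e n) (e′ n)) (sym (coefficient-+ ξ′ η′ n)))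

  laurent-+ : ∀ s f g → laurent s f +ₗ laurent s g ≃ laurent s (λ i → f i + g i)
  laurent-+ s f g = mk λ n → trans (coefficient-+ (laurent s f) (laurent s g) n) (coef n)
    where
    coef : ∀ n → coefficient (laurent s f) n + coefficient (laurent s g) n ≈ coefficient (laurent s (λ i → f i + g i)) n
    coef n with n ℤ.- s
    ... | + i      = refl
    ... | -[1+ _ ] = +-identityˡ 0#

  *ₗ-distribʳ : ∀ ζ ξ η → (ξ +ₗ η) *ₗ ζ ≃ ξ *ₗ ζ +ₗ η *ₗ ζ
  *ₗ-distribʳ ζ ξ η with commonStart ξ η
  ... | i , j , eq = begin
    (ξ +ₗ η) *ₗ ζ    ≈⟨ *ₗ-congʳ ζ (+ₗ-cong (lowers-≃ i ξ) (lowers-≃ j η)) ⟨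
    (ξ₁ +ₗ η₁) *ₗ ζ  ≈⟨ *ₗ-congʳ {ξ₁ +ₗ η₁} {ξ₁ +ₗ η₂} ζ (+ₗ-cong {ξ₁} {ξ₁} ≃.refl η₁≃) ⟩
    (ξ₁ +ₗ η₂) *ₗ ζ  ≈⟨ *ₗ-congʳ ζ (laurent-+ (start ξ₁) (digit ξ₁) (digit η₁)) ⟩
    laurent (start ξ₁) (λ i → digit ξ₁ i + digit η₁ i) *ₗ ζ
      ≈⟨ laurent-cong ≡.refl (conv-distribʳ (digit ζ) (digit ξ₁) (digit η₁)) ⟩
    laurent (start ξ₁ ℤ.+ start ζ) (λ i → conv (digit ξ₁) (digit ζ) i + conv (digit η₁) (digit ζ) i)
      ≈⟨ laurent-+ (start ξ₁ ℤ.+ start ζ) _ _ ⟨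
    ξ₁ *ₗ ζ +ₗ η₂ *ₗ ζ ≈⟨ +ₗ-cong (lowers-* i ξ ζ) (≃.trans (*ₗ-congʳ ζ (≃.sym η₁≃)) (lowers-* j η ζ)) ⟩
    ξ *ₗ ζ +ₗ η *ₗ ζ ∎
    where
    ξ₁ = lowers i ξ
    η₁ = lowers j η
    η₂ = laurent (start ξ₁) (digit η₁)
    η₁≃ : η₁ ≃ η₂
    η₁≃ = laurent-cong (≡.sym eq) (λ _ → refl)

  *ₗ-identityˡ : ∀ ξ → constant 1# *ₗ ξ ≃ ξ
  *ₗ-identityˡ ξ = laurent-cong (ℤ.+-identityˡ (start ξ)) λ n →
    trans (conv-cong {g = digit ξ} one≐ (λ _ → refl) n) (conv-identityˡ (digit ξ) n)
    where
    one≐ : digit (constant 1#) ≐ one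
    one≐ zero    = refl
    one≐ (suc _) = refl

  coefficient-0 : ∀ n → coefficient (constant 0#) n ≈ 0#
  coefficient-0 n with n ℤ.- + 0
  ... | + zero   = refl
  ... | + suc _  = refl
  ... | -[1+ _ ] = refl

  coefficient-neg : ∀ ξ n → coefficient (𝕃.- ξ) n ≈ - coefficient ξ n
  coefficient-neg ξ n with n ℤ.- start ξ
  ... | + _      = refl
  ... | -[1+ _ ] = sym -0≈0

  laurentRing : CommutativeRing c ℓ
  laurentRing = record
    { Carrier = Laurent
    ; _≈_     = 𝕃._≈_
    ; _+_     = _+ₗ_
    ; _*_     = _*ₗ_
    ; -_      = 𝕃.-_
    ; 0#      = 𝕃.0#
    ; 1#      = 𝕃.1#
    ; isCommutativeRing = record
      { isRing = record
        { +-isAbelianGroup = record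
          { isGroup = record
            { isMonoid = record
              { isSemigroup = record
                { isMagma = record
                  { isEquivalence = record
                    { refl = λ _ → refl ; sym = λ e n → sym (e n) ; trans = λ e e′ n → trans (e n) (e′ n) }
                  ; ∙-cong = λ {ξ} {ξ′} {η} {η′} e e′ → coef≈ (+ₗ-cong {ξ} {ξ′} {η} {η′} (mk e) (mk e′))
                  }
                ; assoc = λ ξ η ζ n → trans (trans (coefficient-+ (ξ +ₗ η) ζ n) (+-congʳ (coefficient-+ ξ η n)))
                    (trans (+-assoc _ _ _)
                      (sym (trans (coefficient-+ ξ (η +ₗ ζ) n) (+-congˡ (coefficient-+ η ζ n)))))
                }
              ; identity = (λ ξ n → trans (coefficient-+ 𝕃.0# ξ n) (trans (+-congʳ (coefficient-0 n)) (+-identityˡ _)))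
                         , (λ ξ n → trans (coefficient-+ ξ 𝕃.0# n) (trans (+-congˡ (coefficient-0 n)) (+-identityʳ _)))
              }
            ; inverse = (λ ξ n → trans (coefficient-+ (𝕃.- ξ) ξ n)
                                  (trans (+-congʳ (coefficient-neg ξ n)) (trans (-‿inverseˡ _) (sym (coefficient-0 n)))))
                      , (λ ξ n → trans (coefficient-+ ξ (𝕃.- ξ) n)
                                  (trans (+-congˡ (coefficient-neg ξ n)) (trans (-‿inverseʳ _) (sym (coefficient-0 n)))))
            ; ⁻¹-cong = λ {ξ} {η} e n → trans (coefficient-neg ξ n) (trans (-‿cong (e n)) (sym (coefficient-neg η n)))
            }
          ; comm = λ ξ η n → trans (coefficient-+ ξ η n) (trans (+-comm _ _) (sym (coefficient-+ η ξ n)))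
          }
        ; *-cong = λ {ξ} {ξ′} {η} {η′} e e′ → coef≈ (*ₗ-cong {ξ} {ξ′} {η} {η′} (mk e) (mk e′))
        ; *-assoc = λ ξ η ζ → coef≈ (*ₗ-assoc ξ η ζ)
        ; *-identity = (λ ξ → coef≈ (*ₗ-identityˡ ξ))
                     , (λ ξ → coef≈ (≃.trans (*ₗ-comm ξ 𝕃.1#) (*ₗ-identityˡ ξ)))
        ; distrib = (λ ξ η ζ → coef≈ (≃.trans (*ₗ-comm ξ (η +ₗ ζ)) (≃.trans (*ₗ-distribʳ ξ η ζ)
                                        (+ₗ-cong (*ₗ-comm η ξ) (*ₗ-comm ζ ξ)))))
                  , (λ ξ η ζ → coef≈ (*ₗ-distribʳ ξ η ζ))
        }
      ; *-comm = λ ξ η → coef≈ (*ₗ-comm ξ η)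
      }
    }

-- Coefficients of products

module Convolution {c ℓ} (R : CommutativeRing c ℓ) where
  open CommutativeRing R hiding (zero)
  open Series R
  open Solver R

  module _ {ℓ₂} (Q : Carrier → Set ℓ₂) (Q-resp : ∀ {x y} → x ≈ y → Q x → Q y)
           (Q-+ : ∀ {x y} → Q x → Q y → Q (x + y)) (Q-0 : Q 0#) where

    conv-closed : ∀ f g n → (∀ i j → i ℕ.+ j ≡ n → Q (f i * g j)) → Q (conv f g n)
    conv-closed f g zero    h = Q-resp (sym (+-identityʳ _)) (h 0 0 ≡.refl)
    conv-closed f g (suc n) h =
      Q-+ (h 0 (suc n) ≡.refl) (conv-closed (tail f) g n λ i j eq → h (suc i) j (≡.cong suc eq))

    -- With `Q` the property of being 0 this isolates the top coefficient of a product; with `Q` a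
    -- bound on the absolute value it isolates the dominant term in Gauss's lemma.
    conv-dominant : ∀ f g i j → (∀ i′ j′ → i′ ℕ.+ j′ ≡ i ℕ.+ j → i′ ≡.≢ i → Q (f i′ * g j′)) →
                    Q (conv f g (i ℕ.+ j) - f i * g j)
    conv-dominant f g zero zero h = Q-resp (sym (solve 1 (λ a → (a :+ :0) :- a := :0) refl _)) Q-0
    conv-dominant f g zero (suc j) h =
      Q-resp (solve 2 (λ a b → b := (a :+ b) :- a) refl _ _)
        (conv-closed (tail f) g j λ i′ j′ eq → h (suc i′) j′ (≡.cong suc eq) λ ())
    conv-dominant f g (suc i) j h =
      Q-resp (solve 3 (λ a b c → a :+ (b :- c) := (a :+ b) :- c) refl _ _ _)
        (Q-+ (h 0 (suc (i ℕ.+ j)) ≡.refl λ ())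
             (conv-dominant (tail f) g i j λ i′ j′ eq ne → h (suc i′) j′ (≡.cong suc eq) (ne ∘ ℕ.suc-injective)))

  open Polynomial rawRing

  monomial : Carrier → ℕ → Poly
  monomial a i = replicate i 0# ++ a ∷ []

  coeff-monomial : ∀ a i → coeff (monomial a i) i ≈ a
  coeff-monomial a zero    = refl
  coeff-monomial a (suc i) = coeff-monomial a i

  coeff-monomial-≢ : ∀ a i j → i ≡.≢ j → coeff (monomial a i) j ≈ 0#
  coeff-monomial-≢ a zero    zero    ne = ⊥-elim (ne ≡.refl)
  coeff-monomial-≢ a zero    (suc j) ne = refl
  coeff-monomial-≢ a (suc i) zero    ne = refl
  coeff-monomial-≢ a (suc i) (suc j) ne = coeff-monomial-≢ a i j (ne ∘ ≡.cong suc)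

  coeff-length : ∀ p i → length p ℕ.≤ i → coeff p i ≈ 0#
  coeff-length []      i       _           = refl
  coeff-length (a ∷ p) (suc i) (ℕ.s≤s l≤i) = coeff-length p i l≤i

  coeff-conv-bound : ∀ {m n} p q → DegreeAtMost m p → DegreeAtMost n q → DegreeAtMost (m ℕ.+ n) (p *ₚ q)
  coeff-conv-bound {m} {n} p q dp dq l m+n<l = trans (coeff-* p q l)
    (conv-closed (_≈ 0#) (λ e z → trans (sym e) z) (λ a b → trans (+-cong a b) (+-identityˡ _)) refl
      (coeff p) (coeff q) l vanish)
    where
    vanish : ∀ i j → i ℕ.+ j ≡ l → coeff p i * coeff q j ≈ 0#
    vanish i j eq with i ℕ.≤? m
    ... | no i≰m  = trans (*-congʳ (dp i (ℕ.≰⇒> i≰m))) (zeroˡ _)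
    ... | yes i≤m = trans (*-congˡ (dq j (ℕ.+-cancelˡ-< m n j (ℕ.<-≤-trans m+n<l
                      (≡.subst (ℕ._≤ m ℕ.+ j) eq (ℕ.+-monoˡ-≤ j i≤m)))))) (zeroʳ _)

  coeff-*-top : ∀ {m n} p q → DegreeAtMost m p → DegreeAtMost n q →
                coeff (p *ₚ q) (m ℕ.+ n) ≈ coeff p m * coeff q n
  coeff-*-top {m} {n} p q dp dq = trans (coeff-* p q (m ℕ.+ n)) (x-y≈0⇒x≈y
    (conv-dominant (_≈ 0#) (λ e z → trans (sym e) z) (λ a b → trans (+-cong a b) (+-identityˡ _)) refl
      (coeff p) (coeff q) m n vanish))
    where
    x-y≈0⇒x≈y : ∀ {x y} → x - y ≈ 0# → x ≈ y
    x-y≈0⇒x≈y {x} {y} e = trans (solve 2 (λ x y → x := (x :- y) :+ y) refl x y) (trans (+-congʳ e) (+-identityˡ y))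
    vanish : ∀ i j → i ℕ.+ j ≡ m ℕ.+ n → i ≡.≢ m → coeff p i * coeff q j ≈ 0#
    vanish i j eq i≢m with i ℕ.≤? m
    ... | no i≰m  = trans (*-congʳ (dp i (ℕ.≰⇒> i≰m))) (zeroˡ _)
    ... | yes i≤m = trans (*-congˡ (dq j (ℕ.+-cancelˡ-< m n j
                      (≡.subst (ℕ._< m ℕ.+ j) eq (ℕ.+-monoˡ-< j (ℕ.≤∧≢⇒< i≤m i≢m)))))) (zeroʳ _)

  fromFun : Fun → ℕ → Poly
  fromFun f zero    = []
  fromFun f (suc n) = f 0 ∷ fromFun (tail f) n

  coeff-fromFun : ∀ f n i → i ℕ.< n → coeff (fromFun f n) i ≈ f i
  coeff-fromFun f (suc n) zero    _           = refl
  coeff-fromFun f (suc n) (suc i) (ℕ.s≤s i<n) = coeff-fromFun (tail f) n i i<n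

  coeff-fromFun-≥ : ∀ f n i → n ℕ.≤ i → coeff (fromFun f n) i ≈ 0#
  coeff-fromFun-≥ f zero    i       _           = refl
  coeff-fromFun-≥ f (suc n) (suc i) (ℕ.s≤s n≤i) = coeff-fromFun-≥ (tail f) n i n≤i

-- Evaluation and roots of polynomials

module Evaluation {c ℓ c₁ ℓ₁} (R : CommutativeRing c ℓ) (S : CommutativeRing c₁ ℓ₁)
                  (ι : CommutativeRing.Carrier R → CommutativeRing.Carrier S)
                  (ι-hom : IsRingHomomorphism (CommutativeRing.rawRing R) (CommutativeRing.rawRing S) ι) where
  private module R = CommutativeRing R
  open CommutativeRing S hiding (zero)
  open Polynomial R.rawRing
  open Convolution R using (monomial)
  open IsRingHomomorphism ι-hom
  open Solver S
  open SetoidReasoning setoid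
  open SemiringExp semiring using (_^_)

  ev : Poly → Carrier → Carrier
  ev = eval rawRing ι

  ev-zero : ∀ p x → (∀ i → coeff p i R.≈ R.0#) → ev p x ≈ 0#
  ev-zero []      x z = refl
  ev-zero (a ∷ p) x z = begin
    ι a + x * ev p x ≈⟨ +-cong (trans (⟦⟧-cong (z 0)) 0#-homo) (*-congˡ (ev-zero p x (z ∘ suc))) ⟩
    0# + x * 0#      ≈⟨ solve 1 (λ x → :0 :+ x :* :0 := :0) refl x ⟩
    0# ∎

  ev-cong : ∀ p q {x y} → (∀ i → coeff p i R.≈ coeff q i) → x ≈ y → ev p x ≈ ev q y
  ev-cong []      q       {x} {y} e x≈y = sym (ev-zero q y (λ i → R.sym (e i)))
  ev-cong (a ∷ p) []      {x} {y} e x≈y = ev-zero (a ∷ p) x e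
  ev-cong (a ∷ p) (b ∷ q)     e x≈y = +-cong (⟦⟧-cong (e 0)) (*-cong x≈y (ev-cong p q (e ∘ suc) x≈y))

  ev-+ : ∀ p q x → ev (p +ₚ q) x ≈ ev p x + ev q x
  ev-+ []      q       x = sym (+-identityˡ _)
  ev-+ (a ∷ p) []      x = sym (+-identityʳ _)
  ev-+ (a ∷ p) (b ∷ q) x = begin
    ι (a R.+ b) + x * ev (p +ₚ q) x         ≈⟨ +-cong (+-homo a b) (*-congˡ (ev-+ p q x)) ⟩
    (ι a + ι b) + x * (ev p x + ev q x)     ≈⟨ solve 5 (λ a b x p q → (a :+ b) :+ x :* (p :+ q) := (a :+ x :* p) :+ (b :+ x :* q))
                                                 refl (ι a) (ι b) x (ev p x) (ev q x) ⟩
    (ι a + x * ev p x) + (ι b + x * ev q x) ∎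

  ev-scale : ∀ a p x → ev (map (a R.*_) p) x ≈ ι a * ev p x
  ev-scale a []      x = sym (zeroʳ _)
  ev-scale a (b ∷ p) x = begin
    ι (a R.* b) + x * ev (map (a R.*_) p) x ≈⟨ +-cong (*-homo a b) (*-congˡ (ev-scale a p x)) ⟩
    ι a * ι b + x * (ι a * ev p x)          ≈⟨ solve 4 (λ a b x p → a :* b :+ x :* (a :* p) := a :* (b :+ x :* p))
                                                 refl (ι a) (ι b) x (ev p x) ⟩
    ι a * (ι b + x * ev p x) ∎

  ev-shift : ∀ p x → ev (R.0# ∷ p) x ≈ x * ev p x
  ev-shift p x = trans (+-congʳ 0#-homo) (+-identityˡ _)

  ev-* : ∀ p q x → ev (p *ₚ q) x ≈ ev p x * ev q x
  ev-* []      q x = sym (zeroˡ _)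
  ev-* (a ∷ p) q x = begin
    ev (map (a R.*_) q +ₚ (R.0# ∷ (p *ₚ q))) x        ≈⟨ ev-+ (map (a R.*_) q) _ x ⟩
    ev (map (a R.*_) q) x + ev (R.0# ∷ (p *ₚ q)) x    ≈⟨ +-cong (ev-scale a q x) (trans (ev-shift (p *ₚ q) x) (*-congˡ (ev-* p q x))) ⟩
    ι a * ev q x + x * (ev p x * ev q x)              ≈⟨ solve 4 (λ a x p q → a :* q :+ x :* (p :* q) := (a :+ x :* p) :* q)
                                                           refl (ι a) x (ev p x) (ev q x) ⟩
    (ι a + x * ev p x) * ev q x ∎

  ev-const : ∀ a x → ev (a ∷ []) x ≈ ι a
  ev-const a x = trans (+-congˡ (zeroʳ x)) (+-identityʳ _)

  ev-neg : ∀ p x → ev (map (R.-_) p) x ≈ - ev p x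
  ev-neg []      x = solve 0 (:0 := :- :0) refl
  ev-neg (a ∷ p) x = trans (+-cong (-‿homo a) (*-congˡ (ev-neg p x)))
    (solve 3 (λ a x p → :- a :+ x :* :- p := :- (a :+ x :* p)) refl (ι a) x (ev p x))

  ev-isRingHomomorphism : ∀ x → IsRingHomomorphism polyRawRing rawRing (λ p → ev p x)
  ev-isRingHomomorphism x = record
    { isSemiringHomomorphism = record
      { isNearSemiringHomomorphism = record
        { +-isMonoidHomomorphism = record
          { isMagmaHomomorphism = record
            { isRelHomomorphism = record { cong = λ {p} {q} e → ev-cong p q e refl }
            ; homo = λ p q → ev-+ p q x
            }
          ; ε-homo = refl
          }
        ; *-homo = λ p q → ev-* p q x
        }
      ; 1#-homo = trans (ev-const R.1# x) 1#-homo
      }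
    ; -‿homo = λ p → ev-neg p x
    }

  ev-monomial : ∀ a i x → ev (monomial a i) x ≈ ι a * x ^ i
  ev-monomial a zero    x = trans (ev-const a x) (sym (*-identityʳ _))
  ev-monomial a (suc i) x = trans (ev-shift (monomial a i) x) (trans (*-congˡ (ev-monomial a i x))
    (solve 3 (λ x a y → x :* (a :* y) := a :* (x :* y)) refl x (ι a) (x ^ i)))

  module _ {c₂ ℓ₂} (S′ : CommutativeRing c₂ ℓ₂) (φ : Carrier → CommutativeRing.Carrier S′)
           (φ-hom : IsRingHomomorphism rawRing (CommutativeRing.rawRing S′) φ) where
    private
      module S′ = CommutativeRing S′
      module φ = IsRingHomomorphism φ-hom

    hom-ev : ∀ p x → φ (ev p x) S′.≈ eval S′.rawRing (φ ∘ ι) p (φ x)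
    hom-ev []      x = φ.0#-homo
    hom-ev (a ∷ p) x = S′.trans (φ.+-homo _ _) (S′.+-congˡ (S′.trans (φ.*-homo _ _) (S′.*-congˡ (hom-ev p x))))

module Roots {c ℓ} (S : CommutativeRing c ℓ) where
  open CommutativeRing S hiding (zero)
  open Polynomial rawRing
  open Solver S
  open SetoidReasoning setoid

  infix 9 _⟦_⟧
  _⟦_⟧ : Poly → Carrier → Carrier
  p ⟦ x ⟧ = eval rawRing id p x

  -- Synthetic division by `X − y`: the coefficients are the Horner values at `y` of the tails of
  -- `p`.
  quotient : Poly → Carrier → Poly
  quotient []          y = []
  quotient (a ∷ [])    y = []
  quotient (a ∷ b ∷ p) y = (b ∷ p) ⟦ y ⟧ ∷ quotient (b ∷ p) y

  quotient-eval : ∀ p x y → p ⟦ x ⟧ - p ⟦ y ⟧ ≈ (x - y) * quotient p y ⟦ x ⟧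
  quotient-eval []          x y = solve 1 (λ d → :0 :- :0 := d :* :0) refl (x - y)
  quotient-eval (a ∷ [])    x y = solve 3 (λ a x y → (a :+ x :* :0) :- (a :+ y :* :0) := (x :- y) :* :0) refl a x y
  quotient-eval (a ∷ q@(_ ∷ _)) x y = begin
    (a + x * q ⟦ x ⟧) - (a + y * q ⟦ y ⟧)
      ≈⟨ solve 5 (λ a x y u v → (a :+ x :* u) :- (a :+ y :* v) := (x :- y) :* v :+ x :* (u :- v)) refl a x y _ _ ⟩
    (x - y) * q ⟦ y ⟧ + x * (q ⟦ x ⟧ - q ⟦ y ⟧) ≈⟨ +-congˡ (*-congˡ (quotient-eval q x y)) ⟩
    (x - y) * q ⟦ y ⟧ + x * ((x - y) * quotient q y ⟦ x ⟧)
      ≈⟨ solve 4 (λ x y u v → (x :- y) :* u :+ x :* ((x :- y) :* v) := (x :- y) :* (u :+ x :* v)) refl x y _ _ ⟩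
    (x - y) * (q ⟦ y ⟧ + x * quotient q y ⟦ x ⟧) ∎

  Zero : Poly → Set _
  Zero p = ∀ i → coeff p i ≈ 0#

  -- The coefficients of the quotient arise from those of `p` by a unitriangular substitution, so
  -- both vanish together; the constant term `a` does not enter.
  quotient-zero : ∀ a p y → Zero (quotient (a ∷ p) y) → Zero p
  quotient-zero a []          y z i       = refl
  quotient-zero a (b ∷ p)     y z (suc i) = quotient-zero b p y (z ∘ suc) i
  quotient-zero a (b ∷ [])    y z zero    =
    trans (solve 2 (λ b y → b := b :+ y :* :0) refl b y) (z 0)
  quotient-zero a (b ∷ c ∷ p) y z zero    = begin
    b                     ≈⟨ solve 2 (λ b y → b := b :+ y :* :0) refl b y ⟩
    b + y * 0#            ≈⟨ +-congˡ (*-congˡ (z 1)) ⟨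
    b + y * (c ∷ p) ⟦ y ⟧ ≈⟨ z 0 ⟩
    0# ∎

  root-zero : ∀ a p y → (a ∷ p) ⟦ y ⟧ ≈ 0# → Zero p → Zero (a ∷ p)
  root-zero a p y r z (suc i) = z i
  root-zero a p y r z zero    = begin
    a               ≈⟨ solve 2 (λ a y → a := a :+ y :* :0) refl a y ⟩
    a + y * 0#      ≈⟨ +-congˡ (*-congˡ (ev-zero p z)) ⟨
    a + y * p ⟦ y ⟧ ≈⟨ r ⟩
    0# ∎
    where
    ev-zero : ∀ p → Zero p → p ⟦ y ⟧ ≈ 0#
    ev-zero []      z = refl
    ev-zero (b ∷ p) z = trans (+-cong (z 0) (*-congˡ (ev-zero p (z ∘ suc)))) (solve 1 (λ y → :0 :+ y :* :0 := :0) refl y)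

  -- Distinctness in the form used for dividing out roots: `x - y` can be cancelled. For Laurent
  -- series this follows from an exact absolute value of `x - y`, without division.
  Apart : Carrier → Carrier → Set _
  Apart x y = ∀ z → (x - y) * z ≈ 0# → z ≈ 0#

  length-quotient : ∀ a p y → length (quotient (a ∷ p) y) ≡ length p
  length-quotient a []      y = ≡.refl
  length-quotient a (b ∷ p) y = ≡.cong suc (length-quotient b p y)

  quotient-root : ∀ p {x y} → Apart x y → p ⟦ x ⟧ ≈ 0# → p ⟦ y ⟧ ≈ 0# → quotient p y ⟦ x ⟧ ≈ 0#
  quotient-root p {x} {y} ap rx ry = ap _ (begin
    (x - y) * quotient p y ⟦ x ⟧ ≈⟨ quotient-eval p x y ⟨
    p ⟦ x ⟧ - p ⟦ y ⟧             ≈⟨ +-cong rx (-‿cong ry) ⟩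
    0# - 0#                     ≈⟨ solve 0 (:0 :- :0 := :0) refl ⟩
    0# ∎)

  distinct-roots : ∀ xs p → length p ℕ.≤ length xs → AllPairs Apart xs → All (λ x → p ⟦ x ⟧ ≈ 0#) xs → Zero p
  distinct-roots xs       []      _           _          _        i = refl
  distinct-roots (y ∷ xs) (a ∷ p) (ℕ.s≤s l≤l) (apart ∷ aps) (ry ∷ rs) =
    root-zero a p y ry (quotient-zero a p y
      (distinct-roots xs (quotient (a ∷ p) y) (≡.subst (ℕ._≤ length xs) (≡.sym (length-quotient a p y)) l≤l) aps
        (All.zipWith (λ (ap , rx) → quotient-root (a ∷ p) (flip ap) rx ry) (apart , rs))))
    where
    flip : ∀ {x y} → Apart y x → Apart x y
    flip {x} {y} ap z e = ap z (trans (solve 3 (λ x y z → (y :- x) :* z := :- ((x :- y) :* z)) refl x y z)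
                                 (trans (-‿cong e) (solve 0 (:- :0 := :0) refl)))

  finitely-many-roots : (∀ x y → Dec (x ≈ y)) → (∀ {x y} → ¬ x ≈ y → Apart x y) →
                        ∀ n p → length p ℕ.≤ n → ¬ Zero p →
                        ¬ ¬ (∃[ xs ] ∀ x → p ⟦ x ⟧ ≈ 0# → Any (x ≈_) xs)
  finitely-many-roots _≟_ apart n       []      _           nz k = nz (λ _ → refl)
  finitely-many-roots _≟_ apart (suc n) (a ∷ p) (ℕ.s≤s l≤n) nz k =
    k ([] , λ y ry → ⊥-elim
      (finitely-many-roots _≟_ apart n (quotient (a ∷ p) y) (≡.subst (ℕ._≤ n) (≡.sym (length-quotient a p y)) l≤n)
        (λ z → nz (root-zero a p y ry (quotient-zero a p y z)))
        λ (xs , complete) → k (y ∷ xs , λ x rx → case x y rx ry complete)))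
    where
    case : ∀ x y {xs} → (a ∷ p) ⟦ x ⟧ ≈ 0# → (a ∷ p) ⟦ y ⟧ ≈ 0# →
           (∀ x → quotient (a ∷ p) y ⟦ x ⟧ ≈ 0# → Any (x ≈_) xs) → Any (x ≈_) (y ∷ xs)
    case x y rx ry complete with x ≟ y
    ... | yes x≈y = here x≈y
    ... | no x≉y  = there (complete x (quotient-root (a ∷ p) (apart x≉y) rx ry))

-- The Frobenius map in characteristic p

prime∤! : ∀ {p} → Prime p → ∀ k → k ℕ.< p → ¬ p ∣ k !
prime∤! {p} pp zero    _    p∣1  = ¬prime[1] (≡.subst Prime (∣1⇒≡1 p∣1) pp)
prime∤! {p} pp (suc k) k<p  p∣k! with euclidsLemma (suc k) (k !) pp p∣k!
... | inj₁ p∣k  = ℕ.<⇒≱ k<p (∣⇒≤ p∣k)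
... | inj₂ p∣k! = prime∤! pp k (ℕ.<-trans (ℕ.n<1+n k) k<p) p∣k!

prime∣C : ∀ {p} → Prime p → ∀ k → 0 ℕ.< k → k ℕ.< p → p ∣ p choose k
prime∣C {p} pp k 0<k k<p with euclidsLemma (p choose k) (k ! ℕ.* (p ∸ k) !) pp p∣product
  where
  instance
    _ = k ℕ.!* (p ∸ k) !≢0
  p∣p! : ∀ {n} → Prime n → n ∣ n !
  p∣p! {suc n} _ = ∣m⇒∣m*n (n !) ∣-refl
  p∣p! {zero} pp with () ← prime⇒nonZero pp
  product≡ : (p choose k) ℕ.* (k ! ℕ.* (p ∸ k) !) ≡ p !
  product≡ = ≡.trans (≡.cong (ℕ._* (k ! ℕ.* (p ∸ k) !)) (nCk≡n!/k![n-k]! (ℕ.<⇒≤ k<p)))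
                     (m/n*n≡m (k![n∸k]!∣n! (ℕ.<⇒≤ k<p)))
  p∣product : p ∣ (p choose k) ℕ.* (k ! ℕ.* (p ∸ k) !)
  p∣product = ≡.subst (p ∣_) (≡.sym product≡) (p∣p! pp)
... | inj₁ p∣C = p∣C
... | inj₂ p∣d with euclidsLemma (k !) ((p ∸ k) !) pp p∣d
... | inj₁ p∣k! = ⊥-elim (prime∤! pp k k<p p∣k!)
... | inj₂ p∣!  = ⊥-elim (prime∤! pp (p ∸ k) (ℕ.∸-monoʳ-< 0<k (ℕ.<⇒≤ k<p)) p∣!)

module Frobenius {c ℓ} (S : CommutativeRing c ℓ) where
  open CommutativeRing S hiding (zero)
  open CommutativeMonoidSum +-commutativeMonoid using (sum; sum-cong-≋; sum-replicate-zero; sum-init-last)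
  open SemiringExp semiring using (_^_; ^-congˡ; ^-assocʳ)
  open MonoidMult +-monoid using (×-congʳ; ×-assocˡ; ×-homo-1) renaming (_×_ to _×ₘ_)
  open SemiringMult semiring using (×-assoc-*)
  open Solver S
  open SetoidReasoning setoid

  module _ {p} (p-prime : Prime p) (char : p ×ₘ 1# ≈ 0#) where

    ×0 : ∀ n → n ×ₘ 0# ≈ 0#
    ×0 zero    = refl
    ×0 (suc n) = trans (+-identityˡ _) (×0 n)

    p∣⇒×≈0 : ∀ {n} → p ∣ n → ∀ x → n ×ₘ x ≈ 0#
    p∣⇒×≈0 (divides q ≡.refl) x = begin
      (q ℕ.* p) ×ₘ x    ≈⟨ ×-assocˡ x q p ⟨
      q ×ₘ (p ×ₘ x)     ≈⟨ ×-congʳ q (×-congʳ p (*-identityˡ x)) ⟨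
      q ×ₘ (p ×ₘ (1# * x)) ≈⟨ ×-congʳ q (×-assoc-* p 1# x) ⟨
      q ×ₘ ((p ×ₘ 1#) * x) ≈⟨ ×-congʳ q (trans (*-congʳ char) (zeroˡ x)) ⟩
      q ×ₘ 0#           ≈⟨ ×0 q ⟩
      0# ∎

    frobenius-p : ∀ x y → (x + y) ^ p ≈ x ^ p + y ^ p
    frobenius-p x y = go p p-prime ≡.refl
      where
      open BinomialTheorem commutativeSemiring using (binomialTerm; theorem)
      go : ∀ n → Prime n → n ≡ p → (x + y) ^ n ≈ x ^ n + y ^ n
      go zero    pp _ with () ← prime⇒nonZero pp
      go (suc n) pp eq = begin
        (x + y) ^ suc n                                ≈⟨ theorem (suc n) x y ⟩
        t Fin.zero + sum (t ∘ Fin.suc)                 ≈⟨ +-congˡ (sum-init-last (t ∘ Fin.suc)) ⟩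
        t Fin.zero + (sum (t ∘ Fin.suc ∘ inject₁) + t (Fin.suc (fromℕ n)))
          ≈⟨ +-cong first (+-cong middle last) ⟩
        y ^ suc n + (0# + x ^ suc n)                   ≈⟨ solve 2 (λ x y → y :+ (:0 :+ x) := x :+ y) refl _ _ ⟩
        x ^ suc n + y ^ suc n ∎
        where
        t = binomialTerm x y (suc n)
        first : t Fin.zero ≈ y ^ suc n
        first = trans (×-homo-1 _) (*-identityˡ _)
        last : t (Fin.suc (fromℕ n)) ≈ x ^ suc n
        last = begin
          (suc n choose suc (toℕ (fromℕ n))) ×ₘ (x ^ suc (toℕ (fromℕ n)) * y ^ (n ∸ toℕ (fromℕ n)))
            ≈⟨ reflexive (≡.cong (λ m → (suc n choose suc m) ×ₘ (x ^ suc m * y ^ (n ∸ m))) (Fin.toℕ-fromℕ n)) ⟩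
          (suc n choose suc n) ×ₘ (x ^ suc n * y ^ (n ∸ n))
            ≈⟨ reflexive (≡.cong₂ (λ a b → a ×ₘ (x ^ suc n * y ^ b)) (nCn≡1 (suc n)) (ℕ.n∸n≡0 n)) ⟩
          1 ×ₘ (x ^ suc n * 1#) ≈⟨ trans (×-homo-1 _) (*-identityʳ _) ⟩
          x ^ suc n ∎
        middle : sum (t ∘ Fin.suc ∘ inject₁) ≈ 0#
        middle = trans (sum-cong-≋ λ i → p∣⇒×≈0 (≡.subst (_∣ (suc n choose suc (toℕ (inject₁ i)))) eq
                          (prime∣C pp (suc (toℕ (inject₁ i))) (ℕ.s≤s ℕ.z≤n)
                            (ℕ.s≤s (≡.subst (ℕ._< n) (≡.sym (Fin.toℕ-inject₁ i)) (Fin.toℕ<n i))))) _)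
                   (sum-replicate-zero n)

    frobenius : ∀ n x y → (x + y) ^ (p ℕ.^ n) ≈ x ^ (p ℕ.^ n) + y ^ (p ℕ.^ n)
    frobenius zero    x y = solve 2 (λ x y → (x :+ y) :* :1 := x :* :1 :+ y :* :1) refl x y
    frobenius (suc n) x y = begin
      (x + y) ^ (p ℕ.* p ℕ.^ n)                        ≈⟨ ^-assocʳ (x + y) p (p ℕ.^ n) ⟨
      ((x + y) ^ p) ^ (p ℕ.^ n)                        ≈⟨ ^-congˡ (p ℕ.^ n) (frobenius-p x y) ⟩
      (x ^ p + y ^ p) ^ (p ℕ.^ n)                      ≈⟨ frobenius n (x ^ p) (y ^ p) ⟩
      (x ^ p) ^ (p ℕ.^ n) + (y ^ p) ^ (p ℕ.^ n)        ≈⟨ +-cong (^-assocʳ x p _) (^-assocʳ y p _) ⟩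
      x ^ (p ℕ.* p ℕ.^ n) + y ^ (p ℕ.* p ℕ.^ n) ∎

-- Decidability and characteristic of a finite field

module FiniteFieldProperties {q c ℓ} (𝔽q : FiniteField q c ℓ) where
  open FiniteField 𝔽q using (commutativeRing; isField; enumeration)
  open CommutativeRing commutativeRing hiding (zero)
  open IsField isField public
  open Inverse enumeration public using (to; from; from-cong; to-cong; strictlyInverseˡ; strictlyInverseʳ)
  open CommutativeMonoidSum +-commutativeMonoid using (sum; sum-cong-≋; ∑-distrib-+; ∑-permute; sum-replicate)
  open MonoidMult +-monoid using (×-congˡ; ×-homo-1) renaming (_×_ to _×ₘ_)
  open SemiringMult semiring using (×1-homo-*)
  open Solver commutativeRing
  open SetoidReasoning setoid

  infix 4 _≟_
  _≟_ : ∀ x y → Dec (x ≈ y)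
  x ≟ y = map′ (λ eq → trans (sym (strictlyInverseˡ x)) (trans (to-cong eq) (strictlyInverseˡ y)))
               from-cong (from x Fin.≟ from y)

  translation : Permutation q q
  translation = permutation (λ i → from (to i + 1#)) (λ i → from (to i - 1#))
    (λ i → ≡.trans (from-cong (trans (+-congʳ (strictlyInverseˡ _))
                    (solve 2 (λ a b → (a :- b) :+ b := a) refl (to i) 1#))) (strictlyInverseʳ i))
    (λ i → ≡.trans (from-cong (trans (+-congʳ (strictlyInverseˡ _))
                    (solve 2 (λ a b → (a :+ b) :- b := a) refl (to i) 1#))) (strictlyInverseʳ i))

  -- Summing all elements before and after translation by 1.
  q×1≈0 : q ×ₘ 1# ≈ 0#
  q×1≈0 = begin
    q ×ₘ 1#                            ≈⟨ solve 2 (λ s t → t := (s :+ t) :- s) refl (sum to) _ ⟩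
    (sum to + q ×ₘ 1#) - sum to        ≈⟨ +-congʳ (+-congˡ (sum-replicate q)) ⟨
    (sum to + sum {q} (λ _ → 1#)) - sum to  ≈⟨ +-congʳ (∑-distrib-+ to (λ _ → 1#)) ⟨
    sum (λ i → to i + 1#) - sum to     ≈⟨ +-congʳ (sum-cong-≋ λ i → strictlyInverseˡ (to i + 1#)) ⟨
    sum (λ i → to (translation ⟨$⟩ʳ i)) - sum to ≈⟨ +-congʳ (∑-permute to translation) ⟨
    sum to - sum to                    ≈⟨ -‿inverseʳ _ ⟩
    0# ∎

  x*y≈0⇒x≈0∨y≈0 : ∀ {x y} → x * y ≈ 0# → x ≈ 0# ⊎ y ≈ 0#
  x*y≈0⇒x≈0∨y≈0 {x} {y} xy≈0 with x ≟ 0#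
  ... | yes x≈0 = inj₁ x≈0
  ... | no  x≉0 with inverse x x≉0
  ... | z , xz≈1 = inj₂ (begin
    y            ≈⟨ *-identityˡ y ⟨
    1# * y       ≈⟨ *-congʳ xz≈1 ⟨
    (x * z) * y  ≈⟨ solve 3 (λ x y z → (x :* z) :* y := z :* (x :* y)) refl x y z ⟩
    z * (x * y)  ≈⟨ *-congˡ xy≈0 ⟩
    z * 0#       ≈⟨ zeroʳ z ⟩
    0# ∎)

  -- The multiple `q · 1` is the `s`-th power of `p · 1`, and a field has no zero divisors.
  p×1≈0 : ∀ p s → q ≡ p ℕ.^ s → p ×ₘ 1# ≈ 0#
  p×1≈0 p s q≡p^s = go s (trans (×-congˡ (≡.sym q≡p^s)) q×1≈0)
    where
    go : ∀ s → (p ℕ.^ s) ×ₘ 1# ≈ 0# → p ×ₘ 1# ≈ 0#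
    go zero    e = ⊥-elim (1≉0 (trans (sym (×-homo-1 1#)) e))
    go (suc s) e with x*y≈0⇒x≈0∨y≈0 (trans (sym (×1-homo-* p (p ℕ.^ s))) e)
    ... | inj₁ e′ = e′
    ... | inj₂ e′ = go s e′

-- Polynomials inside Laurent series, described by coefficients

-- A is k[T] and L is k((T⁻¹)); coef ξ n is the coefficient of T⁻ⁿ.
record LaurentField {c ℓ} (K : CommutativeRing c ℓ) : Set (lsuc (c ⊔ ℓ)) where
  private module K = CommutativeRing K
  field
    1≉0    : ¬ K.1# K.≈ K.0#
    _≟_    : ∀ x y → Dec (x K.≈ y)
    domain : ∀ {x y} → x K.* y K.≈ K.0# → x K.≈ K.0# ⊎ y K.≈ K.0#
    A L : CommutativeRing c ℓ
  module A = CommutativeRing A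
  module L = CommutativeRing L
  field
    coeffₐ         : A.Carrier → ℕ → K.Carrier
    coeffₐ-cong    : ∀ {a b} → a A.≈ b → ∀ i → coeffₐ a i K.≈ coeffₐ b i
    coeffₐ-ext     : ∀ {a b} → (∀ i → coeffₐ a i K.≈ coeffₐ b i) → a A.≈ b
    coeffₐ-finite  : ∀ a → ∃[ d ] ∀ i → d ℕ.≤ i → coeffₐ a i K.≈ K.0#
    coef           : L.Carrier → ℤ → K.Carrier
    coef-cong      : ∀ {ξ η} → ξ L.≈ η → ∀ n → coef ξ n K.≈ coef η n
    coef-ext       : ∀ {ξ η} → (∀ n → coef ξ n K.≈ coef η n) → ξ L.≈ η
    coef-+         : ∀ ξ η n → coef (ξ L.+ η) n K.≈ coef ξ n K.+ coef η n
    coef-neg       : ∀ ξ n → coef (L.- ξ) n K.≈ K.- coef ξ n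
    coef-0         : ∀ n → coef L.0# n K.≈ K.0#
    coef-finite    : ∀ ξ → ∃[ s ] ∀ n → n ℤ.< s → coef ξ n K.≈ K.0#
    coef-lead-*    : ∀ ξ η a b → (∀ n → n ℤ.< ℤ.- a → coef ξ n K.≈ K.0#) → (∀ n → n ℤ.< ℤ.- b → coef η n K.≈ K.0#) →
                     (∀ n → n ℤ.< ℤ.- (a ℤ.+ b) → coef (ξ L.* η) n K.≈ K.0#) ×
                     coef (ξ L.* η) (ℤ.- (a ℤ.+ b)) K.≈ coef ξ (ℤ.- a) K.* coef η (ℤ.- b)
    T^             : ℤ → L.Carrier
    T^0            : T^ (+ 0) L.≈ L.1#
    coef-T^        : ∀ e → coef (T^ e) (ℤ.- e) K.≈ K.1#
    coef-T^-≢      : ∀ e n → n ≡.≢ ℤ.- e → coef (T^ e) n K.≈ K.0#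
    coef-T^*       : ∀ e ξ n → coef (T^ e L.* ξ) n K.≈ coef ξ (n ℤ.+ e)
    emb            : A.Carrier → L.Carrier
    emb-hom        : IsRingHomomorphism A.rawRing L.rawRing emb
    coef-emb-neg   : ∀ a i → coef (emb a) (ℤ.- + i) K.≈ coeffₐ a i
    coef-emb-pos   : ∀ a i → coef (emb a) (+ suc i) K.≈ K.0#
    polynomial     : ∀ (f : ℕ → K.Carrier) B → ∃[ a ] (∀ i → i ℕ.≤ B → coeffₐ a i K.≈ f i)
                                                    × (∀ i → B ℕ.< i → coeffₐ a i K.≈ K.0#)

module LaurentFieldInstance {c ℓ} (K : CommutativeRing c ℓ) where
  open CommutativeRing K hiding (zero) renaming (rawRing to k)
  open Series K
  open LaurentRing K
  open LaurentSeries k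
  open Laurent
  open Polynomial k
  open Exponents k using (embed)
  private
    module 𝕃 = CommutativeRing laurentRing

  -- Restarting both factors of a product at the exponents of their bounds makes the coefficient at
  -- the sum of the starts a single product; this gives `coefficient-lead-*`.
  rebase : ∀ ξ a → ∣ ξ ∣≤q^ a → ξ ≃ laurent (ℤ.- a) (λ i → coefficient ξ (ℤ.- a ℤ.+ + i))
  rebase ξ a ξ≤a = mk λ n → trans (cases n (n ℤ.- (ℤ.- a)) ≡.refl)
                            (reflexive (≡.sym (coefficient-at ξ′ n (n ℤ.- (ℤ.- a)) ≡.refl)))
    where
    f = λ i → coefficient ξ (ℤ.- a ℤ.+ + i)
    ξ′ = laurent (ℤ.- a) f
    s+n-s≡n : ∀ s n → s ℤ.+ (n ℤ.- s) ≡ n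
    s+n-s≡n = solve 2 (λ s n → s :+ (n :- s) := n) ≡.refl
      where open +-*-Solver
    cases : ∀ n z → n ℤ.- (ℤ.- a) ≡ z → coefficient ξ n ≈ at f z
    cases n (+ i) eq = reflexive (≡.cong (coefficient ξ)
                          (≡.trans (≡.sym (s+n-s≡n (ℤ.- a) n)) (≡.cong (ℤ._+_ (ℤ.- a)) eq)))
    cases n -[1+ i ] eq = ξ≤a n (ℤ.≰⇒> λ -a≤n → ℤ.<⇒≱ (≡.subst (ℤ._< ℤ.0ℤ) (≡.sym eq) ℤ.-<+) (ℤ.i≤j⇒0≤j-i -a≤n))

  coefficient-lead-* : ∀ ξ η a b → ∣ ξ ∣≤q^ a → ∣ η ∣≤q^ b →
                 ∣ ξ *ₗ η ∣≤q^ (a ℤ.+ b) ×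
                 coefficient (ξ *ₗ η) (ℤ.- (a ℤ.+ b)) ≈ coefficient ξ (ℤ.- a) * coefficient η (ℤ.- b)
  coefficient-lead-* ξ η a b ξ≤a η≤b =
    (λ n n<s → trans (_≃_.coef≈ product n) (reflexive (coefficient-below (ξ′ *ₗ η′) (≡.subst (n ℤ.<_) s≡ n<s)))) ,
    trans (_≃_.coef≈ product (ℤ.- (a ℤ.+ b)))
      (trans (reflexive (≡.trans (≡.cong (coefficient (ξ′ *ₗ η′)) (≡.trans s≡ (≡.sym (ℤ.+-identityʳ _))))
                        (coefficient-digit (ξ′ *ₗ η′) 0)))
        (trans (+-identityʳ _) (reflexive (≡.cong₂ (λ i j → coefficient ξ i * coefficient η j) (ℤ.+-identityʳ (ℤ.- a)) (ℤ.+-identityʳ (ℤ.- b))))))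
    where
    ξ′ = laurent (ℤ.- a) (λ i → coefficient ξ (ℤ.- a ℤ.+ + i))
    η′ = laurent (ℤ.- b) (λ i → coefficient η (ℤ.- b ℤ.+ + i))
    product : ξ *ₗ η ≃ ξ′ *ₗ η′
    product = *ₗ-cong (rebase ξ a ξ≤a) (rebase η b η≤b)
    s≡ : ℤ.- (a ℤ.+ b) ≡ ℤ.- a ℤ.+ ℤ.- b
    s≡ = ℤ.neg-distrib-+ a b

  coefficient-T^ : ∀ e → coefficient T^[ e ] (ℤ.- e) ≈ 1#
  coefficient-T^ e = reflexive (coefficient-at T^[ e ] (ℤ.- e) (+ 0) (ℤ.+-inverseʳ (ℤ.- e)))

  coefficient-constant-like : ∀ s f n → (∀ i → f (suc i) ≈ 0#) → n ≡.≢ s → coefficient (laurent s f) n ≈ 0#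
  coefficient-constant-like s f n f≈0 n≢s with n ℤ.- s in eq
  ... | + zero   = ⊥-elim (n≢s (ℤ.i-j≡0⇒i≡j n s eq))
  ... | + suc i  = f≈0 i
  ... | -[1+ _ ] = refl

  coefficient-T^-≢ : ∀ e n → n ≡.≢ ℤ.- e → coefficient T^[ e ] n ≈ 0#
  coefficient-T^-≢ e n = coefficient-constant-like (ℤ.- e) (digit T^[ e ]) n λ _ → refl

  coefficient-T^* : ∀ e ξ n → coefficient (T^[ e ] *ₗ ξ) n ≈ coefficient ξ (n ℤ.+ e)
  coefficient-T^* e ξ n = trans (_≃_.coef≈ product n)
    (reflexive (≡.trans (coefficient-at _ n _ (lemma n e (start ξ))) (≡.sym (coefficient-at ξ (n ℤ.+ e) _ ≡.refl))))
    where
    digits : conv (digit T^[ e ]) (digit ξ) ≐ digit ξ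
    digits i = trans (conv-cong {f = digit T^[ e ]} {f′ = one} {g = digit ξ} (λ { zero → refl ; (suc _) → refl }) (λ _ → refl) i) (conv-identityˡ (digit ξ) i)
    product : T^[ e ] *ₗ ξ ≃ laurent (ℤ.- e ℤ.+ start ξ) (digit ξ)
    product = laurent-cong ≡.refl digits
    lemma : ∀ n e s → n ℤ.- (ℤ.- e ℤ.+ s) ≡ n ℤ.+ e ℤ.- s
    lemma = solve 3 (λ n e s → n :- (:- e :+ s) := n :+ e :- s) ≡.refl
      where open +-*-Solver

  constant-cong : ∀ {x y} → x ≈ y → constant x ≃ constant y
  constant-cong e = laurent-cong ≡.refl λ { zero → e ; (suc _) → refl }

  constant-isRingHomomorphism : IsRingHomomorphism k laurentRawRing constant
  constant-isRingHomomorphism = record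
    { isSemiringHomomorphism = record
      { isNearSemiringHomomorphism = record
        { +-isMonoidHomomorphism = record
          { isMagmaHomomorphism = record
            { isRelHomomorphism = record { cong = λ e → _≃_.coef≈ (constant-cong e) }
            ; homo = λ x y → _≃_.coef≈ (≃.sym (≃.trans (laurent-+ (+ 0) (digit (constant x)) (digit (constant y)))
                (laurent-cong ≡.refl λ { zero → refl ; (suc _) → +-identityˡ 0# })))
            }
          ; ε-homo = λ _ → refl
          }
        ; *-homo = λ x y → _≃_.coef≈ (laurent-cong ≡.refl
            λ { zero → sym (+-identityʳ _)
              ; (suc i) → sym (trans (+-cong (zeroʳ x) (conv-zeroˡ (λ _ → 0#) (digit (constant y)) (λ _ → refl) i)) (+-identityˡ 0#)) })
        }
      ; 1#-homo = λ _ → refl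
      }
    ; -‿homo = λ x → _≃_.coef≈ (laurent-cong ≡.refl λ { zero → refl ; (suc _) → sym -0≈0 })
    }

  coefficient-constant-≢0 : ∀ x n → n ≡.≢ + 0 → coefficient (constant x) n ≈ 0#
  coefficient-constant-≢0 x n = coefficient-constant-like (+ 0) (digit (constant x)) n λ _ → refl

  coefficient-∷ : ∀ x p n → coefficient (embed (x ∷ p)) n ≈ coefficient (constant x) n + coefficient (embed p) (n ℤ.+ + 1)
  coefficient-∷ x p n = trans (coefficient-+ (constant x) (T^[ + 1 ] *ₗ embed p) n)
                              (+-congˡ (coefficient-T^* (+ 1) (embed p) n))

  coefficient-embed-pos : ∀ p i → coefficient (embed p) (+ suc i) ≈ 0#
  coefficient-embed-pos []      i = coefficient-0 (+ suc i)
  coefficient-embed-pos (x ∷ p) i = trans (coefficient-∷ x p (+ suc i))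
    (trans (+-cong (coefficient-constant-≢0 x (+ suc i) λ ())
             (trans (reflexive (≡.cong (λ i → coefficient (embed p) (+ suc i)) (ℕ.+-comm i 1)))
                    (coefficient-embed-pos p (suc i))))
      (+-identityˡ 0#))

  coefficient-embed-neg : ∀ p i → coefficient (embed p) (ℤ.- + i) ≈ coeff p i
  coefficient-embed-neg []      i       = coefficient-0 (ℤ.- + i)
  coefficient-embed-neg (x ∷ p) zero    = trans (coefficient-∷ x p (+ 0))
    (trans (+-congˡ (coefficient-embed-pos p 0)) (+-identityʳ x))
  coefficient-embed-neg (x ∷ p) (suc i) = trans (coefficient-∷ x p (ℤ.- + suc i))
    (trans (+-cong (coefficient-constant-≢0 x (ℤ.- + suc i) λ ())
             (trans (reflexive (≡.cong (coefficient (embed p)) (lemma i))) (coefficient-embed-neg p i)))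
      (+-identityˡ _))
    where
    lemma : ∀ i → ℤ.- + suc i ℤ.+ + 1 ≡ ℤ.- + i
    lemma zero    = ≡.refl
    lemma (suc i) = ≡.refl

  -- The arithmetic that follows sees Laurent series only through their coefficients, behind the
  -- fields of `LaurentField`, so that products do not unfold to digit sequences.
  laurentField : ¬ 1# ≈ 0# → (∀ x y → Dec (x ≈ y)) → (∀ {x y} → x * y ≈ 0# → x ≈ 0# ⊎ y ≈ 0#) → LaurentField K
  laurentField 1≉0 _≟_ domain = record
    { 1≉0 = 1≉0
    ; _≟_ = _≟_
    ; domain = domain
    ; A = polyRing
    ; L = laurentRing
    ; coeffₐ = coeff
    ; coeffₐ-cong = λ e → e
    ; coeffₐ-ext = λ e → e
    ; coeffₐ-finite = λ a → length a , coeff-length a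
    ; coef = coefficient
    ; coef-cong = λ e → e
    ; coef-ext = λ e → e
    ; coef-+ = coefficient-+
    ; coef-neg = coefficient-neg
    ; coef-0 = coefficient-0
    ; coef-finite = λ ξ → start ξ , λ n n<s → reflexive (coefficient-below ξ n<s)
    ; coef-lead-* = coefficient-lead-*
    ; T^ = T^[_]
    ; T^0 = _≃_.coef≈ (laurent-cong ≡.refl λ { zero → refl ; (suc _) → refl })
    ; coef-T^ = coefficient-T^
    ; coef-T^-≢ = coefficient-T^-≢
    ; coef-T^* = coefficient-T^*
    ; emb = embed
    ; emb-hom = Evaluation.ev-isRingHomomorphism K laurentRing constant constant-isRingHomomorphism T^[ + 1 ]
    ; coef-emb-neg = coefficient-embed-neg
    ; coef-emb-pos = coefficient-embed-pos
    ; polynomial = λ f B → fromFun f (suc B) , (λ i i≤B → coeff-fromFun f (suc B) i (ℕ.s≤s i≤B)) , coeff-fromFun-≥ f (suc B)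
    }
    where open Convolution K using (coeff-length; fromFun; coeff-fromFun; coeff-fromFun-≥)

-- Absolute values and denominators

module ValuedEvaluation {c ℓ c₁ ℓ₁ ℓ₂} (R : CommutativeRing c ℓ) (S : CommutativeRing c₁ ℓ₁)
    (ι : CommutativeRing.Carrier R → CommutativeRing.Carrier S)
    (Le : CommutativeRing.Carrier S → ℤ → Set ℓ₂)
    (le-cong : ∀ {x y e} → CommutativeRing._≈_ S x y → Le x e → Le y e)
    (le-0 : ∀ {e} → Le (CommutativeRing.0# S) e)
    (le-+ : ∀ {x y e} → Le x e → Le y e → Le (CommutativeRing._+_ S x y) e)
    (le-* : ∀ {x y a b} → Le x a → Le y b → Le (CommutativeRing._*_ S x y) (a ℤ.+ b)) where
  private module R = CommutativeRing R
  open CommutativeRing S hiding (zero)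
  open Polynomial R.rawRing
  open Solver S

  ev-le : ∀ p {x h} → (∀ i → Le (ι (coeff p i)) h) → Le x (+ 0) → Le (eval rawRing ι p x) h
  ev-le []      p≤h x≤0 = le-0
  ev-le (a ∷ p) p≤h x≤0 = le-+ (p≤h 0) (≡.subst (Le _) (ℤ.+-identityˡ _) (le-* x≤0 (ev-le p (p≤h ∘ suc) x≤0)))

  -- The factor `x - y` splits off inductively, and the remaining factors are harmless because `x`
  -- and `y` lie in the unit ball. The bound `Le` is abstract because the estimate serves both for
  -- Laurent series and for the algebraic closure.
  ev-diff-le : ∀ p {x y h e} → (∀ i → Le (ι (coeff p i)) h) → Le x (+ 0) → Le y (+ 0) → Le (x - y) e →
               Le (eval rawRing ι p x - eval rawRing ι p y) (e ℤ.+ h)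
  ev-diff-le []      p≤h x≤0 y≤0 d≤e = le-cong (sym (-‿inverseʳ 0#)) le-0
  ev-diff-le (a ∷ p) {x} {y} {h} {e} p≤h x≤0 y≤0 d≤e =
    le-cong (solve 5 (λ a x y u v → (x :- y) :* u :+ y :* (u :- v) := (a :+ x :* u) :- (a :+ y :* v)) refl (ι a) x y _ _)
      (le-+ (le-* d≤e (ev-le p (p≤h ∘ suc) x≤0))
            (≡.subst (Le _) (ℤ.+-identityˡ (e ℤ.+ h)) (le-* y≤0 (ev-diff-le p (p≤h ∘ suc) x≤0 y≤0 d≤e))))

module Valuation {c ℓ} (K : CommutativeRing c ℓ) (F : LaurentField K) where
  private module K = CommutativeRing K
  open LaurentField F
  open L hiding (zero)
  open SemiringExp semiring using (_^_)
  open Solver L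
  private module emb = IsRingHomomorphism emb-hom
  open SetoidReasoning setoid

  record Le (ξ : Carrier) (e : ℤ) : Set ℓ where
    constructor mkLe
    field vanish : ∀ n → n ℤ.< ℤ.- e → coef ξ n K.≈ K.0#
  open Le public

  Ex : Carrier → ℤ → Set ℓ
  Ex ξ e = Le ξ e × ¬ coef ξ (ℤ.- e) K.≈ K.0#

  le-cong : ∀ {ξ η e} → ξ ≈ η → Le ξ e → Le η e
  le-cong ξ≈η (mkLe ξ≤e) = mkLe λ n n< → K.trans (K.sym (coef-cong ξ≈η n)) (ξ≤e n n<)

  le-mono : ∀ {ξ a b} → a ℤ.≤ b → Le ξ a → Le ξ b
  le-mono a≤b (mkLe ξ≤a) = mkLe λ n n< → ξ≤a n (ℤ.<-≤-trans n< (ℤ.neg-mono-≤ a≤b))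

  le-0 : ∀ {e} → Le 0# e
  le-0 = mkLe λ n _ → coef-0 n

  le-+ : ∀ {ξ η e} → Le ξ e → Le η e → Le (ξ + η) e
  le-+ {ξ} {η} (mkLe ξ≤e) (mkLe η≤e) = mkLe λ n n< → K.trans (coef-+ ξ η n) (K.trans (K.+-cong (ξ≤e n n<) (η≤e n n<)) (K.+-identityˡ _))

  -0≈0 : K.- K.0# K.≈ K.0#
  -0≈0 = RingProperties.-0#≈0# K.ring

  le-neg : ∀ {ξ e} → Le ξ e → Le (- ξ) e
  le-neg {ξ} (mkLe ξ≤e) = mkLe λ n n< → K.trans (coef-neg ξ n) (K.trans (K.-‿cong (ξ≤e n n<)) -0≈0)

  le-- : ∀ {ξ η e} → Le ξ e → Le η e → Le (ξ - η) e
  le-- ξ≤e η≤e = le-+ ξ≤e (le-neg η≤e)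

  le-* : ∀ {ξ η a b} → Le ξ a → Le η b → Le (ξ * η) (a ℤ.+ b)
  le-* {ξ} {η} {a} {b} (mkLe ξ≤a) (mkLe η≤b) = mkLe (proj₁ (coef-lead-* ξ η a b ξ≤a η≤b))

  ex-cong : ∀ {ξ η e} → ξ ≈ η → Ex ξ e → Ex η e
  ex-cong ξ≈η (ξ≤e , ≉) = le-cong ξ≈η ξ≤e , λ z → ≉ (K.trans (coef-cong ξ≈η _) z)

  ex-* : ∀ {ξ η a b} → Ex ξ a → Ex η b → Ex (ξ * η) (a ℤ.+ b)
  ex-* {ξ} {η} {a} {b} (mkLe ξ≤a , ξ≉) (mkLe η≤b , η≉) with coef-lead-* ξ η a b ξ≤a η≤b
  ... | le , lead = mkLe le , λ z → [ ξ≉ , η≉ ]′ (domain (K.trans (K.sym lead) z))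

  ex-+ : ∀ {ξ η a b} → Ex ξ a → Le η b → b ℤ.< a → Ex (ξ + η) a
  ex-+ {ξ} {η} {a} (ξ≤a , ξ≉) η≤b b<a = le-+ ξ≤a (le-mono (ℤ.<⇒≤ b<a) η≤b) ,
    λ z → ξ≉ (K.trans (K.trans (K.sym (K.+-identityʳ _)) (K.+-congˡ (K.sym (vanish η≤b (ℤ.- a) (ℤ.neg-mono-< b<a)))))
                (K.trans (K.sym (coef-+ ξ η (ℤ.- a))) z))

  ex-neg : ∀ {ξ e} → Ex ξ e → Ex (- ξ) e
  ex-neg {ξ} {e} (ξ≤e , ξ≉) = le-neg ξ≤e , λ z → ξ≉ (K.trans (K.sym (RingProperties.-‿involutive K.ring _))
    (K.trans (K.-‿cong (K.trans (K.sym (coef-neg ξ (ℤ.- e))) z)) -0≈0))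

  ex-le : ∀ {ξ a b} → Ex ξ a → Le ξ b → a ℤ.≤ b
  ex-le {a = a} (_ , ξ≉) ξ≤b = ℤ.≮⇒≥ λ b<a → ξ≉ (vanish ξ≤b (ℤ.- a) (ℤ.neg-mono-< b<a))

  ex-T^ : ∀ e → Ex (T^ e) e
  ex-T^ e = mkLe (λ n n< → coef-T^-≢ e n (ℤ.<⇒≢ n<)) , λ z → 1≉0 (K.trans (K.sym (coef-T^ e)) z)

  ex-1 : Ex 1# (+ 0)
  ex-1 = ex-cong T^0 (ex-T^ (+ 0))

  le-^ : ∀ {ξ} n → Le ξ (+ 0) → Le (ξ ^ n) (+ 0)
  le-^ zero    ξ≤0 = proj₁ ex-1
  le-^ (suc n) ξ≤0 = le-* ξ≤0 (le-^ n ξ≤0)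

  le-^-suc : ∀ {ξ e} n → e ℤ.≤ + 0 → Le ξ e → Le (ξ ^ suc n) e
  le-^-suc n e≤0 ξ≤e = ≡.subst (Le _) (ℤ.+-identityʳ _) (le-* ξ≤e (le-^ n (le-mono e≤0 ξ≤e)))

  -- Whether a series is zero is not decidable, but a known nonzero coefficient leaves only finitely
  -- many indices, from the start of the series up to `n`, to be tested.
  find-ex : ∀ ξ n → ¬ coef ξ n K.≈ K.0# → ∃[ e ] Ex ξ e × ℤ.- n ℤ.≤ e
  find-ex ξ n ξ≉ with coef-finite ξ
  ... | s , below with ℤ.≤-total s n
  ... | inj₂ n≤s with n ℤ.≟ s
  ...   | no n≢s      = ⊥-elim (ξ≉ (below n (ℤ.≤∧≢⇒< n≤s n≢s)))
  ...   | yes ≡.refl  = ℤ.- n , (mkLe (λ m m< → below m (≡.subst (m ℤ.<_) (ℤ.neg-involutive n) m<)) ,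
                          λ z → ξ≉ (≡.subst (λ m → coef ξ m K.≈ K.0#) (ℤ.neg-involutive n) z)) , ℤ.≤-refl
  find-ex ξ n ξ≉ | s , below | inj₁ s≤n = go ℤ.∣ n ℤ.- s ∣ s n≡ below
    where
    lemma₁ : ∀ s n → s ℤ.+ (n ℤ.- s) ≡ n
    lemma₁ = Z.solve 2 (λ s n → s Z.:+ (n Z.:- s) Z.:= n) ≡.refl where module Z = +-*-Solver
    lemma₂ : ∀ s i → s ℤ.+ (+ 1 ℤ.+ i) ≡ (+ 1 ℤ.+ s) ℤ.+ i
    lemma₂ = Z.solve 2 (λ s i → s Z.:+ (Z.con (+ 1) Z.:+ i) Z.:= (Z.con (+ 1) Z.:+ s) Z.:+ i) ≡.refl where module Z = +-*-Solver
    n≡ : n ≡ s ℤ.+ + ℤ.∣ n ℤ.- s ∣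
    n≡ = ≡.sym (≡.trans (≡.cong (ℤ._+_ s) (ℤ.0≤i⇒+∣i∣≡i (ℤ.i≤j⇒0≤j-i s≤n))) (lemma₁ s n))
    exact : ∀ s → s ℤ.≤ n → (∀ m → m ℤ.< s → coef ξ m K.≈ K.0#) → ¬ coef ξ s K.≈ K.0# → ∃[ e ] Ex ξ e × ℤ.- n ℤ.≤ e
    exact s s≤n below ≉ = ℤ.- s , (mkLe (λ m m< → below m (≡.subst (m ℤ.<_) (ℤ.neg-involutive s) m<)) ,
                          λ z → ≉ (≡.subst (λ m → coef ξ m K.≈ K.0#) (ℤ.neg-involutive s) z)) , ℤ.neg-mono-≤ s≤n
    go : ∀ i s → n ≡ s ℤ.+ + i → (∀ m → m ℤ.< s → coef ξ m K.≈ K.0#) → ∃[ e ] Ex ξ e × ℤ.- n ℤ.≤ e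
    go i s n≡ below with coef ξ s ≟ K.0#
    ... | no ≉ = exact s (≡.subst (s ℤ.≤_) (≡.sym n≡) (ℤ.i≤i+j s (+ i))) below ≉
    go zero    s n≡ below | yes z = ⊥-elim (ξ≉ (≡.subst (λ m → coef ξ m K.≈ K.0#) (≡.sym (≡.trans n≡ (ℤ.+-identityʳ s))) z))
    go (suc i) s n≡ below | yes z = go i (ℤ.suc s) (≡.trans n≡ (lemma₂ s (+ i))) below′
      where
      below′ : ∀ m → m ℤ.< ℤ.suc s → coef ξ m K.≈ K.0#
      below′ m m< with m ℤ.≟ s
      ... | yes ≡.refl = z
      ... | no m≢s     = below m (ℤ.≤∧≢⇒< (≡.subst (m ℤ.≤_) (ℤ.pred-suc s) (ℤ.i<j⇒i≤pred[j] m<)) m≢s)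

  le⇒0 : ∀ {ξ} → (∀ M → Le ξ (ℤ.- + M)) → ξ ≈ 0#
  le⇒0 {ξ} small = coef-ext λ n → K.trans (vanish (small (suc ℤ.∣ n ∣)) n
    (≡.subst (n ℤ.<_) (≡.sym (ℤ.neg-involutive (+ suc ℤ.∣ n ∣))) (n<∣n∣ n))) (K.sym (coef-0 n))
    where
    n<∣n∣ : ∀ n → n ℤ.< + suc ℤ.∣ n ∣
    n<∣n∣ (+ n)    = ℤ.+<+ (ℕ.n<1+n n)
    n<∣n∣ -[1+ n ] = ℤ.-<+

  -- Cancellation without inverses: a nonzero coefficient of `η` would give `η`, and hence the
  -- product, an exact absolute value. Decidability in `K` removes the double negation coefficient
  -- by coefficient.
  ex-cancel : ∀ {ξ η a} → Ex ξ a → ξ * η ≈ 0# → η ≈ 0#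
  ex-cancel {ξ} {η} ex e = coef-ext λ n → K.trans (decidable-stable (_ ≟ _) λ ≉ → nonzero n ≉) (K.sym (coef-0 n))
    where
    nonzero : ∀ n → ¬ ¬ coef η n K.≈ K.0#
    nonzero n ≉ with find-ex η n ≉
    ... | b , exb , _ = proj₂ (ex-* ex exb) (K.trans (coef-cong e _) (coef-0 _))

  T^-+ : ∀ a b → T^ a * T^ b ≈ T^ (a ℤ.+ b)
  T^-+ a b = coef-ext coefs
    where
    lemma : ∀ a b → ℤ.- (a ℤ.+ b) ℤ.+ a ≡ ℤ.- b
    lemma = Z.solve 2 (λ a b → Z.:- (a Z.:+ b) Z.:+ a Z.:= Z.:- b) ≡.refl where module Z = +-*-Solver
    lemma′ : ∀ a b n → n ≡ ℤ.- b ℤ.+ (n ℤ.+ b)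
    lemma′ = Z.solve 3 (λ a b n → n Z.:= Z.:- b Z.:+ (n Z.:+ b)) ≡.refl where module Z = +-*-Solver
    coefs : ∀ n → coef (T^ a * T^ b) n K.≈ coef (T^ (a ℤ.+ b)) n
    coefs n with n ℤ.≟ ℤ.- (a ℤ.+ b)
    ... | yes ≡.refl = K.trans (coef-T^* a (T^ b) _) (K.trans (K.reflexive (≡.cong (coef (T^ b)) (lemma a b)))
                         (K.trans (coef-T^ b) (K.sym (coef-T^ (a ℤ.+ b)))))
    ... | no n≢ = K.trans (coef-T^* a (T^ b) n) (K.trans (coef-T^-≢ b (n ℤ.+ a) λ eq → n≢
                    (≡.trans (lemma″ a n) (≡.trans (≡.cong (ℤ._- a) eq) (lemma‴ a b))))
                    (K.sym (coef-T^-≢ (a ℤ.+ b) n n≢)))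
      where
      lemma″ : ∀ a n → n ≡ n ℤ.+ a ℤ.- a
      lemma″ = Z.solve 2 (λ a n → n Z.:= n Z.:+ a Z.:- a) ≡.refl where module Z = +-*-Solver
      lemma‴ : ∀ a b → ℤ.- b ℤ.- a ≡ ℤ.- (a ℤ.+ b)
      lemma‴ = Z.solve 2 (λ a b → Z.:- b Z.:- a Z.:= Z.:- (a Z.:+ b)) ≡.refl where module Z = +-*-Solver

  open ValuedEvaluation A L emb Le le-cong le-0 le-+ le-* public

  emb-le⇒degree : ∀ {a H} → Le (emb a) (+ H) → ∀ i → H ℕ.< i → coeffₐ a i K.≈ K.0#
  emb-le⇒degree {a} le i H<i = K.trans (K.sym (coef-emb-neg a i)) (vanish le (ℤ.- + i) (ℤ.neg-mono-< (ℤ.+<+ H<i)))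

  degree⇒emb-le : ∀ {a H} → (∀ i → H ℕ.< i → coeffₐ a i K.≈ K.0#) → Le (emb a) (+ H)
  degree⇒emb-le {a} {H} deg = mkLe cases
    where
    H< : ∀ n H → -[1+ n ] ℤ.< ℤ.- + H → H ℕ.< suc n
    H< n zero    _           = ℕ.s≤s ℕ.z≤n
    H< n (suc H) (ℤ.-<- H<n) = ℕ.s≤s H<n
    cases : ∀ n → n ℤ.< ℤ.- + H → coef (emb a) n K.≈ K.0#
    cases (+ suc n)  n<  = coef-emb-pos a n
    cases (+ zero)   n<  with () ← ℤ.<⇒≱ n< (ℤ.neg-mono-≤ {+ 0} {+ H} (ℤ.+≤+ ℕ.z≤n))
    cases -[1+ n ]   n<  = K.trans (coef-emb-neg a (suc n)) (deg (suc n) (H< n H n<))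

  emb-0⇒0 : ∀ {a} → emb a ≈ 0# → a A.≈ A.0#
  emb-0⇒0 {a} e = coeffₐ-ext λ i → K.trans (K.sym (coef-emb-neg a i))
    (K.trans (coef-cong (trans e (sym emb.0#-homo)) (ℤ.- + i)) (coef-emb-neg A.0# i))

  emb-small⇒0 : ∀ {a e} → e ℤ.< + 0 → Le (emb a) e → a A.≈ A.0#
  emb-small⇒0 {a} {e} e<0 (mkLe le) = emb-0⇒0 (coef-ext λ n → K.trans (zeros n) (K.sym (coef-0 n)))
    where
    zeros : ∀ n → coef (emb a) n K.≈ K.0#
    zeros (+ suc n)  = coef-emb-pos a n
    zeros (+ zero)   = le (+ 0) (ℤ.neg-mono-< e<0)
    zeros -[1+ n ]   = le -[1+ n ] (ℤ.<-trans ℤ.-<+ (ℤ.neg-mono-< e<0))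

  zero-or-degree : ∀ a → a A.≈ A.0# ⊎ (∃[ h ] Ex (emb a) (+ h))
  zero-or-degree a with coeffₐ-finite a
  ... | d , above = go d above
    where
    go : ∀ d → (∀ i → d ℕ.≤ i → coeffₐ a i K.≈ K.0#) → a A.≈ A.0# ⊎ (∃[ h ] Ex (emb a) (+ h))
    go zero    above = inj₁ (coeffₐ-ext λ i → K.trans (above i ℕ.z≤n)
      (K.sym (K.trans (K.sym (coef-emb-neg A.0# i)) (K.trans (coef-cong emb.0#-homo _) (coef-0 _)))))
    go (suc d) above with coeffₐ a d ≟ K.0#
    ... | no ≉  = inj₂ (d , degree⇒emb-le above , λ z → ≉ (K.trans (K.sym (coef-emb-neg a d)) z))
    ... | yes z = go d λ i d≤i → case i d≤i
      where
      case : ∀ i → d ℕ.≤ i → coeffₐ a i K.≈ K.0#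
      case i d≤i with d ℕ.≟ i
      ... | yes ≡.refl = z
      ... | no d≢i     = above i (ℕ.≤∧≢⇒< d≤i d≢i)

  ex⇒≉0 : ∀ {ξ e} → Ex ξ e → ¬ ξ ≈ 0#
  ex⇒≉0 (_ , ≉) z = ≉ (K.trans (coef-cong z _) (coef-0 _))

  A-zero? : ∀ a → Dec (a A.≈ A.0#)
  A-zero? a with zero-or-degree a
  ... | inj₁ z = yes z
  ... | inj₂ (h , ex) = no λ z → ex⇒≉0 ex (trans (emb.⟦⟧-cong z) emb.0#-homo)

  A-domain : ∀ {a b} → a A.* b A.≈ A.0# → a A.≈ A.0# ⊎ b A.≈ A.0#
  A-domain {a} {b} e with zero-or-degree a
  ... | inj₁ z = inj₁ z
  ... | inj₂ (h , ex) = inj₂ (emb-0⇒0 (ex-cancel ex (trans (sym (emb.*-homo a b)) (trans (emb.⟦⟧-cong e) emb.0#-homo))))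

  -- Membership in `T^(−B) k[T]`. Powers of `T` are the only denominators that occur, as all
  -- rational numbers in question come from truncations.
  Rat : ℕ → Carrier → Set _
  Rat B ξ = ∃[ w ] emb w ≈ T^ (+ B) * ξ

  T^-polynomial : ∀ B → ∃[ w ] emb w ≈ T^ (+ B)
  T^-polynomial B with polynomial (λ i → coef (T^ (+ B)) (ℤ.- + i)) B
  ... | w , below , above = w , coef-ext coefs
    where
    coefs : ∀ n → coef (emb w) n K.≈ coef (T^ (+ B)) n
    coefs (+ suc n) = K.trans (coef-emb-pos w n) (K.sym (coef-T^-≢ (+ B) (+ suc n) (pos≢ B)))
      where
      pos≢ : ∀ B → + suc n ≡.≢ ℤ.- + B
      pos≢ zero    ()
      pos≢ (suc B) ()
    coefs (+ zero) = K.trans (coef-emb-neg w 0) (below 0 ℕ.z≤n)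
    coefs -[1+ n ] with suc n ℕ.≤? B
    ... | yes n≤B = K.trans (coef-emb-neg w (suc n)) (below (suc n) n≤B)
    ... | no n≰B  = K.trans (coef-emb-neg w (suc n)) (K.trans (above (suc n) (ℕ.≰⇒> n≰B))
                      (K.sym (coef-T^-≢ (+ B) -[1+ n ] λ eq → n≰B (ℕ.≤-reflexive (ℤ.+-injective (ℤ.neg-injective eq))))))

  rat-cong : ∀ {B ξ η} → ξ ≈ η → Rat B ξ → Rat B η
  rat-cong ξ≈η (w , e) = w , trans e (*-congˡ ξ≈η)

  rat-+ : ∀ {B ξ η} → Rat B ξ → Rat B η → Rat B (ξ + η)
  rat-+ (w , e) (w′ , e′) = w A.+ w′ , trans (emb.+-homo w w′) (trans (+-cong e e′) (sym (distribˡ _ _ _)))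

  rat-neg : ∀ {B ξ} → Rat B ξ → Rat B (- ξ)
  rat-neg (w , e) = A.- w , trans (emb.-‿homo w) (trans (-‿cong e) (solve 2 (λ t x → :- (t :* x) := t :* :- x) refl _ _))

  rat-* : ∀ {B C ξ η} → Rat B ξ → Rat C η → Rat (B ℕ.+ C) (ξ * η)
  rat-* {B} {C} {ξ} {η} (w , e) (w′ , e′) = w A.* w′ , (begin
    emb (w A.* w′)                        ≈⟨ emb.*-homo w w′ ⟩
    emb w * emb w′                        ≈⟨ *-cong e e′ ⟩
    (T^ (+ B) * ξ) * (T^ (+ C) * η)       ≈⟨ solve 4 (λ a x b y → (a :* x) :* (b :* y) := (a :* b) :* (x :* y)) refl _ _ _ _ ⟩
    (T^ (+ B) * T^ (+ C)) * (ξ * η)       ≈⟨ *-congʳ (T^-+ (+ B) (+ C)) ⟩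
    T^ (+ (B ℕ.+ C)) * (ξ * η) ∎)

  rat-0 : ∀ {B} → Rat B 0#
  rat-0 = A.0# , trans emb.0#-homo (sym (zeroʳ _))

  rat-emb : ∀ a → Rat 0 (emb a)
  rat-emb a = a , sym (trans (*-congʳ T^0) (*-identityˡ _))

  rat-1 : ∀ B → Rat B 1#
  rat-1 B with T^-polynomial B
  ... | w , e = w , trans e (sym (*-identityʳ _))

  rat-mono : ∀ {B C ξ} → B ℕ.≤ C → Rat B ξ → Rat C ξ
  rat-mono {B} {C} {ξ} B≤C r = ≡.subst (λ n → Rat n ξ) (ℕ.m∸n+n≡m B≤C) (rat-cong (*-identityˡ ξ) (rat-* (rat-1 (C ∸ B)) r))

  rat-^ : ∀ {B ξ} n → Rat B ξ → Rat (n ℕ.* B) (ξ ^ n)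
  rat-^ zero    r = rat-1 0
  rat-^ (suc n) r = rat-* r (rat-^ n r)

  rat-T^ : ∀ B → Rat B (T^ (ℤ.- + B))
  rat-T^ B = A.1# , trans emb.1#-homo (sym (trans (T^-+ (+ B) (ℤ.- + B)) (trans (reflexive (≡.cong T^ (ℤ.+-inverseʳ (+ B)))) T^0)))

  -- Here `T^B ξ` is a polynomial of absolute value below 1. This is the analogue of a nonzero
  -- integer being at least 1 in absolute value.
  rat-small⇒0 : ∀ {B ξ e} → e ℤ.< ℤ.- + B → Rat B ξ → Le ξ e → ξ ≈ 0#
  rat-small⇒0 {B} {ξ} {e} e<-B (w , eq) ξ≤e = ex-cancel (ex-T^ (+ B)) (trans (sym eq)
    (trans (emb.⟦⟧-cong (emb-small⇒0 (≡.subst (+ B ℤ.+ e ℤ.<_) (ℤ.+-inverseʳ (+ B)) (ℤ.+-monoʳ-< (+ B) e<-B))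
              (le-cong (sym eq) (le-* (proj₁ (ex-T^ (+ B))) ξ≤e)))) emb.0#-homo))

-- Truncations of the tail of ξ

^-injectiveʳ : ∀ {b} → 2 ℕ.≤ b → ∀ m n → b ℕ.^ m ≡ b ℕ.^ n → m ≡ n
^-injectiveʳ {b} b≥2 m n eq with ℕ.<-cmp m n
... | tri< m<n _ _ = ⊥-elim (ℕ.<⇒≢ (ℕ.^-monoʳ-< b b≥2 m<n) eq)
... | tri≈ _ m≡n _ = m≡n
... | tri> _ _ n<m = ⊥-elim (ℕ.<⇒≢ (ℕ.^-monoʳ-< b b≥2 n<m) (≡.sym eq))

^-cancelʳ-< : ∀ {b} → 1 ℕ.≤ b → ∀ m n → b ℕ.^ m ℕ.< b ℕ.^ n → m ℕ.< n
^-cancelʳ-< {suc b} _ m n lt = ℕ.≰⇒> λ n≤m → ℕ.<⇒≱ lt (ℕ.^-monoʳ-≤ (suc b) n≤m)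

∤-suc-multiple : ∀ {b} → 2 ℕ.≤ b → ∀ t → ¬ b ∣ suc (t ℕ.* b)
∤-suc-multiple {b} b≥2 t b∣ = ℕ.<⇒≢ b≥2 (≡.sym (∣1⇒≡1 (∣m+n∣m⇒∣n (≡.subst (b ∣_) (ℕ.+-comm 1 (t ℕ.* b)) b∣) (divides t ≡.refl))))

module Approximation {c ℓ} (K : CommutativeRing c ℓ) (F : LaurentField K)
    (p : ℕ) (p-prime : Prime p)
    (char : Characteristic K p) where
  private module K = CommutativeRing K
  open LaurentField F
  open L hiding (zero)
  open Valuation K F
  open SemiringExp semiring using (_^_; ^-congˡ; ^-congʳ; ^-assocʳ)
  open MonoidMult +-monoid renaming (_×_ to _×ₘ_)  using ()
  open MonoidMult K.+-monoid renaming (_×_ to _×ᴷ_) using ()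
  open Solver L
  open SetoidReasoning setoid

  coef-× : ∀ n ξ i → coef (n ×ₘ ξ) i K.≈ n ×ᴷ coef ξ i
  coef-× zero    ξ i = coef-0 i
  coef-× (suc n) ξ i = K.trans (coef-+ ξ (n ×ₘ ξ) i) (K.+-congˡ (coef-× n ξ i))

  char-L : p ×ₘ 1# ≈ 0#
  char-L = coef-ext λ i → K.trans (coef-× p 1# i)
    (K.trans (Frobenius.p∣⇒×≈0 K p-prime char ∣-refl (coef 1# i)) (K.sym (coef-0 i)))

  coef-- : ∀ ξ η n → coef (ξ - η) n K.≈ coef ξ n K.- coef η n
  coef-- ξ η n = K.trans (coef-+ ξ (- η) n) (K.+-congˡ (coef-neg η n))

  0-0 : K.0# K.- K.0# K.≈ K.0#
  0-0 = K.-‿inverseʳ K.0#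

  psum : (ℕ → Carrier) → ℕ → Carrier
  psum f zero    = 0#
  psum f (suc n) = psum f n + f n

  Sum : (ℕ → Carrier) → Carrier → Set _
  Sum f s = ∀ M → ∃[ N ] ∀ n → N ℕ.≤ n → Le (psum f n - s) (ℤ.- + M)

  -- A precision finer than `T^(−x)` freezes that coefficient, so limits can be computed one
  -- coefficient at a time.
  sum-coef : ∀ {f s} → Sum f s → ∀ x → ∃[ N ] ∀ n → N ℕ.≤ n → coef s x K.≈ coef (psum f n) x
  sum-coef {f} {s} lim x with lim (suc ℤ.∣ x ∣)
  ... | N , close = N , λ n N≤n → K.sym (x-y≈0⇒x≈y (K.trans (K.sym (coef-- (psum f n) s x))
      (vanish (close n N≤n) x (≡.subst (x ℤ.<_) (≡.sym (ℤ.neg-involutive (+ suc ℤ.∣ x ∣))) (x<∣x∣ x)))))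
    where
    x<∣x∣ : ∀ x → x ℤ.< + suc ℤ.∣ x ∣
    x<∣x∣ (+ n)    = ℤ.+<+ (ℕ.n<1+n n)
    x<∣x∣ -[1+ n ] = ℤ.-<+
    x-y≈0⇒x≈y : ∀ {x y} → x K.- y K.≈ K.0# → x K.≈ y
    x-y≈0⇒x≈y = RingProperties.x∙y⁻¹≈ε⇒x≈y K.ring _ _

  psum-le : ∀ {f e} → (∀ n → Le (f n) e) → ∀ n → Le (psum f n) e
  psum-le f≤e zero    = le-0
  psum-le f≤e (suc n) = le-+ (psum-le f≤e n) (f≤e n)

  sum-le : ∀ {f s e} → Sum f s → (∀ n → Le (f n) e) → Le s e
  sum-le lim f≤e = mkLe λ x x< → let N , agree = sum-coef lim x in
    K.trans (agree N ℕ.≤-refl) (vanish (psum-le f≤e N) x x<)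

  sum-drop : ∀ {f s} i → Sum f s → Sum (λ n → f (n ℕ.+ i)) (s - psum f i)
  sum-drop {f} {s} i lim M with lim M
  ... | N , close = N , λ n N≤n → le-cong (begin
      psum f (n ℕ.+ i) - s                   ≈⟨ +-congʳ (split n) ⟩
      (psum f i + psum f′ n) - s             ≈⟨ solve 3 (λ a b s → (a :+ b) :- s := b :- (s :- a)) refl _ _ _ ⟩
      psum f′ n - (s - psum f i) ∎) (close (n ℕ.+ i) (ℕ.≤-trans N≤n (ℕ.m≤m+n n i)))
    where
    f′ : ℕ → Carrier
    f′ n = f (n ℕ.+ i)
    split : ∀ n → psum f (n ℕ.+ i) ≈ psum f i + psum f′ n
    split zero    = sym (+-identityʳ _)
    split (suc n) = trans (+-congʳ (split n)) (+-assoc _ _ _)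

  T⁻ : ℕ → Carrier
  T⁻ N = T^ (ℤ.- + N)

  coef-T⁻ : ∀ N → coef (T⁻ N) (+ N) K.≈ K.1#
  coef-T⁻ N = ≡.subst (λ x → coef (T⁻ N) x K.≈ K.1#) (ℤ.neg-involutive (+ N)) (coef-T^ (ℤ.- + N))

  coef-T⁻-≢ : ∀ N x → x ≡.≢ + N → coef (T⁻ N) x K.≈ K.0#
  coef-T⁻-≢ N x x≢ = coef-T^-≢ (ℤ.- + N) x λ eq → x≢ (≡.trans eq (ℤ.neg-involutive (+ N)))

  T⁻-^ : ∀ N e → T⁻ N ^ e ≈ T⁻ (e ℕ.* N)
  T⁻-^ N zero    = sym T^0
  T⁻-^ N (suc e) = trans (*-congˡ (T⁻-^ N e)) (trans (T^-+ (ℤ.- + N) (ℤ.- + (e ℕ.* N)))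
    (reflexive (≡.cong T^ (≡.sym (ℤ.neg-distrib-+ (+ N) (+ (e ℕ.* N)))))))

  IsPower : ℕ → Set
  IsPower e = ∃[ x ] e ≡ p ℕ.^ x

  isPower-^ : ∀ {e} → IsPower e → ∀ n → IsPower (e ℕ.^ n)
  isPower-^ (x , ≡.refl) n = x ℕ.* n , ℕ.^-*-assoc p x n

  p≥2 : 2 ℕ.≤ p
  p≥2 = ℕ.nonTrivial⇒n>1 p {{prime⇒nonTrivial p-prime}}

  isPower≥1 : ∀ {e} → IsPower e → 1 ℕ.≤ e
  isPower≥1 (x , ≡.refl) = ℕ.>-nonZero⁻¹ (p ℕ.^ x) {{ℕ.m^n≢0 p x {{prime⇒nonZero p-prime}}}}

  power-+ : ∀ {e} → IsPower e → ∀ x y → (x + y) ^ e ≈ x ^ e + y ^ e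
  power-+ (x , ≡.refl) = Frobenius.frobenius L p-prime char-L x

  power-- : ∀ {e} → IsPower e → ∀ x y → (x - y) ^ e ≈ x ^ e - y ^ e
  power-- {e} ie x y = begin
    (x - y) ^ e                     ≈⟨ solve 2 (λ a b → a := (a :+ b) :- b) refl _ _ ⟩
    ((x - y) ^ e + y ^ e) - y ^ e   ≈⟨ +-congʳ (power-+ ie (x - y) y) ⟨
    (x - y + y) ^ e - y ^ e         ≈⟨ +-congʳ (^-congˡ e (solve 2 (λ x y → x :- y :+ y := x) refl x y)) ⟩
    x ^ e - y ^ e ∎

  -- The Artin-Schreier map, additive when `e` is a power of `p`.
  Φ : ℕ → Carrier → Carrier
  Φ e x = x ^ e - x

  Φ-+ : ∀ {e} → IsPower e → ∀ x y → Φ e (x + y) ≈ Φ e x + Φ e y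
  Φ-+ ie x y = trans (+-congʳ (power-+ ie x y))
    (solve 4 (λ a b x y → (a :+ b) :- (x :+ y) := (a :- x) :+ (b :- y)) refl _ _ x y)

  Φ-- : ∀ {e} → IsPower e → ∀ x y → Φ e (x - y) ≈ Φ e x - Φ e y
  Φ-- ie x y = trans (+-congʳ (power-- ie x y))
    (solve 4 (λ a b x y → (a :- b) :- (x :- y) := (a :- x) :- (b :- y)) refl _ _ x y)

  Φ-cong : ∀ e {x y} → x ≈ y → Φ e x ≈ Φ e y
  Φ-cong e x≈y = +-cong (^-congˡ e x≈y) (-‿cong x≈y)

  -- `B` bounds the exponents that are kept, and hence the denominator, while `N` is the first
  -- exponent of the remainder. The quality of the approximation is the ratio of `N` to `B`, so long
  -- gaps are what matters.
  truncate : ∀ ζ B N → (∀ n → n ℤ.< + 0 → coef ζ n K.≈ K.0#) →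
             (∀ n → B ℕ.< n → n ℕ.< N → coef ζ (+ n) K.≈ K.0#) → B ℕ.< N → ¬ coef ζ (+ N) K.≈ K.0# →
             ∃[ h ] Rat B h × Ex (ζ - h) (ℤ.- + N)
  truncate ζ B N neg gap B<N lead with polynomial (λ i → coef ζ (+ B ℤ.- + i)) B
  -- The coefficient of `w = T^B h` at `T^i` is that of `ζ` at `T^(i − B)`, whence the reversed
  -- index.
  ... | w , below , above = h , rat , mkLe le , λ z → lead (K.trans (K.sym (lead-coef)) (≡.subst (λ x → coef (ζ - h) x K.≈ K.0#) (ℤ.neg-involutive (+ N)) z))
    where
    h = T⁻ B * emb w
    rat : Rat B h
    rat = w , sym (begin
      T^ (+ B) * (T⁻ B * emb w)   ≈⟨ *-assoc _ _ _ ⟨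
      (T^ (+ B) * T⁻ B) * emb w   ≈⟨ *-congʳ (trans (T^-+ (+ B) (ℤ.- + B)) (trans (reflexive (≡.cong T^ (ℤ.+-inverseʳ (+ B)))) T^0)) ⟩
      1# * emb w                  ≈⟨ *-identityˡ _ ⟩
      emb w ∎)
    coef-h : ∀ n z → n ℤ.+ ℤ.- + B ≡ z → coef h n K.≈ coef (emb w) z
    coef-h n z eq = K.trans (coef-T^* (ℤ.- + B) (emb w) n) (K.reflexive (≡.cong (coef (emb w)) eq))
    lemma : ∀ B i → + B ℤ.- i ℤ.+ ℤ.- + B ≡ ℤ.- i
    lemma B i = solveℤ (+ B) i
      where solveℤ : ∀ b i → b ℤ.- i ℤ.+ ℤ.- b ≡ ℤ.- i
            solveℤ = Z.solve 2 (λ b i → b Z.:- i Z.:+ Z.:- b Z.:= Z.:- i) ≡.refl where module Z = +-*-Solver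
    coef-h-≤ : ∀ i → coef h (+ B ℤ.- + i) K.≈ coef ζ (+ B ℤ.- + i)
    coef-h-≤ i with i ℕ.≤? B
    ... | yes i≤B = K.trans (coef-h _ _ (lemma B (+ i))) (K.trans (coef-emb-neg w i) (below i i≤B))
    ... | no i≰B  = K.trans (coef-h _ _ (lemma B (+ i))) (K.trans (coef-emb-neg w i)
                      (K.trans (above i (ℕ.≰⇒> i≰B)) (K.sym (neg _ (≡.subst (+ B ℤ.- + i ℤ.<_) (ℤ.+-inverseʳ (+ i)) (ℤ.+-monoˡ-< (ℤ.- + i) (ℤ.+<+ (ℕ.≰⇒> i≰B))))))))
    coef-h-> : ∀ i → coef h (+ (suc i ℕ.+ B)) K.≈ K.0#
    coef-h-> i = K.trans (coef-h _ (+ suc i) (solveℤ (+ suc i) (+ B))) (coef-emb-pos w i)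
      where solveℤ : ∀ a b → a ℤ.+ b ℤ.+ ℤ.- b ≡ a
            solveℤ = Z.solve 2 (λ a b → a Z.:+ b Z.:+ Z.:- b Z.:= a) ≡.refl where module Z = +-*-Solver
    >B : ∀ {n} → B ℕ.< n → coef h (+ n) K.≈ K.0#
    >B {n} B<n = ≡.subst (λ n → coef h (+ n) K.≈ K.0#)
                   (≡.trans (≡.sym (ℕ.+-suc (n ∸ suc B) B)) (ℕ.m∸n+n≡m B<n)) (coef-h-> (n ∸ suc B))
    ≤B : ∀ n → n ℤ.≤ + B → coef (ζ - h) n K.≈ K.0#
    ≤B n n≤B = K.trans (coef-- ζ h n) (≡.subst (λ n → coef ζ n K.- coef h n K.≈ K.0#) n≡
                 (K.trans (K.+-congˡ (K.-‿cong (coef-h-≤ ℤ.∣ + B ℤ.- n ∣))) (K.-‿inverseʳ _)))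
      where
      solveℤ : ∀ b n → b ℤ.- (b ℤ.- n) ≡ n
      solveℤ = Z.solve 2 (λ b n → b Z.:- (b Z.:- n) Z.:= n) ≡.refl where module Z = +-*-Solver
      n≡ : + B ℤ.- + ℤ.∣ + B ℤ.- n ∣ ≡ n
      n≡ = ≡.trans (≡.cong (ℤ._-_ (+ B)) (ℤ.0≤i⇒+∣i∣≡i (ℤ.i≤j⇒0≤j-i n≤B))) (solveℤ (+ B) n)
    le : ∀ n → n ℤ.< ℤ.- (ℤ.- + N) → coef (ζ - h) n K.≈ K.0#
    le n n< with n ℤ.≤? + B
    ... | yes n≤B = ≤B n n≤B
    ... | no n≰B  = mid n (ℤ.≰⇒> n≰B) (≡.subst (n ℤ.<_) (ℤ.neg-involutive (+ N)) n<)
      where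
      mid : ∀ n → + B ℤ.< n → n ℤ.< + N → coef (ζ - h) n K.≈ K.0#
      mid (+ n) (ℤ.+<+ B<n) (ℤ.+<+ n<N) =
        K.trans (coef-- ζ h (+ n)) (K.trans (K.+-cong (gap n B<n n<N) (K.-‿cong (>B B<n))) 0-0)
    lead-coef : coef (ζ - h) (+ N) K.≈ coef ζ (+ N)
    lead-coef = K.trans (coef-- ζ h (+ N)) (K.trans (K.+-congˡ (K.trans (K.-‿cong (>B B<N)) -0≈0)) (K.+-identityʳ _))

  record Data : Set (c ⊔ ℓ) where
    field
      r a   : ℕ
      a≥1   : 1 ℕ.≤ a
      r≡p^a : r ≡ p ℕ.^ a
      m     : ℕ → ℕ
      m₀≡1  : m 0 ≡ 1
      m≥2   : ∀ j → 1 ℕ.≤ j → 2 ℕ.≤ m j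
      ξ     : Carrier
      α     : ℕ → Carrier
      α-sum : ∀ j → Sum (λ n → T⁻ ((r[ r , m ] j) ℕ.^ suc n)) (α j)
      ξ-sum : Sum α ξ

  module Sequence (xi : Data) where
    open Data xi public

    rⱼ : ℕ → ℕ
    rⱼ = r[ r , m ]_

    M : ℕ → ℕ
    M = ∏≤ m

    r≥2 : 2 ℕ.≤ r
    r≥2 = ≡.subst (2 ℕ.≤_) (≡.sym r≡p^a) (ℕ.≤-trans p≥2 (ℕ.≤-trans (ℕ.≤-reflexive (≡.sym (ℕ.^-identityʳ p)))
            (ℕ.^-monoʳ-≤ p {{prime⇒nonZero p-prime}} a≥1)))

    M≥1 : ∀ j → 1 ℕ.≤ M j
    M≥1 zero    = ℕ.≤-reflexive (≡.sym m₀≡1)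
    M≥1 (suc j) = ℕ.*-mono-≤ (M≥1 j) (ℕ.≤-trans (ℕ.s≤s ℕ.z≤n) (m≥2 (suc j) (ℕ.s≤s ℕ.z≤n)))

    rⱼ≥2 : ∀ j → 2 ℕ.≤ rⱼ j
    rⱼ≥2 j = ℕ.≤-trans r≥2 (ℕ.≤-trans (ℕ.≤-reflexive (≡.sym (ℕ.^-identityʳ r)))
               (ℕ.^-monoʳ-≤ r {{ℕ.>-nonZero (ℕ.<-trans (ℕ.s≤s ℕ.z≤n) r≥2)}} (M≥1 j)))

    rⱼ-power : ∀ j → IsPower (rⱼ j)
    rⱼ-power j = isPower-^ (a , r≡p^a) (M j)

    rⱼ-suc : ∀ j → rⱼ (suc j) ≡ rⱼ j ℕ.^ m (suc j)
    rⱼ-suc j = ≡.sym (ℕ.^-*-assoc r (M j) (m (suc j)))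

    exponent-injective : ∀ i {s t} → s ≡.≢ t → + (rⱼ i ℕ.^ s) ≡.≢ + (rⱼ i ℕ.^ t)
    exponent-injective i {s} {t} s≢t eq = s≢t (^-injectiveʳ (rⱼ≥2 i) s t (ℤ.+-injective eq))

    α-partial : ℕ → ℕ → Carrier
    α-partial i = psum (λ n → T⁻ (rⱼ i ℕ.^ suc n))

    α-partial-≥ : ∀ i n t → n ℕ.≤ t → coef (α-partial i n) (+ (rⱼ i ℕ.^ suc t)) K.≈ K.0#
    α-partial-≥ i zero    t _   = coef-0 _
    α-partial-≥ i (suc n) t n<t = K.trans (coef-+ _ _ _) (K.trans (K.+-cong
      (α-partial-≥ i n t (ℕ.<⇒≤ n<t))
      (coef-T⁻-≢ _ _ (exponent-injective i λ eq → ℕ.<⇒≢ n<t (≡.sym (ℕ.suc-injective eq))))) (K.+-identityˡ _))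

    α-partial-< : ∀ i n t → t ℕ.< n → coef (α-partial i n) (+ (rⱼ i ℕ.^ suc t)) K.≈ K.1#
    α-partial-< i (suc n) t (ℕ.s≤s t≤n) with t ℕ.≟ n
    ... | yes ≡.refl = K.trans (coef-+ _ _ _) (K.trans (K.+-cong (α-partial-≥ i n n ℕ.≤-refl) (coef-T⁻ _)) (K.+-identityˡ _))
    ... | no t≢n     = K.trans (coef-+ _ _ _) (K.trans (K.+-cong (α-partial-< i n t (ℕ.≤∧≢⇒< t≤n t≢n))
                         (coef-T⁻-≢ _ _ (exponent-injective i (t≢n ∘ ℕ.suc-injective)))) (K.+-identityʳ _))

    α-coef : ∀ i t → coef (α i) (+ (rⱼ i ℕ.^ suc t)) K.≈ K.1#
    α-coef i t with sum-coef (α-sum i) (+ (rⱼ i ℕ.^ suc t))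
    ... | N , agree = K.trans (agree (N ℕ.⊔ suc t) (ℕ.m≤m⊔n N (suc t))) (α-partial-< i _ t (ℕ.m≤n⊔m N (suc t)))

    psum-support : ∀ f x → (∀ n → coef (f n) x K.≈ K.0#) → ∀ n → coef (psum f n) x K.≈ K.0#
    psum-support f x z zero    = coef-0 x
    psum-support f x z (suc n) = K.trans (coef-+ _ _ _) (K.trans (K.+-cong (psum-support f x z n) (z n)) (K.+-identityˡ _))

    sum-support : ∀ {f s} x → Sum f s → (∀ n → coef (f n) x K.≈ K.0#) → coef s x K.≈ K.0#
    sum-support {f} x lim z with sum-coef lim x
    ... | N , agree = K.trans (agree N ℕ.≤-refl) (psum-support f x z N)

    α-support : ∀ i x → (∀ t → x ≡.≢ + (rⱼ i ℕ.^ suc t)) → coef (α i) x K.≈ K.0#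
    α-support i x x≢ = sum-support x (α-sum i) λ n → coef-T⁻-≢ _ _ (x≢ n)

    α-le : ∀ i → Le (α i) (+ 0)
    α-le i = mkLe λ x x<0 → α-support i x λ { t ≡.refl → ℤ.≤⇒≯ (ℤ.+≤+ ℕ.z≤n) x<0 }

    ξ-le : Le ξ (+ 0)
    ξ-le = sum-le ξ-sum α-le

    -- Raising to the power `ρ = r_i` maps the exponent `ρ^n` to `ρ^(n+1)`, so `α i ^ ρ` is `α i`
    -- without its first term. In the limit, the errors `S (suc N) - α i` and `(S N - α i) ^ ρ` are
    -- both small.
    α-equation : ∀ i → Φ (rⱼ i) (α i) ≈ - T⁻ (rⱼ i)
    α-equation i = trans (solve 3 (λ a b t → a :- b := (a :+ t :- b) :- t) refl (α i ^ ρ) (α i) (T⁻ ρ))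
                         (trans (+-congʳ (le⇒0 small)) (+-identityˡ _))
      where
      ρ = rⱼ i
      S = α-partial i
      0^ : ∀ n → 1 ℕ.≤ n → 0# ^ n ≈ 0#
      0^ (suc n) _ = zeroˡ _
      step : ∀ n → S n ^ ρ + T⁻ ρ ≈ S (suc n)
      step zero    = +-cong (0^ ρ (isPower≥1 (rⱼ-power i))) (reflexive (≡.cong T⁻ (≡.sym (ℕ.*-identityʳ ρ))))
      step (suc n) = begin
        (S n + T⁻ (ρ ℕ.^ suc n)) ^ ρ + T⁻ ρ        ≈⟨ +-congʳ (power-+ (rⱼ-power i) _ _) ⟩
        (S n ^ ρ + T⁻ (ρ ℕ.^ suc n) ^ ρ) + T⁻ ρ    ≈⟨ solve 3 (λ a b t → (a :+ b) :+ t := (a :+ t) :+ b) refl _ _ _ ⟩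
        (S n ^ ρ + T⁻ ρ) + T⁻ (ρ ℕ.^ suc n) ^ ρ    ≈⟨ +-cong (step n) (T⁻-^ (ρ ℕ.^ suc n) ρ) ⟩
        S (suc n) + T⁻ (ρ ℕ.^ suc (suc n)) ∎
      small : ∀ M → Le (α i ^ ρ + T⁻ ρ - α i) (ℤ.- + M)
      small M with α-sum i M
      ... | N , close = le-cong (begin
          (S (suc N) - α i) - (S N - α i) ^ ρ                   ≈⟨ +-cong (+-congʳ (sym (step N))) (-‿cong (power-- (rⱼ-power i) _ _)) ⟩
          (S N ^ ρ + T⁻ ρ - α i) - (S N ^ ρ - α i ^ ρ)         ≈⟨ solve 4 (λ s t x a → (s :+ t :- x) :- (s :- a) := a :+ t :- x) refl _ _ _ _ ⟩
          α i ^ ρ + T⁻ ρ - α i ∎)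
        (le-- (close (suc N) (ℕ.n≤1+n N))
              (power-le ρ (isPower≥1 (rⱼ-power i)) (close N ℕ.≤-refl)))
        where
        power-le : ∀ {x} n → 1 ℕ.≤ n → Le x (ℤ.- + M) → Le (x ^ n) (ℤ.- + M)
        power-le (suc n) _ = le-^-suc n ℤ.neg-≤-pos

    -- `Φ` for `ρ^(s+1)` is `Φ` for `ρ` plus the `ρ`-th power of `Φ` for `ρ^s`. General `s` is
    -- required because `ξⱼ-rational` applies this to the earlier `α i`, with `r_j` written as a
    -- power of `r_i`.
    α-rational : ∀ i s → Rat (rⱼ i ℕ.^ s) (Φ (rⱼ i ℕ.^ s) (α i))
    α-rational i zero    = rat-cong (solve 1 (λ x → :0 := x :* :1 :- x) refl (α i)) rat-0
    α-rational i (suc s) = rat-cong (begin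
        Φ ρ x + φ ^ ρ                       ≈⟨ solve 3 (λ a x b → (a :- x) :+ b := (b :+ a) :- x) refl _ x _ ⟩
        (φ ^ ρ + x ^ ρ) - x                 ≈⟨ +-congʳ (power-+ (rⱼ-power i) φ x) ⟨
        (φ + x) ^ ρ - x                     ≈⟨ +-congʳ (^-congˡ ρ (solve 2 (λ a x → (a :- x) :+ x := a) refl _ x)) ⟩
        (x ^ (ρ ℕ.^ s)) ^ ρ - x             ≈⟨ +-congʳ (trans (^-assocʳ x (ρ ℕ.^ s) ρ) (^-congʳ x (ℕ.*-comm (ρ ℕ.^ s) ρ))) ⟩
        Φ (ρ ℕ.^ suc s) x ∎)
      (rat-+ (rat-mono ρ≤ (rat-cong (sym (α-equation i)) (rat-neg (rat-T^ ρ))))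
             (rat-^ ρ (α-rational i s)))
      where
      ρ = rⱼ i
      x = α i
      φ = Φ (ρ ℕ.^ s) x
      ρ≤ : ρ ℕ.≤ ρ ℕ.* ρ ℕ.^ s
      ρ≤ = ℕ.≤-trans (ℕ.≤-reflexive (≡.sym (ℕ.*-identityʳ ρ))) (ℕ.*-monoʳ-≤ ρ (isPower≥1 (isPower-^ (rⱼ-power i) s)))

    ξⱼ : ℕ → Carrier
    ξⱼ j = psum α (suc j)

    ξⱼ-rational : ∀ j s → Rat (rⱼ j ℕ.^ s) (Φ (rⱼ j ℕ.^ s) (ξⱼ j))
    ξⱼ-rational zero    s = rat-cong (Φ-cong (rⱼ 0 ℕ.^ s) (sym (+-identityˡ (α 0)))) (α-rational 0 s)
    ξⱼ-rational (suc j) s = rat-cong (sym (Φ-+ (isPower-^ (rⱼ-power (suc j)) s) (ξⱼ j) (α (suc j))))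
      (rat-+ (≡.subst (λ e → Rat e (Φ e (ξⱼ j))) e≡ (ξⱼ-rational j (m (suc j) ℕ.* s))) (α-rational (suc j) s))
      where
      e≡ : rⱼ j ℕ.^ (m (suc j) ℕ.* s) ≡ rⱼ (suc j) ℕ.^ s
      e≡ = ≡.trans (≡.sym (ℕ.^-*-assoc (rⱼ j) (m (suc j)) s)) (≡.cong (ℕ._^ s) (≡.sym (rⱼ-suc j)))

    module Tail (j : ℕ) where
      d R : ℕ
      d = rⱼ j
      R = rⱼ (suc j)

      -- The quotient of `M (s + suc j)` by `M (suc j)`. Thus `r_(j+1+s)` is `R ^ relative s`, and
      -- the exponents in `α′ s` are the `R^k` with `k ≥ 1` divisible by `relative s`.
      relative : ℕ → ℕ
      relative zero    = 1
      relative (suc s) = relative s ℕ.* m (suc (s ℕ.+ suc j))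

      M-relative : ∀ s → M (s ℕ.+ suc j) ≡ M (suc j) ℕ.* relative s
      M-relative zero    = ≡.sym (ℕ.*-identityʳ _)
      M-relative (suc s) = ≡.trans (≡.cong (ℕ._* m (suc (s ℕ.+ suc j))) (M-relative s)) (ℕ.*-assoc (M (suc j)) (relative s) _)

      rⱼ-relative : ∀ s n → rⱼ (s ℕ.+ suc j) ℕ.^ n ≡ R ℕ.^ (relative s ℕ.* n)
      rⱼ-relative s n = ≡.trans (≡.cong (λ e → (r ℕ.^ e) ℕ.^ n) (M-relative s))
        (≡.trans (≡.cong (ℕ._^ n) (≡.sym (ℕ.^-*-assoc r (M (suc j)) (relative s)))) (ℕ.^-*-assoc R (relative s) n))

      relative≥1 : ∀ s → 1 ℕ.≤ relative s
      relative≥1 zero    = ℕ.s≤s ℕ.z≤n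
      relative≥1 (suc s) = ℕ.*-mono-≤ (relative≥1 s) (ℕ.≤-trans (ℕ.s≤s ℕ.z≤n) (m≥2 (suc (s ℕ.+ suc j)) (ℕ.s≤s ℕ.z≤n)))

      relative-∣ : ∀ s i → relative s ∣ relative (i ℕ.+ s)
      relative-∣ s zero    = ∣-refl
      relative-∣ s (suc i) = ∣m⇒∣m*n _ (relative-∣ s i)

      R≥2 : 2 ℕ.≤ R
      R≥2 = rⱼ≥2 (suc j)

      α′ : ℕ → Carrier
      α′ s = α (s ℕ.+ suc j)

      η : Carrier
      η = ξ - ξⱼ j

      η-sum : Sum α′ η
      η-sum = sum-drop (suc j) ξ-sum

      α′-∣ : ∀ s k → relative s ∣ suc k → coef (α′ s) (+ (R ℕ.^ suc k)) K.≈ K.1#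
      α′-∣ s k (divides zero    ())
      α′-∣ s k (divides (suc t) eq) = ≡.subst (λ e → coef (α′ s) (+ e) K.≈ K.1#)
        (≡.trans (rⱼ-relative s (suc t)) (≡.cong (R ℕ.^_) (≡.trans (ℕ.*-comm (relative s) (suc t)) (≡.sym eq))))
        (α-coef (s ℕ.+ suc j) t)

      α′-∤ : ∀ s k → ¬ relative s ∣ suc k → coef (α′ s) (+ (R ℕ.^ suc k)) K.≈ K.0#
      α′-∤ s k ∤k = α-support (s ℕ.+ suc j) _ λ t eq → ∤k (divides (suc t)
        (≡.trans (^-injectiveʳ R≥2 (suc k) (relative s ℕ.* suc t) (≡.trans (ℤ.+-injective eq) (rⱼ-relative s (suc t))))
                 (ℕ.*-comm (relative s) (suc t))))

      α′-support : ∀ s x → (∀ k → x ≡.≢ + (R ℕ.^ suc k)) → coef (α′ s) x K.≈ K.0#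
      α′-support s x x≢ = α-support (s ℕ.+ suc j) x λ t eq → x≢ (ℕ.pred (relative s ℕ.* suc t))
        (≡.trans eq (≡.cong +_ (≡.trans (rⱼ-relative s (suc t)) (≡.cong (R ℕ.^_)
          (≡.sym (ℕ.suc-pred (relative s ℕ.* suc t) {{ℕ.>-nonZero (ℕ.*-mono-≤ (relative≥1 s) (ℕ.s≤s (ℕ.z≤n {t})))}}))))))

      η-support : ∀ x → (∀ k → x ≡.≢ + (R ℕ.^ suc k)) → coef η x K.≈ K.0#
      η-support x x≢ = sum-support x η-sum λ s → α′-support s x x≢

      -- The numbers `relative s` form a divisibility chain: once one of them fails to divide
      -- `k + 1`, all later ones fail. So exactly the first `c` terms contribute, each with
      -- coefficient 1.
      η-coef : ∀ c k → (∀ s → s ℕ.< c → relative s ∣ suc k) → ¬ relative c ∣ suc k →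
               coef η (+ (R ℕ.^ suc k)) K.≈ c ×ᴷ K.1#
      η-coef c k ∣k ∤k with sum-coef η-sum (+ (R ℕ.^ suc k))
      ... | N , agree = K.trans (agree (N ℕ.+ c) (ℕ.m≤m+n N c)) (beyond N)
        where
        upto : ∀ n → n ℕ.≤ c → coef (psum α′ n) (+ (R ℕ.^ suc k)) K.≈ n ×ᴷ K.1#
        upto zero    _   = coef-0 _
        upto (suc n) n<c = K.trans (coef-+ _ _ _) (K.trans (K.+-comm _ _) (K.+-cong (α′-∣ n k (∣k n n<c)) (upto n (ℕ.<⇒≤ n<c))))
        beyond : ∀ i → coef (psum α′ (i ℕ.+ c)) (+ (R ℕ.^ suc k)) K.≈ c ×ᴷ K.1#
        beyond zero    = upto c ℕ.≤-refl
        beyond (suc i) = K.trans (coef-+ _ _ _) (K.trans (K.+-cong (beyond i)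
          (α′-∤ (i ℕ.+ c) k λ ∣k → ∤k (∣-trans (relative-∣ c i) ∣k))) (K.+-identityʳ _))

      η-neg : ∀ n → n ℤ.< + 0 → coef η n K.≈ K.0#
      η-neg n n<0 = η-support n λ { k ≡.refl → ℤ.≤⇒≯ (ℤ.+≤+ ℕ.z≤n) n<0 }

      m₂ : ℕ
      m₂ = m (suc (suc j))

      m₂≥2 : 2 ℕ.≤ m₂
      m₂≥2 = m≥2 (suc (suc j)) (ℕ.s≤s ℕ.z≤n)

      η-coef-1 : ∀ k → ¬ m₂ ∣ suc k → ¬ coef η (+ (R ℕ.^ suc k)) K.≈ K.0#
      η-coef-1 k ∤k z = 1≉0 (K.trans (K.sym (K.+-identityʳ _)) (K.trans (K.sym
        (η-coef 1 k (λ { zero _ → 1∣ _ ; (suc _) (ℕ.s≤s ()) }) (∤k ∘ ≡.subst (_∣ suc k) (ℕ.*-identityˡ m₂)))) z))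

      Good : ℕ → ℕ → Set _
      Good B N = ∃[ h ] Rat B h × Ex (η - h) (ℤ.- + N)

      -- If `m₂` divides `k`, it does not divide `k + 1`, so the very next exponent `R^(k+1)` occurs
      -- with coefficient 1. A gap of ratio `R` suffices for the upper bounds, and the regular
      -- spacing of the admissible `k` controls the growth from one approximation to the next.
      good-multiple : ∀ t → Good (R ℕ.^ (t ℕ.* m₂)) (R ℕ.^ suc (t ℕ.* m₂))
      good-multiple t = truncate η _ _ η-neg gap (ℕ.^-monoʳ-< R R≥2 (ℕ.n<1+n k)) (η-coef-1 k (∤-suc-multiple m₂≥2 t))
        where
        k = t ℕ.* m₂
        gap : ∀ n → R ℕ.^ k ℕ.< n → n ℕ.< R ℕ.^ suc k → coef η (+ n) K.≈ K.0#
        gap n k< <k = η-support (+ n) λ { l ≡.refl → ℕ.<⇒≱ (^-cancelʳ-< (ℕ.<⇒≤ R≥2) k (suc l) k<)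
                                                           (ℕ.≤-pred (^-cancelʳ-< (ℕ.<⇒≤ R≥2) (suc l) (suc k) <k)) }

      -- The coefficient at R^(k+1) is p · 1 = 0, which makes the gap long.
      good-gap : ∀ x → ∃[ k ] x ℕ.≤ k × Good (R ℕ.^ k) (R ℕ.^ suc (suc k))
      good-gap x = k , x≤k , truncate η _ _ η-neg gap (ℕ.^-monoʳ-< R R≥2 (ℕ.≤-trans (ℕ.n<1+n k) (ℕ.n≤1+n (suc k))))
                     (η-coef-1 (suc k) ∤k+2)
        where
        p′ = ℕ.pred p
        p≡ : suc p′ ≡ p
        p≡ = ℕ.suc-pred p {{prime⇒nonZero p-prime}}
        p′≥1 : 1 ℕ.≤ p′
        p′≥1 = ℕ.≤-pred (≡.subst (2 ℕ.≤_) (≡.sym p≡) p≥2)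
        mₚ = m (suc (p′ ℕ.+ suc j))
        mₚ≥2 : 2 ℕ.≤ mₚ
        mₚ≥2 = m≥2 _ (ℕ.s≤s ℕ.z≤n)
        -- Divisible by `relative s` for the `p` values `s ≤ p′`, but not by `relative (suc p′)`,
        -- which is `relative p′` times `mₚ`, since `1 + x mₚ` is not a multiple of `mₚ`. The
        -- parameter `x` makes it large.
        K′ = relative p′ ℕ.* suc (x ℕ.* mₚ)
        k = ℕ.pred K′
        k≡ : suc k ≡ K′
        k≡ = ℕ.suc-pred K′ {{ℕ.>-nonZero (ℕ.*-mono-≤ (relative≥1 p′) (ℕ.s≤s (ℕ.z≤n {x ℕ.* mₚ})))}}
        x≤k : x ℕ.≤ k
        x≤k = ℕ.≤-pred (ℕ.≤-trans (ℕ.s≤s (ℕ.≤-trans (ℕ.≤-reflexive (≡.sym (ℕ.*-identityʳ x))) (ℕ.*-monoʳ-≤ x (ℕ.<⇒≤ mₚ≥2))))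
                (ℕ.≤-trans (ℕ.≤-trans (ℕ.≤-reflexive (≡.sym (ℕ.*-identityˡ _))) (ℕ.*-monoˡ-≤ (suc (x ℕ.* mₚ)) (relative≥1 p′)))
                  (ℕ.≤-reflexive (≡.sym k≡))))
        ∣k : ∀ s → s ℕ.< suc p′ → relative s ∣ suc k
        ∣k s (ℕ.s≤s s≤p′) = ≡.subst (relative s ∣_) (≡.sym k≡) (∣m⇒∣m*n _
          (≡.subst (λ n → relative s ∣ relative n) (ℕ.m∸n+n≡m s≤p′) (relative-∣ s (p′ ∸ s))))
        ∤k : ¬ relative (suc p′) ∣ suc k
        ∤k div = ∤-suc-multiple mₚ≥2 x (*-cancelˡ-∣ (relative p′) {{ℕ.>-nonZero (relative≥1 p′)}}
                   (≡.subst (relative (suc p′) ∣_) k≡ div))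
        middle : coef η (+ (R ℕ.^ suc k)) K.≈ K.0#
        middle = K.trans (η-coef (suc p′) k ∣k ∤k) (≡.subst (λ n → n ×ᴷ K.1# K.≈ K.0#) (≡.sym p≡) char)
        gap : ∀ n → R ℕ.^ k ℕ.< n → n ℕ.< R ℕ.^ suc (suc k) → coef η (+ n) K.≈ K.0#
        gap n k< <k with n ℕ.≟ R ℕ.^ suc k
        ... | yes ≡.refl = middle
        ... | no n≢ = η-support (+ n) λ { l ≡.refl → n≢ (≡.cong (R ℕ.^_) (ℕ.≤-antisym
                        (ℕ.≤-pred (^-cancelʳ-< (ℕ.<⇒≤ R≥2) (suc l) (suc (suc k)) <k))
                        (^-cancelʳ-< (ℕ.<⇒≤ R≥2) k (suc l) k<))) }
        -- As `p ≥ 2`, the index `s = 1` is among the contributing ones. So `m₂` divides `k + 1` and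
        -- cannot divide `k + 2`.
        m₂∣k+1 : m₂ ∣ suc k
        m₂∣k+1 = ∣-trans (≡.subst (m₂ ∣_) (≡.sym (ℕ.*-identityˡ m₂)) ∣-refl) (∣k 1 (ℕ.s≤s p′≥1))
        ∤k+2 : ¬ m₂ ∣ suc (suc k)
        ∤k+2 div = ℕ.<⇒≢ m₂≥2 (≡.sym (∣1⇒≡1 (∣m+n∣m⇒∣n (≡.subst (m₂ ∣_) (ℕ.+-comm 1 (suc k)) div) m₂∣k+1)))

      record Approximant (B N : ℕ) : Set (c ⊔ ℓ) where
        field
          β        : Carrier
          distance : Ex (ξ - β) (ℤ.- + N)
          rational : Rat (d ℕ.* B) (Φ d β)
          closeΦ   : Ex (Φ d ξ - Φ d β) (ℤ.- + N)
          Φ-le     : Le (Φ d β) (+ 0)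

      -- For `δ = ξ − β` of absolute value below 1, `δ^d` is negligible against `δ` because `d ≥ 2`;
      -- by additivity `Φ d` therefore preserves the distance. The denominator exponent `d B` comes
      -- from `h^d`, where `h` is the truncated tail.
      approximant : ∀ {B N} → 1 ℕ.≤ B → 1 ℕ.≤ N → Good B N → Approximant B N
      approximant {B} {N} B≥1 N≥1 (h , rat-h , close) = record
        { β = β
        ; distance = distance
        ; rational = rat-cong (sym (Φ-+ d-power (ξⱼ j) h))
            (rat-+ (rat-mono d≤dB (≡.subst (λ e → Rat e (Φ e (ξⱼ j))) (ℕ.*-identityʳ d) (ξⱼ-rational j 1)))
                   (rat-+ (rat-^ d rat-h) (rat-neg (rat-mono B≤dB rat-h))))
        ; closeΦ = ex-cong (Φ-- d-power ξ β)
            (ex-cong (+-comm _ _) (ex-+ (ex-neg distance) (power-small d (rⱼ≥2 j)) 2N<N))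
        ; Φ-le = le-- (le-^ d β≤0) β≤0
        }
        where
        d-power = rⱼ-power j
        β = ξⱼ j + h
        distance : Ex (ξ - β) (ℤ.- + N)
        distance = ex-cong (solve 3 (λ x y h → (x :- y) :- h := x :- (y :+ h)) refl ξ (ξⱼ j) h) close
        β≤0 : Le β (+ 0)
        β≤0 = le-cong (solve 2 (λ x b → x :- (x :- b) := b) refl ξ β) (le-- ξ-le (le-mono ℤ.neg-≤-pos (proj₁ distance)))
        d≤dB : d ℕ.≤ d ℕ.* B
        d≤dB = ℕ.≤-trans (ℕ.≤-reflexive (≡.sym (ℕ.*-identityʳ d))) (ℕ.*-monoʳ-≤ d B≥1)
        B≤dB : B ℕ.≤ d ℕ.* B
        B≤dB = ℕ.≤-trans (ℕ.≤-reflexive (≡.sym (ℕ.*-identityˡ B))) (ℕ.*-monoˡ-≤ B (ℕ.<⇒≤ (rⱼ≥2 j)))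
        2N<N : ℤ.- + N ℤ.+ ℤ.- + N ℤ.< ℤ.- + N
        2N<N = ≡.subst (ℤ._< ℤ.- + N) (ℤ.neg-distrib-+ (+ N) (+ N)) (ℤ.neg-mono-< (ℤ.+<+ (ℕ.m<m+n N N≥1)))
        power-small : ∀ n → 2 ℕ.≤ n → Le ((ξ - β) ^ n) (ℤ.- + N ℤ.+ ℤ.- + N)
        power-small (suc (suc n)) _ = le-* (proj₁ distance) (le-^-suc n ℤ.neg-≤-pos (proj₁ distance))
        power-small (suc zero) (ℕ.s≤s ())

-- Fraction-free elimination with degree bounds

-- This is `2^m − 1`: clearing one column doubles the degrees of the entries, and undoing the step
-- multiplies the weights by one further entry of degree `H`.
growth : ℕ → ℕ
growth zero    = 0
growth (suc m) = growth m ℕ.* 2 ℕ.+ 1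

growth-suc : ∀ m H → growth m ℕ.* (H ℕ.+ H) ℕ.+ H ≡ growth (suc m) ℕ.* H
growth-suc m H = solve 2 (λ g h → g :* (h :+ h) :+ h := (g :* con 2 :+ con 1) :* h) ≡.refl (growth m) H
  where open ℕ-Solver

record Filtration {a ℓ} (A : CommutativeRing a ℓ) ℓ₂ : Set (a ⊔ ℓ ⊔ lsuc ℓ₂) where
  open CommutativeRing A
  field
    D      : Carrier → ℕ → Set ℓ₂
    D-0    : ∀ {H} → D 0# H
    D-1    : D 1# 0
    D-neg  : ∀ {x H} → D x H → D (- x) H
    D-+    : ∀ {x y H} → D x H → D y H → D (x + y) H
    D-*    : ∀ {x y G H} → D x G → D y H → D (x * y) (G ℕ.+ H)
    D-mono : ∀ {x G H} → G ℕ.≤ H → D x G → D x H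

module Elimination {a ℓ ℓ₂} (A : CommutativeRing a ℓ) (1≉0 : Nontrivial A) (zero? : DecidableZero A) (domain : IsDomain A)
    (filtration : Filtration A ℓ₂) where
  open CommutativeRing A hiding (zero)
  open Filtration filtration
  open CommutativeMonoidSum +-commutativeMonoid using (sum; sum-cong-≋; sum-remove; sum-replicate-zero; ∑-distrib-+)
  open SemiringSum semiring using (*-distribʳ-sum)
  open Solver A
  open SetoidReasoning setoid

  D-sum : ∀ {n H} (f : Fin n → Carrier) → (∀ i → D (f i) H) → D (sum f) H
  D-sum {zero}  f Df = D-0
  D-sum {suc n} f Df = D-+ (Df Fin.zero) (D-sum (f ∘ Fin.suc) (Df ∘ Fin.suc))

  sum-zero : ∀ {n} (f : Fin n → Carrier) → (∀ i → f i ≈ 0#) → sum f ≈ 0#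
  sum-zero {n} f z = trans (sum-cong-≋ z) (sum-replicate-zero n)

  record Relation (m : ℕ) (v : Fin (suc m) → ℕ → Carrier) (H : ℕ) : Set (a ⊔ ℓ ⊔ ℓ₂) where
    field
      weight     : Fin (suc m) → Carrier
      nontrivial : ∃[ l ] ¬ weight l ≈ 0#
      bounded    : ∀ l → D (weight l) H
      vanishing  : ∀ i → i ℕ.< m → sum (λ l → weight l * v l i) ≈ 0#

  -- Fraction-free Gaussian elimination.
  relation : ∀ m H (v : Fin (suc m) → ℕ → Carrier) → (∀ l i → D (v l i) H) → Relation m v (growth m ℕ.* H)
  relation zero    H v Dv = record
    { weight = λ _ → 1# ; nontrivial = Fin.zero , 1≉0 ; bounded = λ _ → D-1 ; vanishing = λ _ () }
  relation (suc m) H v Dv with Fin.any? (λ l → ¬? (zero? (v l m)))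
  -- The last column imposes no condition, so the first vector may be dropped and the remaining ones
  -- related on the other `m` columns.
  ... | no all-zero = record
    { weight = c′ ; nontrivial = Fin.suc (proj₁ rec.nontrivial) , proj₂ rec.nontrivial ; bounded = D-c′ ; vanishing = vanishing }
    where
    v·m≈0 : ∀ l → v l m ≈ 0#
    v·m≈0 l = decidable-stable (zero? _) λ ≉ → all-zero (l , ≉)
    module rec = Relation (relation m H (v ∘ Fin.suc) (Dv ∘ Fin.suc))
    c₀ = rec.weight
    c′ : Fin (suc (suc m)) → Carrier
    c′ Fin.zero    = 0#
    c′ (Fin.suc l) = c₀ l
    D-c′ : ∀ l → D (c′ l) (growth (suc m) ℕ.* H)
    D-c′ Fin.zero    = D-0
    D-c′ (Fin.suc l) = D-mono (ℕ.*-monoˡ-≤ H (ℕ.≤-trans (ℕ.m≤m*n (growth m) 2) (ℕ.m≤m+n _ 1))) (rec.bounded l)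
    vanishing : ∀ i → i ℕ.< suc m → sum (λ l → c′ l * v l i) ≈ 0#
    vanishing i (ℕ.s≤s i≤m) with i ℕ.≟ m
    ... | yes ≡.refl = sum-zero (λ l → c′ l * v l m) λ l → trans (*-congˡ (v·m≈0 l)) (zeroʳ _)
    ... | no i≢m     = trans (+-cong (zeroˡ _) (rec.vanishing i (ℕ.≤∧≢⇒< i≤m i≢m))) (+-identityˡ _)
  ... | yes (l₀ , b≉) = record
    { weight = c ; nontrivial = punchIn l₀ l , c≉ ∘ trans (sym (c-in l)) ; bounded = D-c
    ; vanishing = λ i i<m → trans (combine i) (vanishing i i<m) }
    where
    b = v l₀ m
    u = λ l → v (punchIn l₀ l) m
    w : Fin (suc m) → ℕ → Carrier
    -- Cross-multiplication with the pivot clears column `m` without division; both products have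
    -- degree at most `H + H`.
    w l i = b * v (punchIn l₀ l) i - u l * v l₀ i
    module rec = Relation (relation m (H ℕ.+ H) w λ l i → D-+ (D-* (Dv l₀ m) (Dv _ i)) (D-neg (D-* (Dv _ m) (Dv l₀ i))))
    c₀ = rec.weight
    l = proj₁ rec.nontrivial
    -- This weight collects the multiples of the pivot vector that were subtracted in `w`.
    pivot = sum (λ l → - (c₀ l * u l))
    c = insertAt (λ l → b * c₀ l) l₀ pivot
    c-in : ∀ l → c (punchIn l₀ l) ≈ b * c₀ l
    c-in l = reflexive (insertAt-punchIn (λ l → b * c₀ l) l₀ pivot l)
    c-pivot : c l₀ ≈ pivot
    c-pivot = reflexive (insertAt-lookup (λ l → b * c₀ l) l₀ pivot)
    c≉ : ¬ b * c₀ l ≈ 0#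
    c≉ z = [ b≉ , proj₂ rec.nontrivial ]′ (domain z)
    bound = growth-suc m H
    D-c : ∀ l → D (c l) (growth (suc m) ℕ.* H)
    D-c = insertAt-All {P = λ x → D x (growth (suc m) ℕ.* H)} (λ l → b * c₀ l) l₀ pivot
            (λ l → ≡.subst (D _) (≡.trans (ℕ.+-comm H _) bound) (D-* (Dv l₀ m) (rec.bounded l)))
            (D-sum _ λ l → ≡.subst (D _) bound (D-neg (D-* (rec.bounded l) (Dv (punchIn l₀ l) m))))
      where
      insertAt-All : ∀ {n} {P : Carrier → Set ℓ₂} (xs : Fin n → Carrier) i x → (∀ l → P (xs l)) → P x → ∀ l → P (insertAt xs i x l)
      insertAt-All {n}     xs Fin.zero    x Pxs Px Fin.zero    = Px
      insertAt-All {n}     xs Fin.zero    x Pxs Px (Fin.suc l) = Pxs l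
      insertAt-All {suc n} xs (Fin.suc i) x Pxs Px Fin.zero    = Pxs Fin.zero
      insertAt-All {suc n} {P} xs (Fin.suc i) x Pxs Px (Fin.suc l) = insertAt-All {P = P} (xs ∘ Fin.suc) i x (Pxs ∘ Fin.suc) Px l
    combine : ∀ i → sum (λ l → c l * v l i) ≈ sum (λ l → c₀ l * w l i)
    combine i = begin
      sum (λ l → c l * v l i)
        ≈⟨ sum-remove {i = l₀} (λ l → c l * v l i) ⟩
      c l₀ * v l₀ i + sum (λ l → c (punchIn l₀ l) * v (punchIn l₀ l) i)
        ≈⟨ +-cong (*-congʳ c-pivot) (sum-cong-≋ λ l → *-congʳ {v (punchIn l₀ l) i} (c-in l)) ⟩
      pivot * v l₀ i + sum (λ l → (b * c₀ l) * v (punchIn l₀ l) i)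
        ≈⟨ +-congʳ (*-distribʳ-sum (v l₀ i) (λ l → - (c₀ l * u l))) ⟩
      sum (λ l → - (c₀ l * u l) * v l₀ i) + sum (λ l → (b * c₀ l) * v (punchIn l₀ l) i)
        ≈⟨ ∑-distrib-+ (λ l → - (c₀ l * u l) * v l₀ i) (λ l → (b * c₀ l) * v (punchIn l₀ l) i) ⟨
      sum (λ l → - (c₀ l * u l) * v l₀ i + (b * c₀ l) * v (punchIn l₀ l) i)
        ≈⟨ sum-cong-≋ (λ l → solve 5 (λ c u z b x → :- (c :* u) :* z :+ (b :* c) :* x := c :* (b :* x :- u :* z))
             refl (c₀ l) (u l) (v l₀ i) b (v (punchIn l₀ l) i)) ⟩
      sum (λ l → c₀ l * w l i) ∎
    vanishing : ∀ i → i ℕ.< suc m → sum (λ l → c₀ l * w l i) ≈ 0#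
    vanishing i (ℕ.s≤s i≤m) with i ℕ.≟ m
    ... | yes ≡.refl = sum-zero (λ l → c₀ l * w l m) λ l →
            solve 3 (λ c b u → c :* (b :* u :- u :* b) := :0) refl (c₀ l) b (u l)
    ... | no i≢m     = rec.vanishing i (ℕ.≤∧≢⇒< i≤m i≢m)

-- Lower bounds for polynomials at ξ

-- Matches the sparse scale of truncations to a given height; overshooting by at most the factor `b`
-- keeps the final bound linear in the height.
power-between : ∀ {b} → 2 ℕ.≤ b → ∀ x → ∃[ t ] x ℕ.< b ℕ.^ t × b ℕ.^ t ℕ.≤ b ℕ.* suc x
power-between {b} b≥2 zero = 0 , ℕ.s≤s ℕ.z≤n , ℕ.≤-trans (ℕ.<⇒≤ b≥2) (ℕ.≤-reflexive (≡.sym (ℕ.*-identityʳ b)))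
power-between {b} b≥2 (suc x) with power-between b≥2 x
... | t , x< , ≤x with suc x ℕ.<? b ℕ.^ t
... | yes x+1< = t , x+1< , ℕ.≤-trans ≤x (ℕ.*-monoʳ-≤ b (ℕ.n≤1+n (suc x)))
... | no x+1≮ = suc t , big , ℕ.≤-trans (ℕ.*-monoʳ-≤ b (ℕ.≮⇒≥ x+1≮)) (ℕ.*-monoʳ-≤ b (ℕ.n≤1+n (suc x)))
  where
  big : suc x ℕ.< b ℕ.* b ℕ.^ t
  big = ℕ.<-≤-trans (ℕ.s≤s (ℕ.m≤m+n (suc x) x)) (ℕ.≤-trans (ℕ.≤-reflexive (lemma x))
          (ℕ.*-mono-≤ b≥2 x<))
    where
    lemma : ∀ x → suc (suc x ℕ.+ x) ≡ 2 ℕ.* suc x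
    lemma = solve 1 (λ x → con 1 :+ ((con 1 :+ x) :+ x) := con 2 :* (con 1 :+ x)) ≡.refl
      where open ℕ-Solver

separation-bound : ∀ {h n d B R} → h ℕ.< B → n ℕ.< d → d ℕ.* d ℕ.≤ R → h ℕ.+ suc (n ℕ.* (d ℕ.* B)) ℕ.≤ R ℕ.* B
separation-bound {h} {n} {d} {B} {R} h<B n<d d²≤R = begin
  h ℕ.+ suc (n ℕ.* (d ℕ.* B))    ≡⟨ ℕ.+-suc h _ ⟩
  suc h ℕ.+ n ℕ.* (d ℕ.* B)      ≤⟨ ℕ.+-monoˡ-≤ _ h<B ⟩
  B ℕ.+ n ℕ.* (d ℕ.* B)          ≡⟨ ≡.cong (ℕ._+ n ℕ.* (d ℕ.* B)) (ℕ.*-identityˡ B) ⟨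
  1 ℕ.* B ℕ.+ n ℕ.* (d ℕ.* B)    ≤⟨ ℕ.+-monoˡ-≤ _ (ℕ.*-monoˡ-≤ B (ℕ.≤-trans (ℕ.s≤s ℕ.z≤n) n<d)) ⟩
  suc n ℕ.* (d ℕ.* B)            ≤⟨ ℕ.*-monoˡ-≤ (d ℕ.* B) n<d ⟩
  d ℕ.* (d ℕ.* B)                ≡⟨ ℕ.*-assoc d d B ⟨
  (d ℕ.* d) ℕ.* B                ≤⟨ ℕ.*-monoˡ-≤ B d²≤R ⟩
  R ℕ.* B ∎
  where open ℕ.≤-Reasoning

-- Origin of the constant `C` in `liouville-bound`: with `B` at most `c (h + 1)` and `h` linear in
-- `H`, the smallness of `P(ξ)` that pushes `N(ξ^d − ξ)` below the denominators is linear in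
-- `H + 1`.
transform-bound : ∀ n d c g H {h B} → h ≡ g ℕ.* H → B ℕ.≤ c ℕ.* suc h →
                  h ℕ.+ suc (n ℕ.* (d ℕ.* B)) ℕ.≤ suc (n ℕ.* (d ℕ.* c)) ℕ.* suc g ℕ.* suc H
transform-bound n d c g H {h} {B} h≡ B≤ = begin
  h ℕ.+ suc (n ℕ.* (d ℕ.* B))                  ≡⟨ ℕ.+-suc h _ ⟩
  suc h ℕ.+ n ℕ.* (d ℕ.* B)                    ≤⟨ ℕ.+-monoʳ-≤ (suc h) (ℕ.*-monoʳ-≤ n (ℕ.*-monoʳ-≤ d B≤)) ⟩
  suc h ℕ.+ n ℕ.* (d ℕ.* (c ℕ.* suc h))        ≡⟨ lemma n d c (suc h) ⟩
  suc Z ℕ.* suc h                              ≡⟨ ≡.cong (λ h → suc Z ℕ.* suc h) h≡ ⟩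
  suc Z ℕ.* suc (g ℕ.* H)                      ≤⟨ ℕ.*-monoʳ-≤ (suc Z) (ℕ.m≤m+n (suc (g ℕ.* H)) (g ℕ.+ H)) ⟩
  suc Z ℕ.* (suc (g ℕ.* H) ℕ.+ (g ℕ.+ H))      ≡⟨ lemma′ Z g H ⟩
  suc Z ℕ.* suc g ℕ.* suc H ∎
  where
  open ℕ.≤-Reasoning
  Z = n ℕ.* (d ℕ.* c)
  lemma : ∀ n d c h → h ℕ.+ n ℕ.* (d ℕ.* (c ℕ.* h)) ≡ suc (n ℕ.* (d ℕ.* c)) ℕ.* h
  lemma = solve 4 (λ n d c h → h :+ n :* (d :* (c :* h)) := (con 1 :+ n :* (d :* c)) :* h) ≡.refl
    where open ℕ-Solver
  lemma′ : ∀ z g h → suc z ℕ.* (suc (g ℕ.* h) ℕ.+ (g ℕ.+ h)) ≡ suc z ℕ.* suc g ℕ.* suc h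
  lemma′ = solve 3 (λ z g h → (con 1 :+ z) :* ((con 1 :+ g :* h) :+ (g :+ h)) := (con 1 :+ z) :* (con 1 :+ g) :* (con 1 :+ h)) ≡.refl
    where open ℕ-Solver

module Liouville {c ℓ} (K : CommutativeRing c ℓ) (F : LaurentField K) (p : ℕ) (p-prime : Prime p)
    (char : Characteristic K p) where
  open LaurentField F
  open L hiding (zero)
  open Valuation K F
  open Approximation K F p p-prime char
  open Polynomial A.rawRing
  open Series A using (coeff-+; coeff-*; coeff-map)
  open Convolution A using (conv-closed; monomial; coeff-monomial-≢; coeff-conv-bound)
  open Evaluation A L emb emb-hom
  private module emb = IsRingHomomorphism emb-hom
  open SemiringExp semiring using (_^_; ^-congˡ)
  open CommutativeMonoidSum +-commutativeMonoid using (sum; sum-cong-≋)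
  open SemiringSum semiring using (*-distribˡ-sum; *-distribʳ-sum)
  module ΣA = CommutativeMonoidSum A.+-commutativeMonoid
  open Solver L
  open SetoidReasoning setoid

  D : A.Carrier → ℕ → Set _
  D a H = Le (emb a) (+ H)

  D-0 : ∀ {H} → D A.0# H
  D-0 = le-cong (sym emb.0#-homo) le-0

  D-1 : D A.1# 0
  D-1 = le-cong (sym emb.1#-homo) (proj₁ ex-1)

  D-neg : ∀ {a H} → D a H → D (A.- a) H
  D-neg Da = le-cong (sym (emb.-‿homo _)) (le-neg Da)

  D-+ : ∀ {a b H} → D a H → D b H → D (a A.+ b) H
  D-+ Da Db = le-cong (sym (emb.+-homo _ _)) (le-+ Da Db)

  D-* : ∀ {a b G H} → D a G → D b H → D (a A.* b) (G ℕ.+ H)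
  D-* Da Db = le-cong (sym (emb.*-homo _ _)) (le-* Da Db)

  D-cong : ∀ {a b H} → a A.≈ b → D a H → D b H
  D-cong e = le-cong (emb.⟦⟧-cong e)

  D-mono : ∀ {a G H} → G ℕ.≤ H → D a G → D a H
  D-mono G≤H = le-mono (ℤ.+≤+ G≤H)

  A-1≉0 : ¬ A.1# A.≈ A.0#
  A-1≉0 e = ex⇒≉0 ex-1 (trans (sym emb.1#-homo) (trans (emb.⟦⟧-cong e) emb.0#-homo))

  degreeFiltration : Filtration A ℓ
  degreeFiltration = record { D = D ; D-0 = D-0 ; D-1 = D-1 ; D-neg = D-neg ; D-+ = D-+ ; D-* = D-* ; D-mono = D-mono }

  open Elimination A A-1≉0 A-zero? A-domain degreeFiltration using (Relation; relation; sum-zero)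

  ConstantCoeffs : Poly → Set _
  ConstantCoeffs P = ∀ i → D (coeff P i) 0

  constant-* : ∀ P Q → ConstantCoeffs P → ConstantCoeffs Q → ConstantCoeffs (P *ₚ Q)
  constant-* P Q cP cQ n = D-cong (A.sym (coeff-* P Q n))
    (conv-closed (λ a → D a 0) D-cong D-+ D-0 (coeff P) (coeff Q) n λ i j _ → D-* (cP i) (cQ j))

  power : Poly → ℕ → Poly
  power P zero    = A.1# ∷ []
  power P (suc i) = P *ₚ power P i

  ev-power : ∀ P i x → ev (power P i) x ≈ ev P x ^ i
  ev-power P zero    x = trans (ev-const A.1# x) emb.1#-homo
  ev-power P (suc i) x = trans (ev-* P (power P i) x) (*-congˡ (ev-power P i x))

  one-constant : ConstantCoeffs (A.1# ∷ [])
  one-constant zero    = D-1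
  one-constant (suc i) = D-0

  power-constant : ∀ P i → ConstantCoeffs P → ConstantCoeffs (power P i)
  power-constant P zero    cP = one-constant
  power-constant P (suc i) cP = constant-* P (power P i) cP (power-constant P i cP)

  power-degree : ∀ P d i → DegreeAtMost d P → DegreeAtMost (i ℕ.* d) (power P i)
  power-degree P d zero    deg (suc i) _ = A.refl
  power-degree P d (suc i) deg = coeff-conv-bound P (power P i) deg (power-degree P d i deg)

  artinSchreier : ℕ → Poly
  artinSchreier d = monomial A.1# d +ₚ monomial (A.- A.1#) 1

  ev-artinSchreier : ∀ d x → ev (artinSchreier d) x ≈ Φ d x
  ev-artinSchreier d x = begin
    ev (artinSchreier d) x                            ≈⟨ ev-+ (monomial A.1# d) _ x ⟩
    ev (monomial A.1# d) x + ev (monomial (A.- A.1#) 1) x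
      ≈⟨ +-cong (trans (ev-monomial A.1# d x) (*-congʳ emb.1#-homo))
                (trans (ev-monomial (A.- A.1#) 1 x) (*-congʳ (trans (emb.-‿homo A.1#) (-‿cong emb.1#-homo)))) ⟩
    1# * x ^ d + - 1# * (x * 1#)  ≈⟨ solve 2 (λ y x → :1 :* y :+ :- :1 :* (x :* :1) := y :- x) refl (x ^ d) x ⟩
    x ^ d - x ∎

  artinSchreier-degree : ∀ d → 1 ℕ.≤ d → DegreeAtMost d (artinSchreier d)
  artinSchreier-degree d d≥1 i d<i = A.trans (coeff-+ (monomial A.1# d) _ i)
    (A.trans (A.+-cong (coeff-monomial-≢ A.1# d i (ℕ.<⇒≢ d<i)) (coeff-monomial-≢ _ 1 i (ℕ.<⇒≢ (ℕ.≤-<-trans d≥1 d<i)))) (A.+-identityˡ _))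

  monomial-constant : ∀ a i → D a 0 → ConstantCoeffs (monomial a i)
  monomial-constant a zero    Da zero    = Da
  monomial-constant a zero    Da (suc j) = D-0
  monomial-constant a (suc i) Da zero    = D-0
  monomial-constant a (suc i) Da (suc j) = monomial-constant a i Da j

  artinSchreier-constant : ∀ d → ConstantCoeffs (artinSchreier d)
  artinSchreier-constant d i = D-cong (A.sym (coeff-+ (monomial A.1# d) _ i))
    (D-+ (monomial-constant A.1# d D-1 i) (monomial-constant (A.- A.1#) 1 (D-neg D-1) i))

  shift : ℕ → Poly → Poly
  shift zero    P = P
  shift (suc j) P = A.0# ∷ shift j P

  ev-shifts : ∀ j P x → ev (shift j P) x ≈ x ^ j * ev P x
  ev-shifts zero    P x = sym (*-identityˡ _)
  ev-shifts (suc j) P x = trans (ev-shift (shift j P) x) (trans (*-congˡ (ev-shifts j P x)) (sym (*-assoc _ _ _)))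

  coeff-shift : ∀ j P i → coeff (shift j P) (j ℕ.+ i) ≡ coeff P i
  coeff-shift zero    P i = ≡.refl
  coeff-shift (suc j) P i = coeff-shift j P i

  coeff-shift-< : ∀ j P i → i ℕ.< j → coeff (shift j P) i A.≈ A.0#
  coeff-shift-< (suc j) P zero    _           = A.refl
  coeff-shift-< (suc j) P (suc i) (ℕ.s≤s i<j) = coeff-shift-< j P i i<j

  coeff-shift-≥ : ∀ j P i → j ℕ.≤ i → coeff (shift j P) i ≡ coeff P (i ∸ j)
  coeff-shift-≥ zero    P i       _           = ≡.refl
  coeff-shift-≥ (suc j) P (suc i) (ℕ.s≤s j≤i) = coeff-shift-≥ j P i j≤i

  shift-bounded : ∀ {H} j P → (∀ i → D (coeff P i) H) → ∀ i → D (coeff (shift j P) i) H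
  shift-bounded zero    P DP i       = DP i
  shift-bounded (suc j) P DP zero    = D-0
  shift-bounded (suc j) P DP (suc i) = shift-bounded j P DP i

  lincomb : ∀ {s} → (Fin s → A.Carrier) → (Fin s → Poly) → Poly
  lincomb {zero}  c V = []
  lincomb {suc s} c V = map (c Fin.zero A.*_) (V Fin.zero) +ₚ lincomb (c ∘ Fin.suc) (V ∘ Fin.suc)

  coeff-lincomb : ∀ {s} (c : Fin s → A.Carrier) V i → coeff (lincomb c V) i A.≈ ΣA.sum (λ l → c l A.* coeff (V l) i)
  coeff-lincomb {zero}  c V i = A.refl
  coeff-lincomb {suc s} c V i = A.trans (coeff-+ (map (c Fin.zero A.*_) (V Fin.zero)) _ i)
    (A.+-cong (coeff-map (c Fin.zero A.*_) (A.zeroʳ _) (V Fin.zero) i) (coeff-lincomb (c ∘ Fin.suc) (V ∘ Fin.suc) i))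

  ev-lincomb : ∀ {s} (c : Fin s → A.Carrier) V x → ev (lincomb c V) x ≈ sum (λ l → emb (c l) * ev (V l) x)
  ev-lincomb {zero}  c V x = refl
  ev-lincomb {suc s} c V x = trans (ev-+ (map (c Fin.zero A.*_) (V Fin.zero)) _ x)
    (+-cong (ev-scale (c Fin.zero) (V Fin.zero) x) (ev-lincomb (c ∘ Fin.suc) (V ∘ Fin.suc) x))

  sum-split : ∀ a {b} (f : Fin (a ℕ.+ b) → Carrier) → sum f ≈ sum (λ i → f (i ↑ˡ b)) + sum (λ j → f (a ↑ʳ j))
  sum-split zero    f = sym (+-identityˡ _)
  sum-split (suc a) f = trans (+-congˡ (sum-split a (f ∘ Fin.suc))) (sym (+-assoc _ _ _))

  ev-tabulate : ∀ {s} (c : Fin s → A.Carrier) x → ev (tabulate c) x ≈ sum (λ i → emb (c i) * x ^ toℕ i)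
  ev-tabulate {zero}  c x = refl
  ev-tabulate {suc s} c x = +-cong (sym (*-identityʳ _)) (begin
    x * ev (tabulate (c ∘ Fin.suc)) x                          ≈⟨ *-congˡ (ev-tabulate (c ∘ Fin.suc) x) ⟩
    x * sum (λ i → emb (c (Fin.suc i)) * x ^ toℕ i)            ≈⟨ *-distribˡ-sum x (λ i → emb (c (Fin.suc i)) * x ^ toℕ i) ⟩
    sum (λ i → x * (emb (c (Fin.suc i)) * x ^ toℕ i))
      ≈⟨ sum-cong-≋ (λ i → solve 3 (λ x a y → x :* (a :* y) := a :* (x :* y)) refl x (emb (c (Fin.suc i))) (x ^ toℕ i)) ⟩
    sum (λ i → emb (c (Fin.suc i)) * (x * x ^ toℕ i)) ∎)

  first-nonzero : ∀ {s} (c : Fin s → A.Carrier) → (∀ i → c i A.≈ A.0#) ⊎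
                  (∃[ i ] ¬ c i A.≈ A.0# × (∀ j → toℕ j ℕ.< toℕ i → c j A.≈ A.0#))
  first-nonzero {zero}  c = inj₁ λ ()
  first-nonzero {suc s} c with A-zero? (c Fin.zero)
  ... | no ≉  = inj₂ (Fin.zero , ≉ , λ _ ())
  ... | yes z with first-nonzero (c ∘ Fin.suc)
  ...   | inj₁ zs = inj₁ λ { Fin.zero → z ; (Fin.suc i) → zs i }
  ...   | inj₂ (i , ≉ , below) = inj₂ (Fin.suc i , ≉ , λ { Fin.zero _ → z ; (Fin.suc j) (ℕ.s≤s j<i) → below j j<i })

  first-nonzero-coeff : ∀ P → (∀ i → coeff P i A.≈ A.0#) ⊎
                        (∃[ i ] ¬ coeff P i A.≈ A.0# × (∀ j → j ℕ.< i → coeff P j A.≈ A.0#))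
  first-nonzero-coeff []      = inj₁ λ _ → A.refl
  first-nonzero-coeff (a ∷ P) with A-zero? a
  ... | no ≉  = inj₂ (0 , ≉ , λ _ ())
  ... | yes z with first-nonzero-coeff P
  ...   | inj₁ zs = inj₁ λ { zero → z ; (suc i) → zs i }
  ...   | inj₂ (i , ≉ , below) = inj₂ (suc i , ≉ , λ { zero _ → z ; (suc j) (ℕ.s≤s j<i) → below j j<i })

  -- Absence of zero divisors for the product `c(X) P(X)`, by comparing lowest terms: at the sum of
  -- the two lowest indices a single product survives.
  shifts-independent : ∀ {s} (c : Fin s → A.Carrier) P → ¬ (∀ i → coeff P i A.≈ A.0#) →
                       (∀ i → ΣA.sum (λ l → c l A.* coeff (shift (toℕ l) P) i) A.≈ A.0#) → ∀ l → c l A.≈ A.0#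
  shifts-independent {zero}  c P P≉0 rel ()
  shifts-independent {suc s} c P P≉0 rel with first-nonzero c | first-nonzero-coeff P
  ... | inj₁ zs | _ = zs
  ... | inj₂ _  | inj₁ P≈0 = ⊥-elim (P≉0 P≈0)
  ... | inj₂ (l₀ , c≉ , c-below) | inj₂ (i₀ , P≉ , P-below) = ⊥-elim ([ c≉ , P≉ ]′ (A-domain leading))
    where
    i = toℕ l₀ ℕ.+ i₀
    t : Fin (suc s) → A.Carrier
    t l = c l A.* coeff (shift (toℕ l) P) i
    other : ∀ l → l ≡.≢ l₀ → t l A.≈ A.0#
    other l l≢ with toℕ l ℕ.<? toℕ l₀ | toℕ l ℕ.≤? i
    ... | yes l<l₀ | _        = A.trans (A.*-congʳ (c-below l l<l₀)) (A.zeroˡ _)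
    ... | no _     | no l≰i   = A.trans (A.*-congˡ (coeff-shift-< (toℕ l) P i (ℕ.≰⇒> l≰i))) (A.zeroʳ _)
    ... | no l≮l₀  | yes l≤i  = A.trans (A.*-congˡ (A.trans (A.reflexive (coeff-shift-≥ (toℕ l) P i l≤i))
                                  (P-below _ (≡.subst (i ∸ toℕ l ℕ.<_) (ℕ.m+n∸m≡n (toℕ l₀) i₀)
                                    (ℕ.∸-monoʳ-< (ℕ.≤∧≢⇒< (ℕ.≮⇒≥ l≮l₀) (λ eq → l≢ (Fin.toℕ-injective (≡.sym eq)))) l≤i)))))
                                  (A.zeroʳ _)
    leading : c l₀ A.* coeff P i₀ A.≈ A.0#
    leading = A.trans (A.*-congˡ (A.reflexive (≡.sym (coeff-shift (toℕ l₀) P i₀))))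
      (A.trans (A.sym (A.trans (ΣA.sum-remove {i = l₀} t)
                 (A.trans (A.+-congˡ (sum-zero (t ∘ punchIn l₀) λ l → other (punchIn l₀ l) (Fin.punchInᵢ≢i l₀ l))) (A.+-identityʳ _))))
               (rel i))

  -- P(X) ∣ N(Xᵈ − X), with cofactor −S.
  record Transform (n d H : ℕ) (P : Poly) : Set (c ⊔ ℓ) where
    field
      {size}   : ℕ
      N        : Fin (suc n) → A.Carrier
      S        : Fin size → A.Carrier
      height   : ℕ
      N-height : ∀ i → D (N i) height
      S-height : ∀ i → D (S i) height
      N≉0      : ¬ (∀ i → N i A.≈ A.0#)
      identity : ∀ x → ev (tabulate N) (Φ d x) + ev (tabulate S) x * ev P x ≈ 0#
      height≡  : height ≡ growth (n ℕ.+ suc (n ℕ.* ℕ.pred d)) ℕ.* H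

  -- The `n + 1` powers of `X^d − X` and the `n (d − 1) + 1` shifts of `P` all have degree at most
  -- `n d`, so there is one vector more than there are coefficients. The powers have constant
  -- coefficients, so all entries have degree at most `H` in `T`.
  transform : ∀ n d H P → 1 ℕ.≤ d → DegreeAtMost n P → ¬ (∀ i → coeff P i A.≈ A.0#) → (∀ i → D (coeff P i) H) → Transform n d H P
  transform n d H P d≥1 degP P≉0 DP = record
    { N = N
    ; S = S
    ; height = _
    ; N-height = λ i → bounded (i ↑ˡ suc e)
    ; S-height = λ j → bounded (suc n ↑ʳ j)
    ; N≉0 = N≉0
    ; identity = identity
    ; height≡ = ≡.refl
    }
    where
    e = n ℕ.* ℕ.pred d
    V₁ : Fin (suc n) → Poly
    V₁ i = power (artinSchreier d) (toℕ i)
    V₂ : Fin (suc e) → Poly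
    V₂ j = shift (toℕ j) P
    V : Fin (suc n ℕ.+ suc e) → Poly
    V l = [ V₁ , V₂ ]′ (splitAt (suc n) l)
    V-bounded : ∀ l i → D (coeff (V l) i) H
    V-bounded l i with splitAt (suc n) l
    ... | inj₁ j = D-mono ℕ.z≤n (power-constant (artinSchreier d) (toℕ j) (artinSchreier-constant d) i)
    ... | inj₂ j = shift-bounded (toℕ j) P DP i
    open Relation (relation (n ℕ.+ suc e) H (λ l → coeff (V l)) V-bounded)
    nd≡ : n ℕ.* d ≡ n ℕ.+ e
    nd≡ = ≡.trans (≡.cong (n ℕ.*_) (≡.sym (ℕ.suc-pred d {{ℕ.>-nonZero d≥1}}))) (ℕ.*-suc n (ℕ.pred d))
    V-degree : ∀ l i → n ℕ.+ suc e ℕ.≤ i → coeff (V l) i A.≈ A.0#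
    V-degree l i m≤i with splitAt (suc n) l
    ... | inj₁ j = power-degree (artinSchreier d) d (toℕ j) (artinSchreier-degree d d≥1) i
                     (ℕ.≤-<-trans (ℕ.*-monoˡ-≤ d (ℕ.≤-pred (Fin.toℕ<n j)))
                       (≡.subst (ℕ._< i) (≡.sym nd≡) (≡.subst (ℕ._≤ i) (ℕ.+-suc n e) m≤i)))
    ... | inj₂ j = A.trans (A.reflexive (coeff-shift-≥ (toℕ j) P i (ℕ.≤-trans (ℕ.<⇒≤ j<) (ℕ.≤-trans (ℕ.m≤n+m (suc e) n) m≤i))))
                     (degP (i ∸ toℕ j) (ℕ.+-cancelʳ-< (toℕ j) n (i ∸ toℕ j)
                       (≡.subst (n ℕ.+ toℕ j ℕ.<_) (≡.sym (ℕ.m∸n+n≡m (ℕ.≤-trans (ℕ.<⇒≤ j<) (ℕ.≤-trans (ℕ.m≤n+m (suc e) n) m≤i))))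
                         (ℕ.<-≤-trans (ℕ.+-monoʳ-< n j<) m≤i))))
      where j< = Fin.toℕ<n j
    vanishing-all : ∀ i → ΣA.sum (λ l → weight l A.* coeff (V l) i) A.≈ A.0#
    vanishing-all i with i ℕ.<? n ℕ.+ suc e
    ... | yes i<m = vanishing i i<m
    ... | no i≮m  = sum-zero (λ l → weight l A.* coeff (V l) i) λ l → A.trans (A.*-congˡ (V-degree l i (ℕ.≮⇒≥ i≮m))) (A.zeroʳ _)
    V-ˡ : ∀ i → V (i ↑ˡ suc e) ≡ V₁ i
    V-ˡ i = ≡.cong [ V₁ , V₂ ]′ (Fin.splitAt-↑ˡ (suc n) i (suc e))
    V-ʳ : ∀ j → V (suc n ↑ʳ j) ≡ V₂ j
    V-ʳ j = ≡.cong [ V₁ , V₂ ]′ (Fin.splitAt-↑ʳ (suc n) (suc e) j)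
    N : Fin (suc n) → A.Carrier
    N i = weight (i ↑ˡ suc e)
    S : Fin (suc e) → A.Carrier
    S j = weight (suc n ↑ʳ j)
    identity : ∀ x → ev (tabulate N) (Φ d x) + ev (tabulate S) x * ev P x ≈ 0#
    identity x = begin
      ev (tabulate N) (Φ d x) + ev (tabulate S) x * ev P x
        ≈⟨ +-cong (ev-tabulate N (Φ d x)) (trans (*-congʳ (ev-tabulate S x)) (*-distribʳ-sum (ev P x) (λ j → emb (S j) * x ^ toℕ j))) ⟩
      sum (λ i → emb (N i) * Φ d x ^ toℕ i) + sum (λ j → emb (S j) * x ^ toℕ j * ev P x)
        ≈⟨ +-cong (sum-cong-≋ λ i → *-congˡ {emb (N i)} (trans (^-congˡ (toℕ i) (sym (ev-artinSchreier d x)))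
                      (trans (sym (ev-power (artinSchreier d) (toℕ i) x)) (reflexive (≡.cong (λ Q → ev Q x) (≡.sym (V-ˡ i)))))))
                  (sum-cong-≋ λ j → trans (*-assoc (emb (S j)) _ _) (*-congˡ {emb (S j)} (trans (sym (ev-shifts (toℕ j) P x))
                      (reflexive (≡.cong (λ Q → ev Q x) (≡.sym (V-ʳ j))))))) ⟩
      sum (λ i → emb (N i) * ev (V (i ↑ˡ suc e)) x) + sum (λ j → emb (S j) * ev (V (suc n ↑ʳ j)) x)
        ≈⟨ sum-split (suc n) (λ l → emb (weight l) * ev (V l) x) ⟨
      sum (λ l → emb (weight l) * ev (V l) x) ≈⟨ ev-lincomb weight V x ⟨
      ev (lincomb weight V) x ≈⟨ ev-zero (lincomb weight V) x (λ i → A.trans (coeff-lincomb weight V i) (vanishing-all i)) ⟩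
      0# ∎
    sumA-split : ∀ a {b} (f : Fin (a ℕ.+ b) → A.Carrier) → ΣA.sum f A.≈ ΣA.sum (λ i → f (i ↑ˡ b)) A.+ ΣA.sum (λ j → f (a ↑ʳ j))
    sumA-split zero    f = A.sym (A.+-identityˡ _)
    sumA-split (suc a) f = A.trans (A.+-congˡ (sumA-split a (f ∘ Fin.suc))) (A.sym (A.+-assoc _ _ _))
    N≉0 : ¬ (∀ i → weight (i ↑ˡ suc e) A.≈ A.0#)
    -- If all weights of the powers vanished, the relation would be one between shifts of `P` alone.
    N≉0 N≈0 = proj₂ nontrivial (weight≈0 (proj₁ nontrivial))
      where
      S≈0 : ∀ j → weight (suc n ↑ʳ j) A.≈ A.0#
      S≈0 = shifts-independent (λ j → weight (suc n ↑ʳ j)) P P≉0 λ i →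
        A.trans (A.sym (A.+-identityˡ _)) (A.trans (A.+-cong
          (A.sym (sum-zero (λ l → weight (l ↑ˡ suc e) A.* coeff (V (l ↑ˡ suc e)) i) λ l → A.trans (A.*-congʳ (N≈0 l)) (A.zeroˡ _)))
          (ΣA.sum-cong-≋ λ j → A.*-congˡ {weight (suc n ↑ʳ j)} (A.reflexive (≡.cong (λ Q → coeff Q i) (≡.sym (V-ʳ j))))))
          (A.trans (A.sym (sumA-split (suc n) (λ l → weight l A.* coeff (V l) i))) (vanishing-all i)))
      weight≈0 : ∀ l → weight l A.≈ A.0#
      weight≈0 l with splitAt (suc n) l in eq
      ... | inj₁ i = A.trans (A.reflexive (≡.cong weight (≡.sym (Fin.splitAt⁻¹-↑ˡ eq)))) (N≈0 i)
      ... | inj₂ j = A.trans (A.reflexive (≡.cong weight (≡.sym (Fin.splitAt⁻¹-↑ʳ eq)))) (S≈0 j)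

  coeff-tabulate-bounded : ∀ {s H} (c : Fin s → A.Carrier) → (∀ i → D (c i) H) → ∀ i → D (coeff (tabulate c) i) H
  coeff-tabulate-bounded {zero}  c Dc i       = D-0
  coeff-tabulate-bounded {suc s} c Dc zero    = Dc Fin.zero
  coeff-tabulate-bounded {suc s} c Dc (suc i) = coeff-tabulate-bounded (c ∘ Fin.suc) (Dc ∘ Fin.suc) i

  rat-ev : ∀ {E x} → Rat E x → ∀ n P → length P ℕ.≤ suc n → Rat (n ℕ.* E) (ev P x)
  rat-ev rx n       []          _          = rat-0
  rat-ev rx zero    (a ∷ [])    _          = rat-cong (sym (ev-const a _)) (rat-emb a)
  rat-ev rx zero    (a ∷ b ∷ P) (ℕ.s≤s ())
  rat-ev rx (suc n) (a ∷ P)     (ℕ.s≤s l≤) = rat-+ (rat-mono ℕ.z≤n (rat-emb a)) (rat-* rx (rat-ev rx n P l≤))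

  module Lroots = Roots L

  eval-map : ∀ P x → (map emb P) Lroots.⟦ x ⟧ ≡ ev P x
  eval-map []      x = ≡.refl
  eval-map (a ∷ P) x = ≡.cong (λ y → emb a + x * y) (eval-map P x)

  coeff-map-tabulate : ∀ {s} (c : Fin s → A.Carrier) i → Polynomial.coeff rawRing (map emb (tabulate c)) (toℕ i) ≡ emb (c i)
  coeff-map-tabulate c Fin.zero    = ≡.refl
  coeff-map-tabulate c (Fin.suc i) = coeff-map-tabulate (c ∘ Fin.suc) i

  +-≤⇒--≤ : ∀ {a b c} → a ℕ.+ c ℕ.≤ b → + a ℤ.+ ℤ.- + b ℤ.≤ ℤ.- + c
  +-≤⇒--≤ {a} {b} {c} a+c≤b = ≡.subst₂ ℤ._≤_ (lemma₁ (+ a) (+ b) (+ c)) (lemma₂ (+ b) (+ c))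
    (ℤ.+-monoˡ-≤ (ℤ.- + b ℤ.- + c) (ℤ.+≤+ a+c≤b))
    where
    lemma₁ : ∀ a b c → a ℤ.+ c ℤ.+ (ℤ.- b ℤ.- c) ≡ a ℤ.+ ℤ.- b
    lemma₁ = Z.solve 3 (λ a b c → a Z.:+ c Z.:+ (Z.:- b Z.:- c) Z.:= a Z.:+ Z.:- b) ≡.refl where module Z = +-*-Solver
    lemma₂ : ∀ b c → b ℤ.+ (ℤ.- b ℤ.- c) ≡ ℤ.- c
    lemma₂ = Z.solve 2 (λ b c → b Z.:+ (Z.:- b Z.:- c) Z.:= Z.:- c) ≡.refl where module Z = +-*-Solver

  module Bound (xi : Data) where
    open Sequence xi public

    rⱼ²≤ : ∀ j → rⱼ j ℕ.* rⱼ j ℕ.≤ rⱼ (suc j)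
    rⱼ²≤ j = ℕ.≤-trans (ℕ.≤-reflexive (≡.cong (rⱼ j ℕ.*_) (≡.sym (ℕ.*-identityʳ (rⱼ j)))))
      (ℕ.≤-trans (ℕ.^-monoʳ-≤ (rⱼ j) {{ℕ.>-nonZero (ℕ.<-trans (ℕ.s≤s ℕ.z≤n) (rⱼ≥2 j))}} (m≥2 (suc j) (ℕ.s≤s ℕ.z≤n)))
                 (ℕ.≤-reflexive (≡.sym (rⱼ-suc j))))

    j<rⱼ : ∀ j → j ℕ.< rⱼ j
    j<rⱼ zero    = ℕ.<-trans (ℕ.s≤s ℕ.z≤n) (rⱼ≥2 0)
    j<rⱼ (suc j) = ℕ.<-≤-trans (ℕ.≤-trans (ℕ.s≤s (j<rⱼ j)) (ℕ.m<m+n (rⱼ j) {rⱼ j ℕ.+ 0} (ℕ.≤-trans (ℕ.<⇒≤ (rⱼ≥2 j)) (ℕ.m≤m+n (rⱼ j) 0))))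
                     (ℕ.≤-trans (ℕ.*-monoˡ-≤ (rⱼ j) (rⱼ≥2 j)) (rⱼ²≤ j))

    liouville-bound : ∀ n → ∃[ C ] (∀ P → DegreeAtMost n P → ¬ (∀ i → coeff P i A.≈ A.0#) → ∀ H → (∀ i → D (coeff P i) H) →
                ¬ Le (ev P ξ) (ℤ.- + (C ℕ.* suc H)))
    liouville-bound n = C , λ P degP P≉0 H DP small → contradictory P degP P≉0 H DP small
      where
      -- Level `n` is taken because `n < r_n`.
      open Tail n
      b g Z C : ℕ
      -- `b` is the ratio of consecutive `B i`. In `Z`, the factor `b^n` covers the `n + 1`
      -- approximations, and the last `b` is the loss in rounding the height to a power of `b`.
      b = R ℕ.^ m₂
      g = growth (n ℕ.+ suc (n ℕ.* ℕ.pred d))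
      Z = n ℕ.* (d ℕ.* (b ℕ.^ n ℕ.* b))
      C = suc Z ℕ.* suc g
      n<d : n ℕ.< d
      n<d = j<rⱼ n
      d≥1 : 1 ℕ.≤ d
      d≥1 = ℕ.<⇒≤ (rⱼ≥2 n)
      R≥1 : 1 ℕ.≤ R
      R≥1 = ℕ.<⇒≤ R≥2
      instance
        _ = ℕ.>-nonZero R≥1
      b≥2 : 2 ℕ.≤ b
      b≥2 = ℕ.≤-trans R≥2 (ℕ.≤-trans (ℕ.≤-reflexive (≡.sym (ℕ.*-identityʳ R))) (ℕ.^-monoʳ-≤ R (ℕ.<⇒≤ m₂≥2)))
      B≡ : ∀ t → R ℕ.^ (t ℕ.* m₂) ≡ b ℕ.^ t
      B≡ t = ≡.trans (≡.cong (R ℕ.^_) (ℕ.*-comm t m₂)) (≡.sym (ℕ.^-*-assoc R m₂ t))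
      module _ (P : Poly) (degP : DegreeAtMost n P) (P≉0 : ¬ (∀ i → coeff P i A.≈ A.0#)) (H : ℕ)
               (DP : ∀ i → D (coeff P i) H) (small : Le (ev P ξ) (ℤ.- + (C ℕ.* suc H))) where
        open Transform (transform n d H P d≥1 degP P≉0 DP)
        -- From `t₀` on the truncation orders exceed the height of `N`, as `separation-bound`
        -- requires.
        t₀ : ℕ
        t₀ = proj₁ (power-between b≥2 height)
        B N′ : ℕ → ℕ
        B i = R ℕ.^ ((i ℕ.+ t₀) ℕ.* m₂)
        N′ i = R ℕ.^ suc ((i ℕ.+ t₀) ℕ.* m₂)
        height<B : ∀ i → height ℕ.< B i
        height<B i = ℕ.<-≤-trans (proj₁ (proj₂ (power-between b≥2 height)))
          (ℕ.≤-trans (ℕ.^-monoʳ-≤ b {{ℕ.>-nonZero (ℕ.<⇒≤ b≥2)}} (ℕ.m≤n+m t₀ i)) (ℕ.≤-reflexive (≡.sym (B≡ (i ℕ.+ t₀)))))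
        B≤ : ∀ i → i ℕ.≤ n → B i ℕ.≤ (b ℕ.^ n ℕ.* b) ℕ.* suc height
        B≤ i i≤n = ℕ.≤-trans (ℕ.≤-reflexive (≡.trans (B≡ (i ℕ.+ t₀)) (ℕ.^-distribˡ-+-* b i t₀)))
          (ℕ.≤-trans (ℕ.*-mono-≤ (ℕ.^-monoʳ-≤ b {{ℕ.>-nonZero (ℕ.<⇒≤ b≥2)}} i≤n) (proj₂ (proj₂ (power-between b≥2 height))))
                     (ℕ.≤-reflexive (≡.sym (ℕ.*-assoc (b ℕ.^ n) b (suc height)))))
        approx : ∀ i → Approximant (B i) (N′ i)
        approx i = approximant (ℕ.m^n>0 R ((i ℕ.+ t₀) ℕ.* m₂)) (ℕ.m^n>0 R (suc ((i ℕ.+ t₀) ℕ.* m₂)))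
                     (good-multiple (i ℕ.+ t₀))
        module A′ i = Approximant (approx i)
        u : Carrier
        u = Φ d ξ
        v : ℕ → Carrier
        v i = Φ d (A′.β i)
        u≤0 : Le u (+ 0)
        u≤0 = le-- (le-^ d ξ-le) ξ-le
        NP : Poly
        NP = tabulate N
        -- By `identity`, `N(u)` is `−S(ξ) P(ξ)`, and `S(ξ)` is at most `q^height`.
        ev-u : ∀ i → i ℕ.≤ n → Le (ev NP u) (ℤ.- + suc (n ℕ.* (d ℕ.* B i)))
        ev-u i i≤n = le-mono (+-≤⇒--≤ (transform-bound n d (b ℕ.^ n ℕ.* b) g H height≡ (B≤ i i≤n)))
          (le-cong (begin
              - (ev (tabulate S) ξ * ev P ξ)              ≈⟨ solve 2 (λ a b → :- b := a :- (a :+ b)) refl (ev NP u) _ ⟩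
              ev NP u - (ev NP u + ev (tabulate S) ξ * ev P ξ)  ≈⟨ +-congˡ (-‿cong (identity ξ)) ⟩
              ev NP u - 0#                                ≈⟨ solve 1 (λ a → a :- :0 := a) refl (ev NP u) ⟩
              ev NP u ∎)
            (le-neg (le-* (ev-le (tabulate S) (coeff-tabulate-bounded S S-height) ξ-le) small)))
        -- `N(u)` and `N(u) − N(v i)` are both too small for `N(v i)`, which has denominator
        -- `T^(n d B i)`, to be nonzero.
        root : ∀ i → i ℕ.≤ n → ev NP (v i) ≈ 0#
        root i i≤n = rat-small⇒0 (ℤ.neg-mono-< (ℤ.+<+ (ℕ.n<1+n _)))
          (rat-ev (A′.rational i) n NP (ℕ.≤-reflexive (List.length-tabulate N)))
          (le-cong (solve 2 (λ a b → a :- (a :- b) := b) refl (ev NP u) (ev NP (v i)))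
            (le-- (ev-u i i≤n)
                  (le-mono (≡.subst (ℤ._≤ ℤ.- + suc (n ℕ.* (d ℕ.* B i))) (ℤ.+-comm (+ height) (ℤ.- + N′ i)) (+-≤⇒--≤ (separation-bound (height<B i) n<d (rⱼ²≤ n))))
                    (ev-diff-le NP (coeff-tabulate-bounded N N-height) u≤0 (A′.Φ-le i) (proj₁ (A′.closeΦ i))))))
        -- The points differ because their distances to `u` do: `N′ i < N′ i′`.
        apart : ∀ {i i′} → i ℕ.< i′ → Lroots.Apart (v i) (v i′)
        apart {i} {i′} i<i′ z = ex-cancel (ex-cong
          (solve 3 (λ u a b → :- (u :- a) :+ (u :- b) := a :- b) refl u (v i) (v i′))
          (ex-+ (ex-neg (A′.closeΦ i)) (proj₁ (A′.closeΦ i′)) (ℤ.neg-mono-< (ℤ.+<+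
            (ℕ.^-monoʳ-< R R≥2 (ℕ.s≤s (ℕ.*-monoˡ-< m₂ {{ℕ.>-nonZero (ℕ.<⇒≤ m₂≥2)}} (ℕ.+-monoˡ-< t₀ i<i′))))))))
        NP-zero : ∀ i → Polynomial.coeff rawRing (map emb NP) i ≈ 0#
        NP-zero = Lroots.distinct-roots (applyUpTo v (suc n)) (map emb NP)
          (ℕ.≤-reflexive (≡.trans (List.length-map emb NP) (≡.trans (List.length-tabulate N) (≡.sym (List.length-applyUpTo v (suc n))))))
          (AllPairs.applyUpTo⁺₁ v (suc n) λ i<i′ _ → apart i<i′)
          (All.applyUpTo⁺₁ v (suc n) λ {i} i<sn → trans (reflexive (eval-map NP (v i))) (root i (ℕ.≤-pred i<sn)))
        contradictory : ⊥
        contradictory = N≉0 λ i → emb-0⇒0 (trans (reflexive (≡.sym (coeff-map-tabulate N i))) (NP-zero (toℕ i)))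

    abstract
      liouville : ∀ n → ∃[ C ] (∀ P → DegreeAtMost n P → ¬ (∀ i → coeff P i A.≈ A.0#) → ∀ H → (∀ i → D (coeff P i) H) →
                  ¬ Le (ev P ξ) (ℤ.- + (C ℕ.* suc H)))
      liouville = liouville-bound

-- Heights and minimal polynomials over k[T]

least : ∀ {ℓ} {P : ℕ → Set ℓ} → (∀ n → Dec (P n)) → ∀ n → P n → ∃[ m ] m ℕ.≤ n × P m × (∀ l → l ℕ.< m → ¬ P l)
least {P = P} P? n Pn with P? 0
... | yes P0 = 0 , ℕ.z≤n , P0 , λ _ ()
least P? zero    Pn | no ¬P0 = ⊥-elim (¬P0 Pn)
least P? (suc n) Pn | no ¬P0 with least (P? ∘ suc) n Pn
... | m , m≤n , Pm , below = suc m , ℕ.s≤s m≤n , Pm , λ { zero _ → ¬P0 ; (suc l) (ℕ.s≤s l<m) → below l l<m }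

module MinimalPolynomials {c ℓ} (K : CommutativeRing c ℓ) (F : LaurentField K) (p : ℕ) (p-prime : Prime p)
    (char : Characteristic K p)
    (inverse : HasInverses K) (finite : IsFinite K) where
  private module K = CommutativeRing K
  open Σ finite renaming (proj₁ to elements; proj₂ to complete)
  open LaurentField F
  open Valuation K F
  open Liouville K F p p-prime char
  open Polynomial A.rawRing
  open Series A using (Fun; conv; conv-comm; conv-zeroˡ; coeff-+; coeff-*; coeff-map)
  open Convolution A using (conv-dominant; coeff-length; coeff-*-top; fromFun; coeff-fromFun; coeff-fromFun-≥)
  private
    module emb = IsRingHomomorphism emb-hom
    module K[T] = Polynomial K.rawRing

  *ₚ-comm : ∀ P Q i → coeff (P *ₚ Q) i A.≈ coeff (Q *ₚ P) i
  *ₚ-comm P Q i = A.trans (coeff-* P Q i) (A.trans (conv-comm (coeff P) (coeff Q) i) (A.sym (coeff-* Q P i)))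

  tuples : ℕ → List (List K.Carrier)
  tuples zero    = [] ∷ []
  tuples (suc n) = cartesianProductWith _∷_ elements (tuples n)

  tuples-complete : ∀ n (f : ℕ → K.Carrier) → Any (λ t → ∀ i → i ℕ.< n → f i K.≈ K[T].coeff t i) (tuples n)
  tuples-complete zero    f = here λ _ ()
  tuples-complete (suc n) f = Any.cartesianProductWith⁺ _∷_
    (λ fx∼ rest → λ { zero _ → fx∼ ; (suc i) (ℕ.s≤s i<n) → rest i i<n }) (complete (f 0)) (tuples-complete n (f ∘ suc))

  ABox : ℕ → Set _
  ABox H = ∃[ a ] D a H

  A-boxes : ∀ H → List (ABox H)
  A-boxes H = map (λ t → let a , _ , above = polynomial (K[T].coeff t) H in a , degree⇒emb-le above) (tuples (suc H))

  A-boxes-complete : ∀ H a → D a H → Any (λ b → a A.≈ proj₁ b) (A-boxes H)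
  A-boxes-complete H a Da = Any.map⁺ (Any.map (λ {t} → match {t}) (tuples-complete (suc H) (coeffₐ a)))
    where
    match : ∀ {t} → (∀ i → i ℕ.< suc H → coeffₐ a i K.≈ K[T].coeff t i) → a A.≈ proj₁ (polynomial (K[T].coeff t) H)
    match {t} agree with polynomial (K[T].coeff t) H
    ... | b , below , above = coeffₐ-ext λ i → case i
      where
      case : ∀ i → coeffₐ a i K.≈ coeffₐ b i
      case i with i ℕ.≤? H
      ... | yes i≤H = K.trans (agree i (ℕ.s≤s i≤H)) (K.sym (below i i≤H))
      ... | no i≰H  = K.trans (emb-le⇒degree Da i (ℕ.≰⇒> i≰H)) (K.sym (above i (ℕ.≰⇒> i≰H)))

  Bounded : ℕ → ℕ → Fun → Set _
  Bounded n H f = (∀ i → n ℕ.≤ i → f i A.≈ A.0#) × (∀ i → D (f i) H)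

  -- At most `n` coefficients, hence degree below `n`. Over a finite field there are finitely many
  -- such polynomials of height at most `q^H`, which makes the search for a minimal polynomial
  -- finite.
  Box : ℕ → ℕ → Set _
  Box n H = ∃[ P ] Bounded n H (coeff P)

  consBox : ∀ {n H} → ABox H → Box n H → Box (suc n) H
  consBox (a , Da) (P , vanish , DP) = a ∷ P , (λ { (suc i) (ℕ.s≤s n≤i) → vanish i n≤i }) , λ { zero → Da ; (suc i) → DP i }

  boxes : ∀ n H → List (Box n H)
  boxes zero    H = ([] , (λ _ _ → A.refl) , λ _ → D-0) ∷ []
  boxes (suc n) H = cartesianProductWith consBox (A-boxes H) (boxes n H)

  boxes-complete : ∀ n H f → Bounded n H f → Any (λ b → ∀ i → f i A.≈ coeff (proj₁ b) i) (boxes n H)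
  boxes-complete zero    H f (vanish , _) = here λ i → vanish i ℕ.z≤n
  boxes-complete (suc n) H f (vanish , Df) = Any.cartesianProductWith⁺ consBox
    (λ fx∼ rest → λ { zero → fx∼ ; (suc i) → rest i }) (A-boxes-complete H (f 0) (Df 0))
    (boxes-complete n H (f ∘ suc) ((λ i n≤i → vanish (suc i) (ℕ.s≤s n≤i)) , Df ∘ suc))

  constants : ℕ → List Poly
  constants n = map proj₁ (boxes (suc n) 0)

  constants-complete : ∀ n P → DegreeAtMost n P → (∀ i → D (coeff P i) 0) → Any (λ Q → ∀ i → coeff P i A.≈ coeff Q i) (constants n)
  constants-complete n P deg DP = Any.map⁺ (boxes-complete (suc n) 0 (coeff P) (deg , DP))

  Zero : Poly → Set _
  Zero P = ∀ i → coeff P i A.≈ A.0#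

  Zero? : ∀ P → Dec (Zero P)
  Zero? P with first-nonzero-coeff P
  ... | inj₁ z = yes z
  ... | inj₂ (i , ≉ , _) = no λ z → ≉ (z i)

  exact-degree : ∀ P → ¬ Zero P → ∃[ d ] HasDegree P d
  exact-degree P P≉0 = go (length P) (λ i l≤i → coeff-length P i l≤i)
    where
    go : ∀ n → (∀ i → n ℕ.≤ i → coeff P i A.≈ A.0#) → ∃[ d ] HasDegree P d
    go zero    above = ⊥-elim (P≉0 λ i → above i ℕ.z≤n)
    go (suc n) above with A-zero? (coeff P n)
    ... | no ≉  = n , above , ≉
    ... | yes z = go n λ i n≤i → case i n≤i
      where
      case : ∀ i → n ℕ.≤ i → coeff P i A.≈ A.0#
      case i n≤i with n ℕ.≟ i
      ... | yes ≡.refl = z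
      ... | no n≢i     = above i (ℕ.≤∧≢⇒< n≤i n≢i)

  -- The index `i₀` is the first at which the height is attained; the strict inequality before it
  -- singles out one dominant term in a product.
  record Height (P : Poly) : Set (c ⊔ ℓ) where
    field
      height   : ℕ
      bounded  : ∀ i → D (coeff P i) height
      i₀       : ℕ
      attained : Ex (emb (coeff P i₀)) (+ height)
      before   : ∀ i → i ℕ.< i₀ → Le (emb (coeff P i)) (ℤ.pred (+ height))

  extend : ∀ a P → ¬ Zero (a ∷ P) → (¬ Zero P → Height P) → Height (a ∷ P)
  extend a P aP≉0 rec with zero-or-degree a | Zero? P
  ... | inj₁ a≈0 | yes P≈0 = ⊥-elim (aP≉0 λ { zero → a≈0 ; (suc i) → P≈0 i })
  ... | inj₁ a≈0 | no P≉0 = record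
    { height = height ; bounded = λ { zero → D-cong (A.sym a≈0) D-0 ; (suc i) → bounded i } ; i₀ = suc i₀ ; attained = attained
    ; before = λ { zero _ → le-cong (L.trans (L.sym emb.0#-homo) (emb.⟦⟧-cong (A.sym a≈0))) le-0 ; (suc i) (ℕ.s≤s i<) → before i i< } }
    where open Height (rec P≉0)
  ... | inj₂ (h , ex) | yes P≈0 = record
    { height = h ; bounded = λ { zero → proj₁ ex ; (suc i) → D-cong (A.sym (P≈0 i)) D-0 } ; i₀ = 0 ; attained = ex ; before = λ _ () }
  ... | inj₂ (h , ex) | no P≉0 with h ℕ.<? Height.height (rec P≉0)
  ...   | yes h< = record
    { height = height ; bounded = λ { zero → D-mono (ℕ.<⇒≤ h<) (proj₁ ex) ; (suc i) → bounded i } ; i₀ = suc i₀ ; attained = attained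
    ; before = λ { zero _ → le-mono (ℤ.i<j⇒i≤pred[j] (ℤ.+<+ h<)) (proj₁ ex) ; (suc i) (ℕ.s≤s i<) → before i i< } }
    where open Height (rec P≉0)
  ...   | no h≮ = record
    { height = h ; bounded = λ { zero → proj₁ ex ; (suc i) → D-mono (ℕ.≮⇒≥ h≮) (Height.bounded (rec P≉0) i) }
    ; i₀ = 0 ; attained = ex ; before = λ _ () }

  exact-height : ∀ P → ¬ Zero P → Height P
  exact-height []      P≉0 = ⊥-elim (P≉0 λ _ → A.refl)
  exact-height (a ∷ P) P≉0 = extend a P P≉0 (exact-height P)

  -- Gauss's lemma for the height.
  height-* : ∀ P Q → (hP : Height P) (hQ : Height Q) → ∀ {H} → (∀ i → D (coeff (P *ₚ Q) i) H) →
             Height.height hP ℕ.+ Height.height hQ ℕ.≤ H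
  height-* P Q hP hQ {H} DPQ = ℤ.drop‿+≤+ (ex-le lead (DPQ (P.i₀ ℕ.+ Q.i₀)))
    where
    module P = Height hP
    module Q = Height hQ
    small : A.Carrier → Set _
    small a = Le (emb a) (ℤ.pred (+ (P.height ℕ.+ Q.height)))
    -- If `i` differs from `P.i₀`, one of the two indices lies before the first maximum of its
    -- polynomial, and that factor loses at least one power of `q`.
    term : ∀ i j → i ℕ.+ j ≡ P.i₀ ℕ.+ Q.i₀ → i ≡.≢ P.i₀ → small (coeff P i A.* coeff Q j)
    term i j eq i≢ with i ℕ.<? P.i₀
    ... | yes i<  = le-cong (L.sym (emb.*-homo _ _)) (≡.subst (Le _) (ℤ.pred-+ (+ P.height) (+ Q.height)) (le-* (P.before i i<) (Q.bounded j)))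
    ... | no i≮   = le-cong (L.sym (emb.*-homo _ _)) (≡.subst (Le _) (ℤ.+-pred (+ P.height) (+ Q.height)) (le-* (P.bounded i) (Q.before j
                      (ℕ.+-cancelˡ-< P.i₀ j Q.i₀ (≡.subst (P.i₀ ℕ.+ j ℕ.<_) eq (ℕ.+-monoˡ-< j (ℕ.≤∧≢⇒< (ℕ.≮⇒≥ i≮) (i≢ ∘ ≡.sym))))))))
    dominant : small (conv (coeff P) (coeff Q) (P.i₀ ℕ.+ Q.i₀) A.- coeff P P.i₀ A.* coeff Q Q.i₀)
    dominant = conv-dominant small (λ e → le-cong (emb.⟦⟧-cong e)) (λ a b → le-cong (L.sym (emb.+-homo _ _)) (le-+ a b))
      (le-cong (L.sym emb.0#-homo) le-0) (coeff P) (coeff Q) P.i₀ Q.i₀ term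
    lead : Ex (emb (coeff (P *ₚ Q) (P.i₀ ℕ.+ Q.i₀))) (+ (P.height ℕ.+ Q.height))
    lead = ex-cong (emb.⟦⟧-cong (A.trans (AS.solve 2 (λ a b → a AS.:+ (b AS.:- a) AS.:= b) A.refl _ _) (A.sym (coeff-* P Q _))))
      (ex-cong (L.sym (emb.+-homo _ _)) (ex-+ (ex-cong (L.sym (emb.*-homo _ _)) (ex-* P.attained Q.attained)) dominant
        (ℤ.i≤pred[j]⇒i<j ℤ.≤-refl)))
      where module AS = Solver A

  constant-polynomial : ∀ x → ∃[ a ] D a 0 × coeffₐ a 0 K.≈ x
  constant-polynomial x with polynomial (λ _ → x) 0
  ... | a , below , above = a , degree⇒emb-le above , below 0 ℕ.z≤n

  coeffₐ-*-lead : ∀ a b h → D a 0 → D b h → coeffₐ (a A.* b) h K.≈ coeffₐ a 0 K.* coeffₐ b h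
  coeffₐ-*-lead a b h Da Db = K.trans (K.sym (coef-emb-neg (a A.* b) h)) (K.trans (coef-cong (emb.*-homo a b) _)
    (K.trans (proj₂ (coef-lead-* (emb a) (emb b) (+ 0) (+ h) (vanish Da) (vanish Db)))
      (K.*-cong (coef-emb-neg a 0) (coef-emb-neg b h))))

  unit-inverse : ∀ a → ¬ a A.≈ A.0# → D a 0 → ∃[ b ] b A.* a A.≈ A.1#
  unit-inverse a a≉0 Da with inverse (coeffₐ a 0) (λ z → a≉0 (coeffₐ-ext λ i → K.trans (zeros z i) (K.sym (A0 i))))
    where
    A0 : ∀ i → coeffₐ A.0# i K.≈ K.0#
    A0 i = K.trans (K.sym (coef-emb-neg A.0# i)) (K.trans (coef-cong emb.0#-homo _) (coef-0 _))
    zeros : coeffₐ a 0 K.≈ K.0# → ∀ i → coeffₐ a i K.≈ K.0#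
    zeros z zero    = z
    zeros z (suc i) = emb-le⇒degree Da (suc i) (ℕ.s≤s ℕ.z≤n)
  ... | y , xy≈1 with constant-polynomial y
  ...   | b , Db , b₀ = b , coeffₐ-ext coefs
    where
    1₀ : coeffₐ A.1# 0 K.≈ K.1#
    1₀ = K.trans (K.sym (coef-emb-neg A.1# 0)) (K.trans (coef-cong (L.trans emb.1#-homo (L.sym T^0)) _) (coef-T^ (+ 0)))
    coefs : ∀ i → coeffₐ (b A.* a) i K.≈ coeffₐ A.1# i
    coefs zero    = K.trans (coeffₐ-*-lead b a 0 Db Da) (K.trans (K.*-congʳ b₀) (K.trans (K.*-comm _ _) (K.trans xy≈1 (K.sym 1₀))))
    coefs (suc i) = K.trans (emb-le⇒degree (D-* Db Da) (suc i) (ℕ.s≤s ℕ.z≤n)) (K.sym (emb-le⇒degree D-1 (suc i) (ℕ.s≤s ℕ.z≤n)))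

  coeff-scale : ∀ a Q i → coeff ((a ∷ []) *ₚ Q) i A.≈ a A.* coeff Q i
  coeff-scale a Q i = A.trans (coeff-+ (map (a A.*_) Q) (A.0# ∷ []) i)
    (A.trans (A.+-cong (coeff-map (a A.*_) (A.zeroʳ a) Q i) (zero∷[] i)) (A.+-identityʳ _))
    where
    zero∷[] : ∀ i → coeff (A.0# ∷ []) i A.≈ A.0#
    zero∷[] zero    = A.refl
    zero∷[] (suc i) = A.refl

  open RawSemiringDefs (RawRing.rawSemiring polyRawRing) using (Irreducible) renaming (_∣_ to _∣ₚ_)
  open RawSemiringDefs (RawRing.rawSemiring A.rawRing) using () renaming (_∣_ to _∣ₐ_)

  unit-polynomial : ∀ Q → ¬ Zero Q → DegreeAtMost 0 Q → (∀ i → D (coeff Q i) 0) → Q ∣ₚ (A.1# ∷ [])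
  unit-polynomial Q Q≉0 deg DQ with unit-inverse (coeff Q 0) (λ z → Q≉0 λ { zero → z ; (suc i) → deg (suc i) (ℕ.s≤s ℕ.z≤n) }) (DQ 0)
  ... | b , ba≈1 = (b ∷ []) RawMagmaDefs., λ
    { zero    → A.trans (coeff-scale b Q 0) ba≈1
    ; (suc i) → A.trans (coeff-scale b Q (suc i)) (A.trans (A.*-congˡ (deg (suc i) (ℕ.s≤s ℕ.z≤n))) (A.zeroʳ b)) }

  module _ {c₁ ℓ₁} (Ω : CommutativeRing c₁ ℓ₁)
      (Ω-1≉0 : Nontrivial Ω) (Ω-zero? : DecidableZero Ω) (Ω-domain : IsDomain Ω)
      (ψ : A.Carrier → CommutativeRing.Carrier Ω) (ψ-hom : IsRingHomomorphism A.rawRing (CommutativeRing.rawRing Ω) ψ)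
      (ψ-injective : ∀ {a} → CommutativeRing._≈_ Ω (ψ a) (CommutativeRing.0# Ω) → a A.≈ A.0#)
      (β : CommutativeRing.Carrier Ω) where
    open CommutativeRing Ω hiding (zero)
    open Evaluation A Ω ψ ψ-hom renaming (ev to evΩ) using (ev-cong; ev-*; ev-const)
    private module ψ = IsRingHomomorphism ψ-hom

    record MinimalPolynomial (d₀ H₀ : ℕ) : Set (c ⊔ ℓ ⊔ c₁ ⊔ ℓ₁) where
      field
        P            : Poly
        degree       : ℕ
        hasDegree    : HasDegree P degree
        nonConstant  : 1 ℕ.≤ degree
        irreducible  : Irreducible P
        isPrimitive    : ∀ a → (∀ i → a ∣ₐ coeff P i) → a ∣ₐ A.1#
        leadDegree   : ℕ
        leadBound    : ∀ i → leadDegree ℕ.< i → coeffₐ (coeff P degree) i K.≈ K.0#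
        leadMonic    : coeffₐ (coeff P degree) leadDegree K.≈ K.1#
        root         : evΩ P β ≈ 0#
        degree≤      : degree ℕ.≤ d₀
        height       : Height P
        height≤      : Height.height height ℕ.≤ H₀

    Annihilates : Poly → Set _
    Annihilates P = ¬ Zero P × evΩ P β ≈ 0#

    -- Degree at most `d` means `d + 1` coefficients.
    Ann : ℕ → ℕ → Set _
    Ann d H = Any (Annihilates ∘ proj₁) (boxes (suc d) H)

    Ann? : ∀ d H → Dec (Ann d H)
    Ann? d H = Any.any? (λ b → ¬? (Zero? (proj₁ b)) ×-dec Ω-zero? (evΩ (proj₁ b) β)) (boxes (suc d) H)

    ann : ∀ {d H} P → DegreeAtMost d P → (∀ i → D (coeff P i) H) → Annihilates P → Ann d H
    ann {d} {H} P deg DP (P≉0 , root) = Any.map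
      (λ {b} e → (λ z → P≉0 λ i → A.trans (e i) (z i)) , trans (sym (ev-cong P (proj₁ b) e refl)) root)
      (boxes-complete (suc d) H (coeff P) (deg , DP))

    -- The polynomial Tᴱ (Xᵈ − X) − W vanishing at β may be reducible, for instance when p = 3 and m₁ = 2.
    -- So the minimal polynomial is found by search: first the least degree, then the least height.
    module Minimal {d₀ H₀ d H : ℕ} (d≤d₀ : d ℕ.≤ d₀) (d-least : ∀ l → l ℕ.< d → ¬ Ann l H₀)
        (H≤H₀ : H ℕ.≤ H₀) (H-least : ∀ l → l ℕ.< H → ¬ Ann d l)
        (P₁ : Poly) (deg₁ : DegreeAtMost d P₁) (DP₁ : ∀ i → D (coeff P₁ i) H)
        (P₁≉0 : ¬ Zero P₁) (root₁ : evΩ P₁ β ≈ 0#) where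
      degree-minimal : ∀ {d′} Q → DegreeAtMost d′ Q → (∀ i → D (coeff Q i) H₀) → Annihilates Q → d ℕ.≤ d′
      degree-minimal Q deg DQ annQ = ℕ.≮⇒≥ λ d′<d → d-least _ d′<d (ann Q deg DQ annQ)
      height-minimal : ∀ {H′} Q → DegreeAtMost d Q → (∀ i → D (coeff Q i) H′) → Annihilates Q → H ℕ.≤ H′
      height-minimal Q deg DQ annQ = ℕ.≮⇒≥ λ H′<H → H-least _ H′<H (ann Q deg DQ annQ)
      DH₀ : ∀ {Q} → (∀ i → D (coeff Q i) H) → ∀ i → D (coeff Q i) H₀
      DH₀ DQ i = D-mono H≤H₀ (DQ i)
      -- Otherwise `P₁` would already be found in a smaller degree, its height being within `H₀`.
      lead₁≉0 : ¬ coeff P₁ d A.≈ A.0#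
      lead₁≉0 z with exact-degree P₁ P₁≉0
      ... | d′ , deg′ , ≉ with degree-minimal P₁ deg′ (DH₀ {P₁} DP₁) (P₁≉0 , root₁)
      ...   | d≤d′ with d ℕ.≟ d′
      ...     | yes ≡.refl = ≉ z
      ...     | no d≢d′    = ≉ (deg₁ d′ (ℕ.≤∧≢⇒< d≤d′ d≢d′))
      lead-degree : ∃[ h ] Ex (emb (coeff P₁ d)) (+ h)
      lead-degree = [ (λ z → ⊥-elim (lead₁≉0 z)) , id ]′ (zero-or-degree (coeff P₁ d))
      h = proj₁ lead-degree
      -- A constant factor preserves the degree and the bound on the height; this one makes the
      -- leading coefficient monic in `T`.
      scalar : ∃[ y ] coeffₐ (coeff P₁ d) h K.* y K.≈ K.1#
      scalar = inverse _ λ z → proj₂ (proj₂ lead-degree) (K.trans (coef-emb-neg _ h) z)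
      κ-data = constant-polynomial (proj₁ scalar)
      κ = proj₁ κ-data
      Dκ = proj₁ (proj₂ κ-data)
      P = (κ ∷ []) *ₚ P₁
      coeffP : ∀ i → coeff P i A.≈ κ A.* coeff P₁ i
      coeffP = coeff-scale κ P₁
      DP : ∀ i → D (coeff P i) H
      DP i = D-cong (A.sym (coeffP i)) (D-* Dκ (DP₁ i))
      deg : DegreeAtMost d P
      deg i d<i = A.trans (coeffP i) (A.trans (A.*-congˡ (deg₁ i d<i)) (A.zeroʳ κ))
      monic : coeffₐ (coeff P d) h K.≈ K.1#
      monic = K.trans (coeffₐ-cong (coeffP d) h) (K.trans (coeffₐ-*-lead κ (coeff P₁ d) h Dκ (proj₁ (proj₂ lead-degree)))
                (K.trans (K.*-congʳ (proj₂ (proj₂ κ-data))) (K.trans (K.*-comm _ _) (proj₂ scalar))))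
      lead-exact : Ex (emb (coeff P d)) (+ h)
      lead-exact = D-cong (A.sym (coeffP d)) (D-* Dκ (proj₁ (proj₂ lead-degree))) ,
        λ z → LaurentField.1≉0 F (K.trans (K.sym monic) (K.trans (K.sym (coef-emb-neg _ h)) z))
      lead≉0 : ¬ coeff P d A.≈ A.0#
      lead≉0 z = ex⇒≉0 lead-exact (L.trans (emb.⟦⟧-cong z) emb.0#-homo)
      P≉0 : ¬ Zero P
      P≉0 z = lead≉0 (z d)
      root : evΩ P β ≈ 0#
      root = trans (ev-* (κ ∷ []) P₁ β) (trans (*-congˡ root₁) (zeroʳ _))
      heightP = exact-height P P≉0
      d≥1 : 1 ℕ.≤ d
      d≥1 = ℕ.n≢0⇒n>0 λ { ≡.refl → P≉0 λ
        { zero → ψ-injective (trans (sym (ev-const (coeff P 0) β)) (trans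
            (ev-cong (coeff P 0 ∷ []) P (λ { zero → A.refl ; (suc i) → A.sym (deg (suc i) (ℕ.s≤s ℕ.z≤n)) }) refl) root))
        ; (suc i) → deg (suc i) (ℕ.s≤s ℕ.z≤n) } }
      not-unit : ¬ P ∣ₚ (A.1# ∷ [])
      not-unit (Y RawMagmaDefs., YP≈1) = Ω-1≉0 (trans (sym ψ.1#-homo) (trans (sym (ev-const A.1# β))
        (trans (sym (ev-cong (Y *ₚ P) (A.1# ∷ []) YP≈1 refl)) (trans (ev-* Y P β) (trans (*-congˡ root) (zeroʳ _))))))
      nonzero-factors : ∀ Q S → (∀ i → coeff P i A.≈ coeff (Q *ₚ S) i) → ¬ Zero Q × ¬ Zero S
      nonzero-factors Q S e =
        (λ z → P≉0 λ i → A.trans (e i) (A.trans (coeff-* Q S i) (conv-zeroˡ (coeff Q) (coeff S) z i))) ,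
        (λ z → P≉0 λ i → A.trans (e i) (A.trans (coeff-* Q S i)
                 (A.trans (conv-comm (coeff Q) (coeff S) i) (conv-zeroˡ (coeff S) (coeff Q) z i))))
      -- By Gauss's lemma the factor `Q` vanishing at `β` has height at most `H`, so it lies within
      -- the range of the search. Minimality of `d` leaves degree 0 for `S`, and then minimality of
      -- `H` leaves height exponent 0, so that `S` is a nonzero constant of `k`.
      cofactor-unit : ∀ Q S → (∀ i → coeff P i A.≈ coeff (Q *ₚ S) i) → evΩ Q β ≈ 0# → S ∣ₚ (A.1# ∷ [])
      cofactor-unit Q S e rootQ = unit-polynomial S S≉0
        (≡.subst (λ n → DegreeAtMost n S) dS≡0 (proj₁ (proj₂ degS)))
        (λ i → ≡.subst (D (coeff S i)) hS≡0 (Height.bounded heightS i))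
        where
        Q≉0 = proj₁ (nonzero-factors Q S e)
        S≉0 = proj₂ (nonzero-factors Q S e)
        degQ = exact-degree Q Q≉0
        degS = exact-degree S S≉0
        dQ = proj₁ degQ
        dS = proj₁ degS
        heightQ = exact-height Q Q≉0
        heightS = exact-height S S≉0
        hQ = Height.height heightQ
        hS = Height.height heightS
        heights : hQ ℕ.+ hS ℕ.≤ H
        heights = height-* Q S heightQ heightS λ i → D-cong (e i) (DP i)
        degrees : dQ ℕ.+ dS ℕ.≤ d
        degrees = ℕ.≮⇒≥ λ d< → [ proj₂ (proj₂ degQ) , proj₂ (proj₂ degS) ]′ (A-domain
          (A.trans (A.sym (coeff-*-top Q S (proj₁ (proj₂ degQ)) (proj₁ (proj₂ degS)))) (A.trans (A.sym (e _)) (deg _ d<))))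
        d≤dQ : d ℕ.≤ dQ
        d≤dQ = degree-minimal Q (proj₁ (proj₂ degQ))
          (λ i → D-mono (ℕ.≤-trans (ℕ.m≤m+n hQ hS) (ℕ.≤-trans heights H≤H₀)) (Height.bounded heightQ i)) (Q≉0 , rootQ)
        dS≡0 : dS ≡ 0
        dS≡0 = ℕ.n≤0⇒n≡0 (ℕ.+-cancelˡ-≤ dQ dS 0 (ℕ.≤-trans degrees (ℕ.≤-trans d≤dQ (ℕ.≤-reflexive (≡.sym (ℕ.+-identityʳ dQ))))))
        H≤hQ : H ℕ.≤ hQ
        H≤hQ = height-minimal Q (λ i d<i → proj₁ (proj₂ degQ) i (ℕ.≤-<-trans (ℕ.≤-trans (ℕ.m≤m+n dQ dS) degrees) d<i))
          (Height.bounded heightQ) (Q≉0 , rootQ)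
        hS≡0 : hS ≡ 0
        hS≡0 = ℕ.n≤0⇒n≡0 (ℕ.+-cancelˡ-≤ hQ hS 0 (ℕ.≤-trans heights (ℕ.≤-trans H≤hQ (ℕ.≤-reflexive (≡.sym (ℕ.+-identityʳ hQ))))))
      factor-root : ∀ Q S → (∀ i → coeff P i A.≈ coeff (Q *ₚ S) i) → evΩ Q β ≈ 0# ⊎ evΩ S β ≈ 0#
      factor-root Q S e = Ω-domain (trans (sym (ev-* Q S β)) (trans (sym (ev-cong P (Q *ₚ S) e refl)) root))
      irreducible : ∀ {Q S} → (∀ i → coeff P i A.≈ coeff (Q *ₚ S) i) → Q ∣ₚ (A.1# ∷ []) ⊎ S ∣ₚ (A.1# ∷ [])
      irreducible {Q} {S} e = [ (λ rootQ → inj₂ (cofactor-unit Q S e rootQ))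
                              , (λ rootS → inj₁ (cofactor-unit S Q (λ i → A.trans (e i) (*ₚ-comm Q S i)) rootS)) ]′ (factor-root Q S e)
      -- A common divisor `a` yields a factorization `P = Q · a` in which `Q` has the root `β`, so
      -- the cofactor `a` is a unit by the same minimality.
      isPrimitive : ∀ a → (∀ i → a ∣ₐ coeff P i) → a ∣ₐ A.1#
      isPrimitive a a∣P = unit-coeff (cofactor-unit Q (a ∷ []) e rootQ)
        where
        quotient : Fun
        quotient i = RawMagmaDefs._∣ʳ_.quotient (a∣P i)
        -- The divisibility witnesses form an infinite sequence; cutting it off after the degree
        -- makes it a polynomial.
        Q = fromFun quotient (suc d)
        Qa≈P : ∀ i → coeff Q i A.* a A.≈ coeff P i
        Qa≈P i = [ (λ i≤d → A.trans (A.*-congʳ (coeff-fromFun quotient (suc d) i (ℕ.s≤s i≤d))) (RawMagmaDefs._∣ʳ_.equality (a∣P i)))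
                 , (λ d<i → A.trans (A.*-congʳ (coeff-fromFun-≥ quotient (suc d) i d<i)) (A.trans (A.zeroˡ a) (A.sym (deg i d<i)))) ]′
                 (ℕ.≤-<-connex i d)
        e : ∀ i → coeff P i A.≈ coeff (Q *ₚ (a ∷ [])) i
        e i = A.trans (A.sym (Qa≈P i)) (A.trans (A.*-comm _ _) (A.trans (A.sym (coeff-scale a Q i)) (*ₚ-comm (a ∷ []) Q i)))
        rootQ : evΩ Q β ≈ 0#
        rootQ = [ id , (λ z → ⊥-elim (proj₂ (nonzero-factors Q (a ∷ []) e)
                  λ { zero → ψ-injective (trans (sym (ev-const a β)) z) ; (suc _) → A.refl })) ]′ (factor-root Q (a ∷ []) e)
        unit-coeff : (a ∷ []) ∣ₚ (A.1# ∷ []) → a ∣ₐ A.1#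
        unit-coeff (Y RawMagmaDefs., Ya≈1) = coeff Y 0 RawMagmaDefs.,
          A.trans (A.*-comm _ _) (A.trans (A.sym (coeff-scale a Y 0)) (A.trans (*ₚ-comm (a ∷ []) Y 0) (Ya≈1 0)))
      result : MinimalPolynomial d₀ H₀
      result = record
        { P = P ; degree = d ; hasDegree = deg , lead≉0 ; nonConstant = d≥1
        ; irreducible = RawSemiringDefs.mkIrred not-unit irreducible ; isPrimitive = isPrimitive
        ; leadDegree = h ; leadBound = emb-le⇒degree (proj₁ lead-exact) ; leadMonic = monic
        ; root = root ; degree≤ = d≤d₀ ; height = heightP
        ; height≤ = ℕ.≤-trans (ℤ.drop‿+≤+ (ex-le (Height.attained heightP) (DP _))) H≤H₀ }

    search : ∀ {d₀ H₀} P₀ → DegreeAtMost d₀ P₀ → (∀ i → D (coeff P₀ i) H₀) → Annihilates P₀ → MinimalPolynomial d₀ H₀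
    search {d₀} {H₀} P₀ deg₀ D₀ ann₀
      with least (λ d → Ann? d H₀) d₀ (ann P₀ deg₀ D₀ ann₀)
    ... | d , d≤d₀ , ann-d , d-least with least (Ann? d) H₀ ann-d
    ...   | H , H≤H₀ , ann-H , H-least with Any.satisfied ann-H
    ...     | (P₁ , deg₁ , DP₁) , P₁≉0 , root₁ =
      Minimal.result d≤d₀ d-least H≤H₀ H-least P₁ deg₁ DP₁ P₁≉0 root₁

    abstract
      minimalPolynomial : ∀ {d₀ H₀} P₀ → DegreeAtMost d₀ P₀ → (∀ i → D (coeff P₀ i) H₀) → Annihilates P₀ → MinimalPolynomial d₀ H₀
      minimalPolynomial = search

-- Polynomials with small values at ξ

-- The chain is `d + d³ ≤ 2 d³ ≤ d⁴ ≤ R²`. The `1` in `1 + d²` pays for the factor `T^E` in the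
-- value at `ξ`, and for the `1` in the exponent `−w* − 1`.
gap-bound : ∀ {d R} B → 2 ℕ.≤ d → d ℕ.* d ℕ.≤ R → suc (d ℕ.* d) ℕ.* (d ℕ.* B) ℕ.≤ R ℕ.* (R ℕ.* B)
gap-bound {d} {R} B d≥2 d²≤R = begin
  suc (d ℕ.* d) ℕ.* (d ℕ.* B)            ≡⟨ lemma d B ⟩
  (d ℕ.+ d ℕ.* d ℕ.* d) ℕ.* B            ≤⟨ ℕ.*-monoˡ-≤ B (ℕ.+-monoˡ-≤ (d ℕ.* d ℕ.* d) d≤d³) ⟩
  (d ℕ.* d ℕ.* d ℕ.+ d ℕ.* d ℕ.* d) ℕ.* B ≡⟨ lemma′ d B ⟩
  2 ℕ.* (d ℕ.* d ℕ.* d) ℕ.* B            ≤⟨ ℕ.*-monoˡ-≤ B (ℕ.*-monoˡ-≤ (d ℕ.* d ℕ.* d) d≥2) ⟩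
  d ℕ.* (d ℕ.* d ℕ.* d) ℕ.* B            ≡⟨ lemma″ d B ⟩
  (d ℕ.* d) ℕ.* ((d ℕ.* d) ℕ.* B)        ≤⟨ ℕ.*-mono-≤ d²≤R (ℕ.*-monoˡ-≤ B d²≤R) ⟩
  R ℕ.* (R ℕ.* B) ∎
  where
  open ℕ.≤-Reasoning
  d≤d³ : d ℕ.≤ d ℕ.* d ℕ.* d
  d≤d³ = ℕ.≤-trans (ℕ.≤-reflexive (≡.sym (ℕ.*-identityˡ d))) (ℕ.*-monoˡ-≤ d (ℕ.*-mono-≤ (ℕ.<⇒≤ d≥2) (ℕ.<⇒≤ d≥2)))
  open ℕ-Solver
  lemma : ∀ d B → suc (d ℕ.* d) ℕ.* (d ℕ.* B) ≡ (d ℕ.+ d ℕ.* d ℕ.* d) ℕ.* B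
  lemma = solve 2 (λ d B → (con 1 :+ d :* d) :* (d :* B) := (d :+ d :* d :* d) :* B) ≡.refl
  lemma′ : ∀ d B → (d ℕ.* d ℕ.* d ℕ.+ d ℕ.* d ℕ.* d) ℕ.* B ≡ 2 ℕ.* (d ℕ.* d ℕ.* d) ℕ.* B
  lemma′ = solve 2 (λ d B → (d :* d :* d :+ d :* d :* d) :* B := con 2 :* (d :* d :* d) :* B) ≡.refl
  lemma″ : ∀ d B → d ℕ.* (d ℕ.* d ℕ.* d) ℕ.* B ≡ (d ℕ.* d) ℕ.* ((d ℕ.* d) ℕ.* B)
  lemma″ = solve 2 (λ d B → d :* (d :* d :* d) :* B := (d :* d) :* ((d :* d) :* B)) ≡.refl

module Approximants {c ℓ} (K : CommutativeRing c ℓ) (F : LaurentField K) (p : ℕ) (p-prime : Prime p)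
    (char : Characteristic K p) where
  open LaurentField F
  open L hiding (zero)
  open Valuation K F
  open Approximation K F p p-prime char
  open Liouville K F p p-prime char
  open Polynomial A.rawRing
  open Series A using (coeff-+)
  open Convolution A using (monomial; coeff-monomial; coeff-monomial-≢)
  open Evaluation A L emb emb-hom
  private module emb = IsRingHomomorphism emb-hom
  open SemiringExp semiring using (_^_)
  open Solver L
  open SetoidReasoning setoid

  monomial-bounded : ∀ {H} a i → D a H → ∀ j → D (coeff (monomial a i) j) H
  monomial-bounded a zero    Da zero    = Da
  monomial-bounded a zero    Da (suc j) = D-0
  monomial-bounded a (suc i) Da zero    = D-0
  monomial-bounded a (suc i) Da (suc j) = monomial-bounded a i Da j

  module Lower (xi : Data) where
    open Bound xi

    record Approximating (j x : ℕ) : Set (c ⊔ ℓ) where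
      field
        P        : Poly
        E N      : ℕ
        x≤E      : x ℕ.≤ E
        gap      : suc (rⱼ j ℕ.* rⱼ j) ℕ.* E ℕ.≤ N
        degree   : DegreeAtMost (rⱼ j) P
        bounded  : ∀ i → D (coeff P i) E
        lead     : Ex (emb (coeff P (rⱼ j))) (+ E)
        value    : Ex (ev P ξ) (+ E ℤ.+ ℤ.- + N)
        β        : Carrier
        distance : Ex (ξ - β) (ℤ.- + N)
        root     : ev P β ≈ 0#

    -- The polynomial is `T^E (X^d − X − Φ d β)`, where `T^E` clears the denominator of `Φ d β`. The
    -- constant term is no larger than `T^E` because `Φ d β` lies in the unit ball, so the leading
    -- coefficient `T^E` fixes the height.
    approximation : ∀ j x → Approximating j x
    approximation j x = record
      { P = P ; E = E ; N = N ; x≤E = x≤E ; gap = gap-bound (R ℕ.^ k) d≥2 (rⱼ²≤ j)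
      ; degree = degree ; bounded = bounded
      ; lead = ex-cong (trans (sym (proj₂ t)) (emb.⟦⟧-cong (A.sym lead))) (ex-T^ (+ E))
      ; value = ex-cong (sym (ev-P ξ)) (ex-* (ex-T^ (+ E)) closeΦ)
      ; β = β ; distance = distance ; root = trans (ev-P β) (trans (*-congˡ (-‿inverseʳ (Φ d β))) (zeroʳ _)) }
      where
      open Tail j
      gaps = good-gap x
      k = proj₁ gaps
      N = R ℕ.^ suc (suc k)
      E = d ℕ.* R ℕ.^ k
      instance
        _ = ℕ.>-nonZero (ℕ.<⇒≤ R≥2)
      d≥2 : 2 ℕ.≤ d
      d≥2 = rⱼ≥2 j
      k<R^k : ∀ k → k ℕ.< R ℕ.^ k
      k<R^k zero    = ℕ.s≤s ℕ.z≤n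
      k<R^k (suc k) = ℕ.<-≤-trans (ℕ.s≤s (k<R^k k)) (ℕ.^-monoʳ-< R R≥2 (ℕ.n<1+n k))
      x≤E : x ℕ.≤ E
      x≤E = ℕ.≤-trans (proj₁ (proj₂ gaps)) (ℕ.≤-trans (ℕ.<⇒≤ (k<R^k k))
              (ℕ.≤-trans (ℕ.≤-reflexive (≡.sym (ℕ.*-identityˡ _))) (ℕ.*-monoˡ-≤ (R ℕ.^ k) (ℕ.<⇒≤ d≥2))))
      open Approximant (approximant (ℕ.m^n>0 R k) (ℕ.m^n>0 R (suc (suc k))) (proj₂ (proj₂ gaps)))
      t = T^-polynomial E
      τ = proj₁ t
      w = proj₁ rational
      Dτ : D τ E
      Dτ = le-cong (sym (proj₂ t)) (proj₁ (ex-T^ (+ E)))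
      Dw : D w E
      Dw = le-cong (sym (proj₂ rational)) (≡.subst (Le _) (ℤ.+-identityʳ (+ E)) (le-* (proj₁ (ex-T^ (+ E))) Φ-le))
      P₂ = monomial (A.- τ) 1 +ₚ monomial (A.- w) 0
      P = monomial τ d +ₚ P₂
      coeff-P : ∀ i → coeff P i A.≈ coeff (monomial τ d) i A.+ (coeff (monomial (A.- τ) 1) i A.+ coeff (monomial (A.- w) 0) i)
      coeff-P i = A.trans (coeff-+ (monomial τ d) P₂ i) (A.+-congˡ (coeff-+ (monomial (A.- τ) 1) (monomial (A.- w) 0) i))
      bounded : ∀ i → D (coeff P i) E
      bounded i = D-cong (A.sym (coeff-P i)) (D-+ (monomial-bounded τ d Dτ i)
        (D-+ (monomial-bounded (A.- τ) 1 (D-neg Dτ) i) (monomial-bounded (A.- w) 0 (D-neg Dw) i)))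
      low : ∀ i → 1 ℕ.< i → coeff (monomial (A.- τ) 1) i A.+ coeff (monomial (A.- w) 0) i A.≈ A.0#
      low i 1<i = A.trans (A.+-cong (coeff-monomial-≢ _ 1 i (ℕ.<⇒≢ 1<i)) (coeff-monomial-≢ _ 0 i (ℕ.<⇒≢ (ℕ.<-trans (ℕ.s≤s ℕ.z≤n) 1<i)))) (A.+-identityˡ _)
      degree : DegreeAtMost d P
      degree i d<i = A.trans (coeff-P i) (A.trans (A.+-cong (coeff-monomial-≢ τ d i (ℕ.<⇒≢ d<i)) (low i (ℕ.<-trans d≥2 d<i))) (A.+-identityˡ _))
      lead : coeff P d A.≈ τ
      lead = A.trans (coeff-P d) (A.trans (A.+-cong (coeff-monomial τ d) (low d d≥2)) (A.+-identityʳ _))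
      ev-P : ∀ x → ev P x ≈ T^ (+ E) * (Φ d x - Φ d β)
      ev-P x = begin
        ev P x ≈⟨ trans (ev-+ (monomial τ d) P₂ x) (+-congˡ (ev-+ (monomial (A.- τ) 1) (monomial (A.- w) 0) x)) ⟩
        ev (monomial τ d) x + (ev (monomial (A.- τ) 1) x + ev (monomial (A.- w) 0) x)
          ≈⟨ +-cong (trans (ev-monomial τ d x) (*-congʳ (proj₂ t)))
               (+-cong (trans (ev-monomial (A.- τ) 1 x) (*-congʳ (trans (emb.-‿homo τ) (-‿cong (proj₂ t)))))
                       (trans (ev-monomial (A.- w) 0 x) (*-congʳ (trans (emb.-‿homo w) (-‿cong (proj₂ rational)))))) ⟩
        T^ (+ E) * x ^ d + (- T^ (+ E) * (x * 1#) + - (T^ (+ E) * Φ d β) * 1#)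
          ≈⟨ solve 4 (λ t y x b → t :* y :+ (:- t :* (x :* :1) :+ :- (t :* b) :* :1) := t :* ((y :- x) :- b)) refl _ _ x _ ⟩
        T^ (+ E) * (Φ d x - Φ d β) ∎

    abstract
      approximating : ∀ j x → Approximating j x
      approximating = approximation

-- Rational exponents and infinitude

toℚᵘ-/1 : ∀ a → toℚᵘ (a / 1) ℚᵘ.≃ mkℚᵘ a 0
toℚᵘ-/1 a = ℚ.toℚᵘ-fromℚᵘ (mkℚᵘ a 0)

/1-* : ∀ a b → (a / 1) ℚ.* (b / 1) ≡ (a ℤ.* b) / 1
/1-* a b = ℚ.toℚᵘ-injective (ℚᵘ.≃-trans (ℚ.toℚᵘ-homo-* (a / 1) (b / 1))
  (ℚᵘ.≃-trans (ℚᵘ.*-cong (toℚᵘ-/1 a) (toℚᵘ-/1 b)) (ℚᵘ.≃-sym (toℚᵘ-/1 (a ℤ.* b)))))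

/1-neg : ∀ a → ℚ.- (a / 1) ≡ (ℤ.- a) / 1
/1-neg a = ℚ.toℚᵘ-injective (ℚᵘ.≃-trans (ℚ.toℚᵘ-homo‿- (a / 1))
  (ℚᵘ.≃-trans (ℚᵘ.-‿cong (toℚᵘ-/1 a)) (ℚᵘ.≃-sym (toℚᵘ-/1 (ℤ.- a)))))

/1-+ : ∀ a b → (a / 1) ℚ.+ (b / 1) ≡ (a ℤ.+ b) / 1
/1-+ a b = ℚ.toℚᵘ-injective (ℚᵘ.≃-trans (ℚ.toℚᵘ-homo-+ (a / 1) (b / 1))
  (ℚᵘ.≃-trans (ℚᵘ.+-cong (toℚᵘ-/1 a) (toℚᵘ-/1 b))
    (ℚᵘ.≃-trans (ℚᵘ.≃-reflexive (≡.cong (λ n → mkℚᵘ n 0) (≡.cong₂ ℤ._+_ (ℤ.*-identityʳ a) (ℤ.*-identityʳ b))))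
      (ℚᵘ.≃-sym (toℚᵘ-/1 (a ℤ.+ b))))))

/1-mono-≤ : ∀ {a b} → a ℤ.≤ b → a / 1 ℚ.≤ b / 1
/1-mono-≤ {a} {b} a≤b = ℚ.toℚᵘ-cancel-≤ (ℚᵘ.≤-respˡ-≃ (ℚᵘ.≃-sym (toℚᵘ-/1 a)) (ℚᵘ.≤-respʳ-≃ (ℚᵘ.≃-sym (toℚᵘ-/1 b))
  (*≤* (ℤ.*-monoʳ-≤-nonNeg (+ 1) a≤b))))

/1-cancel-≤ : ∀ {a b} → a / 1 ℚ.≤ b / 1 → a ℤ.≤ b
/1-cancel-≤ {a} {b} le with ℚᵘ.≤-respˡ-≃ (toℚᵘ-/1 a) (ℚᵘ.≤-respʳ-≃ (toℚᵘ-/1 b) (ℚ.toℚᵘ-mono-≤ le))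
... | *≤* a≤b = ≡.subst₂ ℤ._≤_ (ℤ.*-identityʳ a) (ℤ.*-identityʳ b) a≤b

/1-mono-< : ∀ {a b} → a ℤ.< b → a / 1 ℚ.< b / 1
/1-mono-< {a} {b} a<b = ℚ.toℚᵘ-cancel-< (ℚᵘ.<-respˡ-≃ (ℚᵘ.≃-sym (toℚᵘ-/1 a)) (ℚᵘ.<-respʳ-≃ (ℚᵘ.≃-sym (toℚᵘ-/1 b))
  (*<* (ℤ.*-monoʳ-<-pos (+ 1) a<b))))

archimedean : ∀ ρ → ∃[ n ] ρ ℚ.< + n / 1
archimedean ρ@(mkℚ a d _) = suc ℤ.∣ a ∣ , ℚ.toℚᵘ-cancel-< (ℚᵘ.<-respʳ-≃ (ℚᵘ.≃-sym (toℚᵘ-/1 (+ suc ℤ.∣ a ∣)))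
  (*<* (≡.subst (ℤ._< + suc ℤ.∣ a ∣ ℤ.* + suc d) (≡.sym (ℤ.*-identityʳ a)) (bound a))))
  where
  bound : ∀ a → a ℤ.< + suc ℤ.∣ a ∣ ℤ.* + suc d
  bound (+ n)    = ℤ.+<+ (ℕ.<-≤-trans (ℕ.n<1+n n) (ℕ.m≤m*n (suc n) (suc d)))
  bound -[1+ n ] = ℤ.-<+

-- The conditions on exponents in WSet and W*Set for integral data.
exponent-≤ : ∀ s h e → e ℤ.≤ ℤ.- + (s ℕ.* h) → e / 1 ℚ.≤ (ℚ.- (+ s / 1)) ℚ.* (+ h / 1)
exponent-≤ s h e le = ≡.subst (e / 1 ℚ.≤_) (≡.sym (≡.trans (≡.cong (ℚ._* (+ h / 1)) (/1-neg (+ s))) (/1-* (ℤ.- + s) (+ h))))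
  (/1-mono-≤ (≡.subst (e ℤ.≤_) (≡.trans (≡.cong ℤ.-_ (ℤ.pos-* s h)) (ℤ.neg-distribˡ-* (+ s) (+ h))) le))

exponent*-≤ : ∀ s h e → e ℤ.≤ ℤ.- + (suc s ℕ.* h) → e / 1 ℚ.≤ (ℚ.- (+ s / 1) ℚ.- 1ℚ) ℚ.* (+ h / 1)
exponent*-≤ s h e le = ≡.subst (λ ρ → e / 1 ℚ.≤ ρ ℚ.* (+ h / 1))
  (≡.trans (≡.cong (λ n → ℚ.- (+ n / 1)) (ℕ.+-comm 1 s)) (≡.trans (≡.cong ℚ.-_ (≡.sym (/1-+ (+ s) (+ 1)))) (ℚ.neg-distrib-+ (+ s / 1) (+ 1 / 1))))
  (exponent-≤ (suc s) h e le)

*-/1-nonNeg-mono : ∀ {ρ σ} h → ρ ℚ.≤ σ → ρ ℚ.* (+ h / 1) ℚ.≤ σ ℚ.* (+ h / 1)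
*-/1-nonNeg-mono h = ℚ.*-monoʳ-≤-nonNeg (+ h / 1) {{ℚ.nonNegative (/1-mono-≤ {+ 0} {+ h} (ℤ.+≤+ ℕ.z≤n))}}

exponent-bound : ∀ {B w ρ} h → + B / 1 ℚ.< w → ρ ℚ.≤ (ℚ.- w) ℚ.* (+ h / 1) → ρ ℚ.≤ (ℤ.- + (B ℕ.* h)) / 1
exponent-bound {B} {w} {ρ} h B<w le = ≡.subst (ρ ℚ.≤_)
  (≡.trans (≡.trans (≡.cong (ℚ._* (+ h / 1)) (/1-neg (+ B))) (/1-* (ℤ.- + B) (+ h)))
           (≡.cong (_/ 1) (≡.trans (≡.sym (ℤ.neg-distribˡ-* (+ B) (+ h))) (≡.cong ℤ.-_ (≡.sym (ℤ.pos-* B h))))))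
  (ℚ.≤-trans le (*-/1-nonNeg-mono h (ℚ.neg-antimono-≤ (ℚ.<⇒≤ B<w))))

-w-1≤-w : ∀ w → ℚ.- w ℚ.- 1ℚ ℚ.≤ ℚ.- w
-w-1≤-w w = ≡.subst (ℚ.- w ℚ.- 1ℚ ℚ.≤_) (ℚ.+-identityʳ (ℚ.- w)) (ℚ.+-monoʳ-≤ (ℚ.- w) (ℚ.neg-antimono-≤ {ℚ.0ℚ} {1ℚ} (/1-mono-≤ {+ 0} {+ 1} (ℤ.+≤+ ℕ.z≤n))))

-- Turns a sequence that eventually leaves every single value into a witness for `Infinitely`.
eventually-avoids : ∀ {a ℓ} {A : Set a} (_≈_ : Rel A ℓ) (f : ℕ → A) → (∀ y → ∃[ X ] ∀ x → X ℕ.≤ x → ¬ f x ≈ y) →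
                    ∀ ys → ∃[ X ] ∀ x → X ℕ.≤ x → ¬ Any (f x ≈_) ys
eventually-avoids _≈_ f avoid []       = 0 , λ _ _ ()
eventually-avoids _≈_ f avoid (y ∷ ys) with avoid y | eventually-avoids _≈_ f avoid ys
... | X , ≉y | Y , ∉ys = X ℕ.⊔ Y , λ
  { x X⊔Y≤x (here ≈y)   → ≉y x (ℕ.≤-trans (ℕ.m≤m⊔n X Y) X⊔Y≤x) ≈y
  ; x X⊔Y≤x (there ∈ys) → ∉ys x (ℕ.≤-trans (ℕ.m≤n⊔m X Y) X⊔Y≤x) ∈ys }

-- For `h ≥ 1` the affine bound `C (h + 1)` is at most `2 C h`; the extra `h` is the factor `H(P)`
-- lost between `∣ξ − α∣` and `∣P(ξ)∣`.
liouville-slack : ∀ C {h} → 1 ℕ.≤ h → h ℕ.+ C ℕ.* suc h ℕ.≤ suc (2 ℕ.* C) ℕ.* h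
liouville-slack C {h} h≥1 = ℕ.≤-trans (ℕ.+-monoʳ-≤ h (ℕ.*-monoʳ-≤ C (ℕ.+-monoˡ-≤ h h≥1))) (ℕ.≤-reflexive (lemma C h))
  where
  lemma : ∀ C h → h ℕ.+ C ℕ.* (h ℕ.+ h) ≡ suc (2 ℕ.* C) ℕ.* h
  lemma = solve 2 (λ C h → h :+ C :* (h :+ h) := (con 1 :+ con 2 :* C) :* h) ≡.refl
    where open ℕ-Solver

[]-injective : ∀ {x y : ℚ} → [ x ] ≡ [ y ] → x ≡ y
[]-injective ≡.refl = ≡.refl

-- The absolute value on the algebraic closure

record LogValue {c ℓ c₁ ℓ₁} (K : CommutativeRing c ℓ) (F : LaurentField K) (Ω : CommutativeRing c₁ ℓ₁) : Set (c ⊔ ℓ ⊔ c₁ ⊔ ℓ₁) where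
  private module L = CommutativeRing (LaurentField.L F)
  open CommutativeRing Ω
  field
    ι           : L.Carrier → Carrier
    ι-hom       : IsRingHomomorphism L.rawRing rawRing ι
    log∣_∣      : Carrier → ℚ ₋
    log-cong    : ∀ {x y} → x ≈ y → log∣ x ∣ ≡ log∣ y ∣
    log-0       : log∣ 0# ∣ ≡ ⊥₋
    log-⊥⇒0     : ∀ x → log∣ x ∣ ≡ ⊥₋ → x ≈ 0#
    log-*       : ∀ x y → log∣ x * y ∣ ≡ _+₋_ (CommutativeRing.rawRing K) log∣ x ∣ log∣ y ∣
    ultrametric : ∀ x y → log∣ x + y ∣ ≤₋ log∣ x ∣ ⊎ log∣ x + y ∣ ≤₋ log∣ y ∣
    extends     : ∀ ξ e → Valuation.Ex K F ξ e → log∣ ι ξ ∣ ≡ [ e / 1 ]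

module Closure {c ℓ} (K : CommutativeRing c ℓ) (F : LaurentField K) (p : ℕ) (p-prime : Prime p)
    (char : Characteristic K p)
    (inverse : HasInverses K) (finite : IsFinite K)
    {c₁ ℓ₁} {Ω : CommutativeRing c₁ ℓ₁} (isField : IsField Ω) (log : LogValue K F Ω) where
  open CommutativeRing Ω hiding (zero)
  open LogValue log
  private module K = CommutativeRing K
  open LaurentField F
  open Valuation K F
  open Approximation K F p p-prime char
  open Liouville K F p p-prime char
  open MinimalPolynomials K F p p-prime char inverse finite
  open Approximants K F p p-prime char
  open IsField isField using () renaming (1≉0 to Ω-1≉0)
  private
    module ι = IsRingHomomorphism ι-hom
    module emb = IsRingHomomorphism emb-hom
    module E = Evaluation A L emb emb-hom
  open Polynomial A.rawRing
  open Solver Ω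

  ψ : A.Carrier → Carrier
  ψ = ι ∘ emb

  ψ-hom : IsRingHomomorphism A.rawRing rawRing ψ
  ψ-hom = Composition.isRingHomomorphism trans emb-hom ι-hom

  open Evaluation A Ω ψ ψ-hom using () renaming (ev to evΩ; ev-cong to evΩ-cong)

  -- Bounds with integral exponents, as for `Le`, so that `ValuedEvaluation` applies although
  -- `log∣_∣` takes rational values.
  record LeΩ (x : Carrier) (e : ℤ) : Set where
    constructor mkLeΩ
    field log≤ : log∣ x ∣ ≤₋ [ e / 1 ]
  open LeΩ

  leΩ-cong : ∀ {x y e} → x ≈ y → LeΩ x e → LeΩ y e
  leΩ-cong {e = e} x≈y (mkLeΩ le) = mkLeΩ (≡.subst (_≤₋ [ e / 1 ]) (log-cong x≈y) le)

  leΩ-0 : ∀ {e} → LeΩ 0# e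
  leΩ-0 {e} = mkLeΩ (≡.subst (_≤₋ [ e / 1 ]) (≡.sym log-0) (⊥₋≤ _))

  leΩ-+ : ∀ {x y e} → LeΩ x e → LeΩ y e → LeΩ (x + y) e
  leΩ-+ {x} {y} (mkLeΩ x≤e) (mkLeΩ y≤e) = mkLeΩ ([ (λ le → ≤₋-trans ℚ.≤-trans le x≤e) , (λ le → ≤₋-trans ℚ.≤-trans le y≤e) ]′ (ultrametric x y))

  leΩ-* : ∀ {x y a b} → LeΩ x a → LeΩ y b → LeΩ (x * y) (a ℤ.+ b)
  leΩ-* {x} {y} {a} {b} (mkLeΩ x≤a) (mkLeΩ y≤b) = mkLeΩ (≡.subst (_≤₋ [ (a ℤ.+ b) / 1 ]) (≡.sym (log-* x y)) (add x≤a y≤b))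
    where
    add : ∀ {u v} → u ≤₋ [ a / 1 ] → v ≤₋ [ b / 1 ] → _+₋_ K.rawRing u v ≤₋ [ (a ℤ.+ b) / 1 ]
    add (⊥₋≤ _) _        = ⊥₋≤ _
    add [ _ ]≤   (⊥₋≤ _)  = ⊥₋≤ _
    add [ u≤a ]≤ [ v≤b ]≤  = [ ≡.subst (_ ℚ.≤_) (/1-+ a b) (ℚ.+-mono-≤ u≤a v≤b) ]≤

  leΩ-mono : ∀ {x a b} → a ℤ.≤ b → LeΩ x a → LeΩ x b
  leΩ-mono a≤b (mkLeΩ x≤a) = mkLeΩ (≤₋-trans ℚ.≤-trans x≤a [ /1-mono-≤ a≤b ]≤)

  -- The absolute value decides equality in the closure, since its logarithm is `⊥₋` exactly at 0.
  zero? : ∀ x → Dec (x ≈ 0#)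
  zero? x with log∣ x ∣ in eq
  ... | ⊥₋    = yes (log-⊥⇒0 x eq)
  ... | [ v ] = no λ z → absurd (≡.trans (≡.sym eq) (≡.trans (log-cong z) log-0))
    where
    absurd : [ v ] ≡ ⊥₋ → ⊥
    absurd ()

  []≢⊥₋ : ∀ {v : ℚ} → [ v ] ≡ ⊥₋ → ⊥
  []≢⊥₋ ()

  Ω-cancel : ∀ {x y} → ¬ x ≈ 0# → x * y ≈ 0# → y ≈ 0#
  Ω-cancel {x} {y} x≉0 xy≈0 with inverse′ x x≉0
    where inverse′ = IsField.inverse isField
  ... | z , xz≈1 = trans (sym (*-identityˡ y)) (trans (*-congʳ (sym xz≈1))
          (trans (solve 3 (λ x y z → (x :* z) :* y := z :* (x :* y)) refl x y z) (trans (*-congˡ xy≈0) (zeroʳ z))))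

  Ω-domain : ∀ {x y} → x * y ≈ 0# → x ≈ 0# ⊎ y ≈ 0#
  Ω-domain {x} xy≈0 with zero? x
  ... | yes x≈0 = inj₁ x≈0
  ... | no x≉0  = inj₂ (Ω-cancel x≉0 xy≈0)

  ψ-injective : ∀ {a} → ψ a ≈ 0# → a A.≈ A.0#
  ψ-injective {a} z with zero-or-degree a
  ... | inj₁ a≈0      = a≈0
  ... | inj₂ (h , ex) = ⊥-elim ([]≢⊥₋ (≡.trans (≡.sym (extends (emb a) (+ h) ex)) (≡.trans (log-cong z) log-0)))

  -- The axiom `extends` speaks of exact absolute values, which `ζ` need not be known to have. The
  -- conclusion is decidable, however, and its failure would force every coefficient of `ζ` to
  -- vanish.
  ι-le : ∀ {ζ e} → Le ζ e → LeΩ (ι ζ) e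
  ι-le {ζ} {e} ζ≤e = mkLeΩ (decidable-stable (≤₋-dec ℚ._≤?_ _ _) λ ≰ → ≰ (log≤ (leΩ-cong (sym (trans (ι.⟦⟧-cong (ζ≈0 ≰)) ι.0#-homo)) (leΩ-0 {e}))))
    where
    ζ≈0 : ¬ log∣ ι ζ ∣ ≤₋ [ e / 1 ] → ζ L.≈ L.0#
    ζ≈0 ≰ = coef-ext λ n → K.trans (decidable-stable (_ ≟ _) λ ≉ → large n ≉) (K.sym (coef-0 n))
      where
      large : ∀ n → ¬ coef ζ n K.≈ K.0# → ⊥
      large n ≉ with find-ex ζ n ≉
      ... | e′ , ex , _ = ≰ (≡.subst (_≤₋ [ e / 1 ]) (≡.sym (extends ζ e′ ex)) [ /1-mono-≤ (ex-le ex ζ≤e) ]≤)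

  ι-le⁻¹ : ∀ {ζ e} → LeΩ (ι ζ) e → Le ζ e
  ι-le⁻¹ {ζ} {e} (mkLeΩ ιζ≤e) = mkLe λ n n<-e → decidable-stable (_ ≟ _) λ ≉ → small n n<-e ≉
    where
    small : ∀ n → n ℤ.< ℤ.- e → ¬ coef ζ n K.≈ K.0# → ⊥
    small n n<-e ≉ with find-ex ζ n ≉
    ... | e′ , ex , -n≤e′ = ℤ.<⇒≱ (ℤ.<-≤-trans (≡.subst (ℤ._< ℤ.- n) (ℤ.neg-involutive e) (ℤ.neg-mono-< n<-e)) -n≤e′)
            (/1-cancel-≤ ([≤]-injective (≡.subst (_≤₋ [ e / 1 ]) (extends ζ e′ ex) ιζ≤e)))

  -- The absolute value of -1 is read off from the Laurent series -1.
  leΩ-neg : ∀ {x e} → LeΩ x e → LeΩ (- x) e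
  leΩ-neg {x} {e} x≤e = leΩ-cong
    (trans (*-congʳ (trans (ι.-‿homo L.1#) (-‿cong ι.1#-homo))) (solve 1 (λ x → :- :1 :* x := :- x) refl x))
    (≡.subst (LeΩ _) (ℤ.+-identityˡ e) (leΩ-* (ι-le (le-neg (proj₁ ex-1))) x≤e))

  open ValuedEvaluation A Ω ψ LeΩ leΩ-cong leΩ-0 leΩ-+ leΩ-* using () renaming (ev-diff-le to evΩ-diff-le)

  module Roots′ = Roots Ω

  eval-map-ψ : ∀ P x → (map ψ P) Roots′.⟦ x ⟧ ≡ evΩ P x
  eval-map-ψ []      x = ≡.refl
  eval-map-ψ (a ∷ P) x = ≡.cong (λ y → ψ a + x * y) (eval-map-ψ P x)

  map-ψ-zero : ∀ P → Roots′.Zero (map ψ P) → Zero P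
  map-ψ-zero []      z i       = A.refl
  map-ψ-zero (a ∷ P) z zero    = ψ-injective (z 0)
  map-ψ-zero (a ∷ P) z (suc i) = map-ψ-zero P (z ∘ suc) i

  x-y≈0⇒x≈y : ∀ {x y} → x - y ≈ 0# → x ≈ y
  x-y≈0⇒x≈y {x} {y} e = trans (solve 2 (λ x y → x := (x :- y) :+ y) refl x y) (trans (+-congʳ e) (+-identityˡ y))

  _≟Ω_ : ∀ x y → Dec (x ≈ y)
  x ≟Ω y with zero? (x - y)
  ... | yes z = yes (x-y≈0⇒x≈y z)
  ... | no ≉  = no λ e → ≉ (trans (+-congʳ e) (-‿inverseʳ y))

  finite-roots : ∀ Ps → ¬ ¬ (∃[ xs ] (∀ x → Any (λ P → ¬ Zero P × evΩ P x ≈ 0#) Ps → Any (x ≈_) xs))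
  finite-roots []       k = k ([] , λ _ ())
  finite-roots (P ∷ Ps) k = finite-roots Ps λ (xs , roots) → extendRoots xs roots (Zero? P)
    where
    extendRoots : ∀ xs → (∀ x → Any (λ P → ¬ Zero P × evΩ P x ≈ 0#) Ps → Any (x ≈_) xs) → Dec (Zero P) → ⊥
    extendRoots xs roots (yes P≈0) = k (xs , λ { x (here (P≉0 , _)) → ⊥-elim (P≉0 P≈0) ; x (there ∈Ps) → roots x ∈Ps })
    extendRoots xs roots (no P≉0)  = Roots′.finitely-many-roots _≟Ω_
      (λ x≉y z → Ω-cancel (x≉y ∘ x-y≈0⇒x≈y)) (length (map ψ P)) (map ψ P) ℕ.≤-refl (P≉0 ∘ map-ψ-zero P)
      λ (ys , P-roots) → k (ys ++ xs , λ
        { x (here (_ , root)) → Any.++⁺ˡ (P-roots x (trans (reflexive (eval-map-ψ P x)) root))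
        ; x (there ∈Ps)       → Any.++⁺ʳ ys (roots x ∈Ps) })

  module Star (xi : Data) where
    open Bound xi
    open Lower xi
    open Approximating

    α* : ∀ j x → Carrier
    α* j x = ι (β (approximating j x))

    distance* : ∀ j x → log∣ ι ξ - α* j x ∣ ≡ [ (ℤ.- + N (approximating j x)) / 1 ]
    distance* j x = ≡.trans (log-cong (sym (trans (ι.+-homo ξ _) (+-congˡ (ι.-‿homo _)))))
                            (extends _ _ (distance (approximating j x)))

    minimal* : ∀ j x → MinimalPolynomial Ω Ω-1≉0 zero? Ω-domain ψ ψ-hom ψ-injective (α* j x) (rⱼ j) (E (approximating j x))
    minimal* j x = minimalPolynomial Ω Ω-1≉0 zero? Ω-domain ψ ψ-hom ψ-injective (α* j x) (P g) (degree g) (bounded g)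
      ( (λ z → ex⇒≉0 (lead g) (L.trans (emb.⟦⟧-cong (z (rⱼ j))) emb.0#-homo))
      , trans (sym (E.hom-ev Ω ι ι-hom (P g) (β g))) (trans (ι.⟦⟧-cong (root g)) ι.0#-homo))
      where g = approximating j x

    x≤N : ∀ j x → x ℕ.≤ N (approximating j x)
    x≤N j x = ℕ.≤-trans (x≤E g) (ℕ.≤-trans (ℕ.m≤m+n (E g) _) (gap g))
      where g = approximating j x

    -- A fixed `y` has a fixed distance to `ξ`, possibly 0, while the distances of the `α* j x` are
    -- nonzero and tend to 0 as `x` grows.
    α*-avoids : ∀ j y → ∃[ X ] ∀ x → X ℕ.≤ x → ¬ α* j x ≈ y
    α*-avoids j y with log∣ ι ξ - y ∣ in eq
    ... | ⊥₋    = 0 , λ x _ e → []≢⊥₋ (≡.trans (≡.sym (distance* j x)) (≡.trans (log-cong (+-congˡ (-‿cong e))) eq))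
    ... | [ v ] with archimedean (ℚ.- v)
    ...   | n , -v<n = n , λ x n≤x e → far x n≤x ([]-injective (≡.trans (≡.sym eq) (≡.trans (log-cong (+-congˡ (-‿cong (sym e)))) (distance* j x))))
      where
      far : ∀ x → n ℕ.≤ x → ¬ v ≡ (ℤ.- + N (approximating j x)) / 1
      far x n≤x v≡ = ℚ.<-irrefl ≡.refl (ℚ.<-≤-trans -v<n (≡.subst (+ n / 1 ℚ.≤_)
        (≡.sym (≡.trans (≡.cong ℚ.-_ v≡) (≡.trans (/1-neg (ℤ.- + N (approximating j x))) (≡.cong (_/ 1) (ℤ.neg-involutive (+ N (approximating j x)))))))
        (/1-mono-≤ (ℤ.+≤+ (ℕ.≤-trans n≤x (x≤N j x))))))

    exponent* : ∀ n → ℕ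
    exponent* n = suc (2 ℕ.* proj₁ (liouville n))

    -- The estimate for `P(ξ) − P(x)` applies because `x`, being close to `ξ`, lies in the unit
    -- ball. The resulting bound on `P(ξ)` contradicts `liouville` by `liouville-slack`.
    far-from-roots : ∀ n P x H e → DegreeAtMost n P → ¬ Zero P → (∀ i → D (coeff P i) H) → evΩ P x ≈ 0# → 1 ℕ.≤ H →
                     log∣ ι ξ - x ∣ ≡ [ e ] → ¬ e ℚ.≤ (ℤ.- + (exponent* n ℕ.* H)) / 1
    far-from-roots n P x H e deg P≉0 DP root H≥1 eq e≤ = proj₂ (liouville n) P deg P≉0 H DP
      (le-mono bound (ι-le⁻¹ (leΩ-cong at-ξ (evΩ-diff-le P (ι-le ∘ DP) ξ≤0 x≤0 close))))
      where
      C = proj₁ (liouville n)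
      close : LeΩ (ι ξ - x) (ℤ.- + (exponent* n ℕ.* H))
      close = mkLeΩ (≡.subst (_≤₋ [ (ℤ.- + (exponent* n ℕ.* H)) / 1 ]) (≡.sym eq) [ e≤ ]≤)
      ξ≤0 : LeΩ (ι ξ) (+ 0)
      ξ≤0 = ι-le ξ-le
      x≤0 : LeΩ x (+ 0)
      x≤0 = leΩ-cong (solve 2 (λ a x → a :+ :- (a :- x) := x) refl (ι ξ) x) (leΩ-+ ξ≤0 (leΩ-neg (leΩ-mono ℤ.neg-≤-pos close)))
      at-ξ : evΩ P (ι ξ) - evΩ P x ≈ ι (E.ev P ξ)
      at-ξ = trans (+-congˡ (trans (-‿cong root) (solve 0 (:- :0 := :0) refl))) (trans (+-identityʳ _) (sym (E.hom-ev Ω ι ι-hom P ξ)))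
      bound : ℤ.- + (exponent* n ℕ.* H) ℤ.+ + H ℤ.≤ ℤ.- + (C ℕ.* suc H)
      bound = ≡.subst (ℤ._≤ ℤ.- + (C ℕ.* suc H)) (ℤ.+-comm (+ H) (ℤ.- + (exponent* n ℕ.* H))) (+-≤⇒--≤ (liouville-slack C H≥1))

    -- These are the points at which `H = 1`, where the condition with `H^(−w*−1)` reads the same
    -- for every `w*`.
    constant-roots : ∀ n → ¬ ¬ (∃[ xs ] (∀ P x → DegreeAtMost n P → ¬ Zero P → (∀ i → D (coeff P i) 0) → evΩ P x ≈ 0# → Any (x ≈_) xs))
    constant-roots n k = finite-roots (constants n) λ (xs , roots) → k (xs , λ P x deg P≉0 DP root → roots x
      (Any.map (λ {Q} e → (λ z → P≉0 λ i → A.trans (e i) (z i)) , trans (sym (evΩ-cong P Q e refl)) root) (constants-complete n P deg DP)))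

-- The exponents of ξ over the finite field

module Setting {c ℓ} {p q s : ℕ} (p-prime : Prime p) (q≡p^s : q ≡ p ℕ.^ s) (𝔽q : FiniteField q c ℓ) where
  open FiniteField 𝔽q using () renaming (commutativeRing to K; rawRing to k)
  private module K = CommutativeRing K
  module 𝔽 = FiniteFieldProperties 𝔽q

  F : LaurentField K
  F = LaurentFieldInstance.laurentField K 𝔽.1≉0 𝔽._≟_ 𝔽.x*y≈0⇒x≈0∨y≈0

  char : Characteristic K p
  char = 𝔽.p×1≈0 p s q≡p^s

  elements : IsFinite K
  elements = map 𝔽.to (allFin q) , λ x → Any.map⁺ (Any.map (λ { ≡.refl → K.sym (𝔽.strictlyInverseˡ x) }) (∈-allFin (𝔽.from x)))

  open LaurentSeries k
  open Exponents k
  open LaurentField F using (A; L)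
  open Valuation K F
  open Approximation K F p p-prime char
  open Liouville K F p p-prime char
  open MinimalPolynomials K F p p-prime char 𝔽.inverse elements
  open Approximants K F p p-prime char

  ≤⇒Le : ∀ {ξ e} → ∣ ξ ∣≤q^ e → Le ξ e
  ≤⇒Le = mkLe

  Ex⇒≡ : ∀ {ξ e} → Ex ξ e → ∣ ξ ∣≡q^ e
  Ex⇒≡ (le , ≉) = vanish le , ≉

  partialSum≡psum : ∀ f n → partialSum f n ≡ psum f n
  partialSum≡psum f zero    = ≡.refl
  partialSum≡psum f (suc n) = ≡.cong (_+ₗ f n) (partialSum≡psum f n)

  difference-Le : ∀ σ s e → ∣ σ +ₗ RawRing.-_ laurentRawRing s ∣≤q^ e → Le (σ L.- s) e
  difference-Le σ s e h = ≤⇒Le {ξ = σ +ₗ RawRing.-_ laurentRawRing s} h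

  hasSum⇒Sum : ∀ {f s} → HasSum f s → Sum f s
  hasSum⇒Sum {f} {s} lim M = proj₁ (lim M) , λ n N≤n →
    ≡.subst (λ σ → Le (σ L.- s) (ℤ.- + M)) (partialSum≡psum f n)
      (difference-Le (partialSum f n) s (ℤ.- + M) (proj₂ (lim M) n N≤n))

  -- A nonzero polynomial in T has absolute value at least 1.
  natural-height : ∀ P {h} → HasHeight P h → ∃[ H ] h ≡ + H × (∀ i → D (k[T][X].coeff P i) H)
  natural-height P {+ H}      (bound , _)          = H , ≡.refl , λ i → ≤⇒Le {ξ = embed (k[T][X].coeff P i)} (bound i)
  natural-height P { -[1+ H ]} (_ , i , _ , lead) = ⊥-elim (lead (LaurentField.coef-emb-pos F (k[T][X].coeff P i) H))

  height-nonzero : ∀ P {h} → HasHeight P h → ¬ Zero P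
  height-nonzero P {h} (_ , i , _ , lead) z = lead (K.trans (IsRingHomomorphism.⟦⟧-cong (LaurentField.emb-hom F) {k[T][X].coeff P i} {[]} (z i) (ℤ.- h))
    (LaurentField.coef-0 F (ℤ.- h)))

  module Theorem {r a m ξ} (a≥1 : 1 ℕ.≤ a) (r≡p^a : r ≡ p ℕ.^ a) (m₀≡1 : m 0 ≡ 1) (m≥2 : ∀ j → 1 ℕ.≤ j → 2 ℕ.≤ m j)
                 (isXi : IsXi k r m ξ) where

    xi : Data
    xi = record
      { r = r ; a = a ; a≥1 = a≥1 ; r≡p^a = r≡p^a ; m = m ; m₀≡1 = m₀≡1 ; m≥2 = m≥2 ; ξ = ξ ; α = proj₁ isXi
      ; α-sum = λ j → hasSum⇒Sum (proj₁ (proj₂ isXi) j) ; ξ-sum = hasSum⇒Sum (proj₂ (proj₂ isXi)) }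

    open Bound xi using (rⱼ; rⱼ≥2; j<rⱼ; liouville)
    open Lower xi
    open Approximating

    -- The leading coefficient has exact degree `E ≥ x` in `T`. Once `x` reaches the length of the
    -- corresponding coefficient list of `Q`, the two polynomials differ.
    approximating-avoids : ∀ j Q → ∃[ X ] ∀ x → X ℕ.≤ x → ¬ (∀ i → k[T][X].coeff (P (approximating j x)) i A.≈ k[T][X].coeff Q i)
    approximating-avoids j Q = length (k[T][X].coeff Q (rⱼ j)) , λ x X≤x e →
      proj₂ (lead (approximating j x)) (K.trans (LaurentField.coef-emb-neg F (k[T][X].coeff (P (approximating j x)) (rⱼ j)) (E (approximating j x)))
        (K.trans (e (rⱼ j) (E (approximating j x)))
          (Convolution.coeff-length K (k[T][X].coeff Q (rⱼ j)) (E (approximating j x)) (ℕ.≤-trans X≤x (x≤E (approximating j x))))))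

    wₙ-lower : ∀ j → WSet (rⱼ j) ξ (+ (rⱼ j ℕ.* rⱼ j) / 1)
    wₙ-lower j Qs = P g , (degree g , + E g , + E g ℤ.+ ℤ.- + N g
                          , ((λ i → vanish (bounded g i)) , rⱼ j , Ex⇒≡ (lead g)) , Ex⇒≡ (value g)
                          , exponent-≤ (rⱼ j ℕ.* rⱼ j) (E g) _ (+-≤⇒--≤ {E g} {N g} (gap g)))
                        , proj₂ avoiding (proj₁ avoiding) ℕ.≤-refl
      where
      module A[X] = RawRing k[T][X].polyRawRing
      avoiding : ∃[ X ] ∀ x → X ℕ.≤ x → ¬ Any (P (approximating j x) A[X].≈_) Qs
      avoiding = eventually-avoids A[X]._≈_ (λ x → P (approximating j x)) (approximating-avoids j) Qs
      g : Approximating j (proj₁ avoiding)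
      g = approximating j (proj₁ avoiding)

    square-bound : ∀ {Q d} → Q ℕ.< d → (+ Q / 1) ℚ.* (+ d / 1) ℚ.< + (d ℕ.* d) / 1
    square-bound {Q} {d} Q<d = ≡.subst (ℚ._< + (d ℕ.* d) / 1) (≡.sym (≡.trans (/1-* (+ Q) (+ d)) (≡.cong (_/ 1) (≡.sym (ℤ.pos-* Q d)))))
      (/1-mono-< (ℤ.+<+ (ℕ.*-monoˡ-< d {{ℕ.>-nonZero (ℕ.≤-<-trans ℕ.z≤n Q<d)}} Q<d)))

    -- At degree `d = r_j` the exponent `d²` leaves `d` after division by the degree. As `j < r_j`,
    -- taking `j` at least `N₀` and `Q` makes degree and quotient large at once. A general `W`
    -- covers both kinds of exponents.
    limsup≡+∞ : ∀ {ℓ′} (W : ℕ → Pred ℚ ℓ′) → (∀ j → W (rⱼ j) (+ (rⱼ j ℕ.* rⱼ j) / 1)) →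
                limsup (λ n → sup (W (suc n)) ÷ suc n) ≡+∞
    limsup≡+∞ W W-lower ρ = + Q / 1 , proj₂ (archimedean ρ) , λ N₀ → n N₀ , N₀≤n N₀
             , ≡.subst (λ d → sup (W d) ((+ Q / 1) ℚ.* (+ d / 1))) (≡.sym (d≡ N₀))
                   (_ , W-lower (j N₀) , square-bound (ℕ.≤-<-trans (ℕ.m≤n⊔m N₀ Q) (j<rⱼ (j N₀))))
      where
      Q = proj₁ (archimedean ρ)
      j n : ℕ → ℕ
      j N₀ = N₀ ℕ.⊔ Q
      -- The upper limit is indexed so that `n` stands for degree `n + 1`.
      n N₀ = ℕ.pred (rⱼ (j N₀))
      d≡ : ∀ N₀ → suc (n N₀) ≡ rⱼ (j N₀)
      d≡ N₀ = ℕ.suc-pred (rⱼ (j N₀)) {{ℕ.>-nonZero (ℕ.<⇒≤ (rⱼ≥2 (j N₀)))}}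
      N₀≤n : ∀ N₀ → N₀ ℕ.≤ n N₀
      N₀≤n N₀ = ℕ.≤-trans (ℕ.m≤m⊔n N₀ Q) (ℕ.≤-pred (≡.subst (j N₀ ℕ.<_) (≡.sym (d≡ N₀)) (j<rⱼ (j N₀))))

    wₙ<+∞ : ∀ n → wₙ n ξ <+∞
    -- Asking for a polynomial outside `constants n` guarantees `H ≥ 1`, so that `liouville-slack`
    -- applies.
    wₙ<+∞ n = + suc (2 ℕ.* C) / 1 , λ (w′ , inf , B<w) → contradictory w′ B<w (inf (constants n))
      where
      C = proj₁ (liouville n)
      positive : ∀ w′ P h e H → + suc (2 ℕ.* C) / 1 ℚ.< w′ → k[T][X].DegreeAtMost n P → HasHeight P h → ∣ P ⟨ ξ ⟩ ∣≡q^ e →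
                 e / 1 ℚ.≤ (ℚ.- w′) ℚ.* (h / 1) → h ≡ + H → (∀ i → D (k[T][X].coeff P i) H) → 1 ℕ.≤ H → ⊥
      positive w′ P h e H B<w deg hh ex e≤ ≡.refl DP H≥1 = proj₂ (liouville n) P deg (height-nonzero P hh) H DP
        (le-mono (ℤ.≤-trans (/1-cancel-≤ (exponent-bound {suc (2 ℕ.* C)} H B<w e≤))
                   (ℤ.neg-mono-≤ (ℤ.+≤+ (ℕ.≤-trans (ℕ.m≤n+m _ H) (liouville-slack C H≥1)))))
                 (mkLe (proj₁ ex)))
      contradictory : ∀ w′ → + suc (2 ℕ.* C) / 1 ℚ.< w′ → _ → ⊥
      contradictory w′ B<w (P , (deg , h , e , hh , ex , e≤) , ∉constants) = cases (natural-height P hh)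
        where
        cases : (∃[ H ] h ≡ + H × (∀ i → D (k[T][X].coeff P i) H)) → ⊥
        cases (zero , _ , DP)        = ∉constants (constants-complete n P deg DP)
        cases (suc H , h≡ , DP) = positive w′ P h e (suc H) B<w deg hh ex e≤ h≡ DP (ℕ.s≤s ℕ.z≤n)

    isTNumber : IsTNumber ξ
    isTNumber = limsup≡+∞ (λ n → WSet n ξ) wₙ-lower , λ n _ → wₙ<+∞ n

    module _ {c₁ ℓ₁} (Ω : AlgebraicClosure k c₁ ℓ₁) (abs : AbsoluteValue k Ω) where
      private module Ω = AlgebraicClosure Ω
      open AbsoluteValue abs

      logValue : LogValue K F Ω.commutativeRing
      logValue = record
        { ι = Ω.ι ; ι-hom = Ω.ι-isHomomorphism ; log∣_∣ = log∣_∣ ; log-cong = log-cong ; log-0 = log-0 ; log-⊥⇒0 = log-⊥⇒0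
        ; log-* = log-* ; ultrametric = ultrametric ; extends = λ ζ e ex → extends ζ e (Ex⇒≡ ex) }

      open Closure K F p p-prime char 𝔽.inverse elements Ω.isField logValue
      open Star xi
      private module Min = MinimalPolynomial

      isMinimalPolynomial : ∀ j x → IsMinimalPolynomial Ω abs (Min.P (minimal* j x)) (α* j x)
      isMinimalPolynomial j x = record
        { degree = Min.degree μ ; hasDegree = Min.hasDegree μ ; nonConstant = Min.nonConstant μ
        ; irreducible = Min.irreducible μ ; isPrimitive = Min.isPrimitive μ
        ; leadingMonic = Min.leadDegree μ , (Min.leadBound μ , λ z → 𝔽.1≉0 (K.trans (K.sym (Min.leadMonic μ)) z)) , Min.leadMonic μ
        ; root = Min.root μ }
        where μ = minimal* j x

      -- Passing to the minimal polynomial does not raise the bounds on degree and height, so the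
      -- gap between `E` and `N` still yields the exponent.
      w*ₙ-lower : ∀ j → W*Set Ω abs (rⱼ j) ξ (+ (rⱼ j ℕ.* rⱼ j) / 1)
      w*ₙ-lower j xs = α* j X , (Min.P μ , isMinimalPolynomial j X
          , (λ i d<i → proj₁ (Min.hasDegree μ) i (ℕ.≤-<-trans (Min.degree≤ μ) d<i))
          , + Height.height (Min.height μ) , (ℤ.- + N (approximating j X)) / 1
          , ((λ i → vanish (Height.bounded (Min.height μ) i)) , Height.i₀ (Min.height μ) , Ex⇒≡ (Height.attained (Min.height μ)))
          , distance* j X
          , exponent*-≤ (rⱼ j ℕ.* rⱼ j) (Height.height (Min.height μ)) (ℤ.- + N (approximating j X))
              (ℤ.neg-mono-≤ (ℤ.+≤+ (ℕ.≤-trans (ℕ.*-monoʳ-≤ (suc (rⱼ j ℕ.* rⱼ j)) (Min.height≤ μ)) (gap (approximating j X))))))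
        , proj₂ avoiding X ℕ.≤-refl
        where
        avoiding : ∃[ X ] ∀ x → X ℕ.≤ x → ¬ Any (α* j x Ω.≈_) xs
        avoiding = eventually-avoids Ω._≈_ (α* j) (α*-avoids j) xs
        X = proj₁ avoiding
        μ = minimal* j X

      w*ₙ<+∞ : ∀ n → w*ₙ Ω abs n ξ <+∞
      -- The goal is a contradiction, so the list promised by `constant-roots` may be assumed and
      -- handed to `inf`.
      w*ₙ<+∞ n = + exponent* n / 1 , λ (w′ , inf , B<w) → constant-roots n λ (xs , roots) → contradictory w′ B<w xs roots (inf xs)
        where
        contradictory : ∀ w′ → + exponent* n / 1 ℚ.< w′ → ∀ xs →
          (∀ P x → k[T][X].DegreeAtMost n P → ¬ Zero P → (∀ i → D (k[T][X].coeff P i) 0) →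
             k[T][X].eval Ω.rawRing (λ a → Ω.ι (embed a)) P x Ω.≈ Ω.0# → Any (x Ω.≈_) xs) → _ → ⊥
        contradictory w′ B<w xs roots (α , (P , min , deg , h , e , hh , eq , e≤) , ∉xs) = cases (natural-height P hh)
          where
          α-root = IsMinimalPolynomial.root min
          cases : (∃[ H ] h ≡ + H × (∀ i → D (k[T][X].coeff P i) H)) → ⊥
          cases (zero , _ , DP)   = ∉xs (roots P α deg (height-nonzero P hh) DP α-root)
          cases (suc H , h≡ , DP) = far-from-roots n P α (suc H) e deg (height-nonzero P hh) DP α-root (ℕ.s≤s ℕ.z≤n) eq
            (exponent-bound {exponent* n} (suc H) B<w (ℚ.≤-trans (≡.subst (λ h → e ℚ.≤ (ℚ.- w′ ℚ.- 1ℚ) ℚ.* (h / 1)) h≡ e≤)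
              (*-/1-nonNeg-mono (suc H) (-w-1≤-w w′))))

      isT*Number : IsT*Number Ω abs ξ
      isT*Number = limsup≡+∞ (λ n → W*Set Ω abs n ξ) w*ₙ-lower , λ n _ → w*ₙ<+∞ n

open import Data.Nat.Base using (_^_; _≤_)

theorem2p1 : ∀ {c ℓ c₁ ℓ₁} (p q r s a : ℕ) → Prime p → 1 ≤ s → q ≡ p ^ s → 1 ≤ a → r ≡ p ^ a →
    (𝔽q : FiniteField q c ℓ) →
    let open FiniteField 𝔽q using () renaming (rawRing to k) in
    let open LaurentSeries k using (Laurent) in
    let open Exponents k in
    (m : ℕ → ℕ) → m 0 ≡ 1 → (∀ j → 1 ≤ j → 2 ≤ m j) →
    (ξ : Laurent) → IsXi k r m ξ →
    IsTNumber ξ ×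
    ((Ω : AlgebraicClosure k c₁ ℓ₁) (abs : AbsoluteValue k Ω) → IsT*Number Ω abs ξ)
theorem2p1 p q r s a p-prime s≥1 q≡p^s a≥1 r≡p^a 𝔽q m m₀≡1 m≥2 ξ isXi = T.isTNumber , T.isT*Number
  where module T = Setting.Theorem {s = s} p-prime q≡p^s 𝔽q {r} {a} {m} {ξ} a≥1 r≡p^a m₀≡1 m≥2 isXi
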